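{- Let $n$ be a positive integer and let $S=S_1\cup S_2\subseteq T_{8n}\setminus\{e\}$, where $S_1=\{b^2,a^nb^2\}$ and $S_2=\langle a\rangle b\cup\langle a\rangle b^3$ (so that $S=S^{ -1}$). Then the normal Cayley graph $\mathrm{Cay}(T_{8n},S)$ is a connected integral graph, whose spectrum is $$\mathrm{Spec}(\mathrm{Cay}(T_{8n},S))=\left\{[-4n+2],\,[4n+2],\,[2]^{2n-2},\,[-2]^{2n},\,[0]^{4n}\right\}.$$
   Context: $T_{8n}=\langle a,b\mid a^{2n}=b^8=e,\ a^n=b^4,\ b^{ -1}ab=a^{ -1}\rangle$ is a group of order $8n$ with elements $a^rb^s$, $0\le r\le 2n-1$, $0\le s\le 3$. For a finite group $G$ with identity $e$ and a nonempty $S\subseteq G\setminus\{e\}$ with $S=S^{ -1}$, $\mathrm{Cay}(G,S)$ is the graph with vertex set $G$ in which $x,y$ are adjacent iff $xy^{ -1}\in S$; it is called normal if $S$ is a union of conjugacy classes of $G$. A graph is integral if all eigenvalues of its adjacency matrix are integers. $\mathrm{Spec}$ is the multiset of adjacency eigenvalues; $[\lambda]^m$ means $m$ copies of $\lambda$ ($m$ omitted if $m=1$), the display being read as a multiset, so that copies are added if two listed values coincide for small $n$. -}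

module Defs where

open import Algebra.Apartness.Bundles using (HeytingField)
open import Algebra.Bundles using (Group)
open import Algebra.Bundles.Raw using (RawRing)
import Algebra.Definitions.RawSemiring as RawSemiringDefinitions
import Algebra.Properties.Group as GroupProperties
open import Data.Fin.Base using (Fin; zero; suc; toℕ; punchIn)
open import Data.Fin.Properties using (_≟_)
open import Data.Integer.Base as ℤ using (ℤ; +_; -[1+_]; 0ℤ; 1ℤ)
open import Data.List.Base using (List; []; _∷_; map; foldr)
open import Data.Nat.Base as ℕ using (ℕ; zero; suc)
open import Data.Product.Base using (∃-syntax; Σ-syntax; _×_; _,_)
open import Data.Sum.Base using (_⊎_)
open import Function.Bundles using (Inverse)
open import Level using (0ℓ; _⊔_) renaming (suc to lsuc)
open import Relation.Binary.Bundles using (Setoid)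
open import Relation.Binary.Construct.Closure.ReflexiveTransitive using (Star)
open import Relation.Binary.Core using (Rel)
open import Relation.Binary.Definitions using (Symmetric; _Respects_; _Respects₂_)
open import Relation.Binary.PropositionalEquality.Core using (_≡_)
import Relation.Binary.PropositionalEquality.Properties as ≡
open import Relation.Nullary using (¬_; yes; no)
open import Relation.Unary using (Pred; _∈_; _∉_; _∪_; Satisfiable)

------------------------------------------------------------------------
-- Groups given by generators and relations

infixr 8 _^_
infixl 7 _∙_

data Term (X : Set) : Set where
  gen  : X → Term X
  ε    : Term X
  _∙_  : Term X → Term X → Term X
  _⁻¹  : Term X → Term X

_^_ : {X : Set} → Term X → ℕ → Term X
x ^ zero  = ε
x ^ suc k = x ∙ x ^ k

-- The least congruence containing R and the group laws.
data Generated {X : Set} (R : Rel (Term X) 0ℓ) : Rel (Term X) 0ℓ where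
  relation  : ∀ {x y} → R x y → Generated R x y
  refl      : ∀ {x} → Generated R x x
  sym       : ∀ {x y} → Generated R x y → Generated R y x
  trans     : ∀ {x y z} → Generated R x y → Generated R y z → Generated R x z
  ∙-cong    : ∀ {x x′ y y′} → Generated R x x′ → Generated R y y′ →
              Generated R (x ∙ y) (x′ ∙ y′)
  ⁻¹-cong   : ∀ {x y} → Generated R x y → Generated R (x ⁻¹) (y ⁻¹)
  assoc     : ∀ x y z → Generated R ((x ∙ y) ∙ z) (x ∙ (y ∙ z))
  identityˡ : ∀ x → Generated R (ε ∙ x) x
  identityʳ : ∀ x → Generated R (x ∙ ε) x
  inverseˡ  : ∀ x → Generated R (x ⁻¹ ∙ x) ε
  inverseʳ  : ∀ x → Generated R (x ∙ x ⁻¹) ε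

⟨_∣_⟩ : (X : Set) → Rel (Term X) 0ℓ → Group 0ℓ 0ℓ
⟨ X ∣ R ⟩ = record
  { Carrier = Term X
  ; _≈_     = Generated R
  ; _∙_     = _∙_
  ; ε       = ε
  ; _⁻¹     = _⁻¹
  ; isGroup = record
    { isMonoid = record
      { isSemigroup = record
        { isMagma = record
          { isEquivalence = record { refl = refl ; sym = sym ; trans = trans }
          ; ∙-cong        = ∙-cong
          }
        ; assoc = assoc
        }
      ; identity = identityˡ , identityʳ
      }
    ; inverse = inverseˡ , inverseʳ
    ; ⁻¹-cong = ⁻¹-cong
    }
  }

data Letter : Set where
  𝕒 𝕓 : Letter

a b : Term Letter
a = gen 𝕒
b = gen 𝕓

data T-relations (n : ℕ) : Rel (Term Letter) 0ℓ where
  a²ⁿ≈e     : T-relations n (a ^ (2 ℕ.* n)) ε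
  b⁸≈e      : T-relations n (b ^ 8) ε
  aⁿ≈b⁴     : T-relations n (a ^ n) (b ^ 4)
  b⁻¹ab≈a⁻¹ : T-relations n ((b ⁻¹ ∙ a) ∙ b) (a ⁻¹)

-- T n is the group written T_{8n}, of order 8n for positive n.
T : ℕ → Group 0ℓ 0ℓ
T n = ⟨ Letter ∣ T-relations n ⟩

module _ (n : ℕ) where
  open Group (T n) using (_≈_)

  ⟨a⟩ : Pred (Term Letter) 0ℓ
  ⟨a⟩ x = ∃[ k ] (x ≈ a ^ k ⊎ x ≈ (a ^ k) ⁻¹)

  S₁ S₂ S : Pred (Term Letter) 0ℓ
  S₁ x = x ≈ b ^ 2 ⊎ x ≈ a ^ n ∙ b ^ 2
  S₂ x = ∃[ y ] (y ∈ ⟨a⟩ × (x ≈ y ∙ b ⊎ x ≈ y ∙ b ^ 3))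
  S    = S₁ ∪ S₂

------------------------------------------------------------------------
-- Simple graphs; the vertices form a setoid so that they can be the
-- elements of a presented group.

record Graph : Set₁ where
  field
    vertices : Setoid 0ℓ 0ℓ

  open Setoid vertices public using (_≈_) renaming (Carrier to Vertex)

  field
    Adj         : Rel Vertex 0ℓ
    Adj-resp-≈  : Adj Respects₂ _≈_
    Adj-sym     : Symmetric Adj
    Adj-irrefl  : ∀ {x y} → x ≈ y → ¬ Adj x y

Connected : Graph → Set
Connected Γ = ∀ x y → Star (λ u v → u ≈ v ⊎ Adj u v) x y
  where open Graph Γ

------------------------------------------------------------------------
-- Cayley graphs

module _ (G : Group 0ℓ 0ℓ) where
  open Group G using (_≈_; setoid)
    renaming (Carrier to C; _∙_ to _·_; ε to e; _⁻¹ to inv)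
  private module G = Group G

  record IsConnectionSet (S : Pred C 0ℓ) : Set where
    field
      respects : S Respects _≈_
      nonempty : Satisfiable S
      e∉       : e ∉ S
      inverse  : ∀ {x} → x ∈ S → inv x ∈ S

  Conjugate : Rel C 0ℓ
  Conjugate x y = ∃[ g ] (y ≈ (inv g · x) · g)

  IsUnionOfConjugacyClasses : Pred C 0ℓ → Set
  IsUnionOfConjugacyClasses S = ∀ {x y} → Conjugate x y → x ∈ S → y ∈ S

  Cay : (S : Pred C 0ℓ) → IsConnectionSet S → Graph
  Cay S isConn = record
    { vertices   = setoid
    ; Adj        = λ x y → x · inv y ∈ S
    ; Adj-resp-≈ = (λ y≈z → respects (G.∙-congˡ (G.⁻¹-cong y≈z)))
                 , (λ y≈z → respects (G.∙-congʳ y≈z))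
    ; Adj-sym    = λ {x} {y} xy⁻¹∈S → respects (flip-inverse x y) (inverse xy⁻¹∈S)
    ; Adj-irrefl = λ {x} {y} x≈y xy⁻¹∈S →
        e∉ (respects (G.trans (G.∙-congʳ x≈y) (G.inverseʳ y)) xy⁻¹∈S)
    }
    where
    open IsConnectionSet isConn
    open GroupProperties G using (⁻¹-anti-homo-∙; ⁻¹-involutive)
    flip-inverse : ∀ x y → inv (x · inv y) ≈ y · inv x
    flip-inverse x y =
      G.trans (⁻¹-anti-homo-∙ x (inv y)) (G.∙-congʳ (⁻¹-involutive y))

  IsNormalCayley : (S : Pred C 0ℓ) → IsConnectionSet S → Set
  IsNormalCayley S _ = IsUnionOfConjugacyClasses S

------------------------------------------------------------------------
-- Determinants and integer polynomials

Matrix : {c : _} → Set c → ℕ → Set c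
Matrix A N = Fin N → Fin N → A

module _ {c ℓ} (R : RawRing c ℓ) where
  open RawRing R using (Carrier; _+_; _*_; -_; 0#; 1#; rawSemiring)
  open RawSemiringDefinitions rawSemiring using (sum)
    renaming (_×_ to _×ᴿ_; _^_ to _^ᴿ_)

  fromℤ : ℤ → Carrier
  fromℤ (+ k)    = k ×ᴿ 1#
  fromℤ -[1+ k ] = - (suc k ×ᴿ 1#)

  -- Laplace expansion along the first row.
  det : ∀ {N} → Matrix Carrier N → Carrier
  det {zero}  M = 1#
  det {suc N} M = sum λ j →
    ((- 1#) ^ᴿ toℕ j) * (M zero j * det (λ i k → M (suc i) (punchIn j k)))

-- Coefficient lists, constant term first. Trailing zeros are allowed, so
-- equality compares coefficients rather than lists.
Poly : Set
Poly = List ℤ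

coeff : Poly → ℕ → ℤ
coeff []      _       = 0ℤ
coeff (c ∷ p) zero    = c
coeff (c ∷ p) (suc k) = coeff p k

infixl 6 _+ₚ_
infixl 7 _*ₚ_

_+ₚ_ : Poly → Poly → Poly
[]      +ₚ q       = q
(c ∷ p) +ₚ []      = c ∷ p
(c ∷ p) +ₚ (d ∷ q) = (c ℤ.+ d) ∷ (p +ₚ q)

_*ₚ_ : Poly → Poly → Poly
[]      *ₚ q = []
(c ∷ p) *ₚ q = map (c ℤ.*_) q +ₚ (0ℤ ∷ (p *ₚ q))

ℤ[x] : RawRing 0ℓ 0ℓ
ℤ[x] = record
  { Carrier = Poly
  ; _≈_     = λ p q → ∀ k → coeff p k ≡ coeff q k
  ; _+_     = _+ₚ_
  ; _*_     = _*ₚ_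
  ; -_      = map (λ c → ℤ.- c)
  ; 0#      = []
  ; 1#      = 1ℤ ∷ []
  }

-- x - c
x-_ : ℤ → Poly
x- c = (ℤ.- c) ∷ 1ℤ ∷ []

charMatrix : ∀ {N} → Matrix ℤ N → Matrix Poly N
charMatrix A i j with i ≟ j
... | yes _ = x- A i j
... | no  _ = (ℤ.- A i j) ∷ []

charpoly : ∀ {N} → Matrix ℤ N → Poly
charpoly A = det ℤ[x] (charMatrix A)

-- A list, up to order, is the multiset of all roots of charpoly A, counted
-- with multiplicity, when the monic polynomial charpoly A is the product of
-- the corresponding linear factors.
IsSpectrum : ∀ {N} → Matrix ℤ N → List ℤ → Set
IsSpectrum A λs = charpoly A ≈ foldr (λ c p → (x- c) *ₚ p) 1# λs
  where open RawRing ℤ[x] using (_≈_; 1#)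

------------------------------------------------------------------------
-- Eigenvalues of an integer matrix in a field of characteristic zero.
-- Apartness _#_ is the positive form of inequality.

rawRing : HeytingField 0ℓ 0ℓ 0ℓ → RawRing 0ℓ 0ℓ
rawRing K = record
  { Carrier = Carrier ; _≈_ = _≈_ ; _+_ = _+_ ; _*_ = _*_ ; -_ = -_
  ; 0# = 0# ; 1# = 1# }
  where open HeytingField K

module _ (K : HeytingField 0ℓ 0ℓ 0ℓ) where
  open HeytingField K using (Carrier; _≈_; _#_; _*_; 0#)
  open RawSemiringDefinitions (RawRing.rawSemiring (rawRing K)) using (sum)

  CharacteristicZero : Set
  CharacteristicZero = ∀ k → fromℤ (rawRing K) (+ suc k) # 0#

  IsEigenvalue : ∀ {N} → Matrix ℤ N → Carrier → Set
  IsEigenvalue {N} A μ = Σ[ v ∈ (Fin N → Carrier) ]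
    ( (∃[ i ] (v i # 0#))
    × (∀ i → sum (λ j → fromℤ (rawRing K) (A i j) * v j) ≈ μ * v i) )

-- The field of scalars is arbitrary, so no eigenvalue is missed for being
-- irrational or non-real.
AllEigenvaluesIntegral : ∀ {N} → Matrix ℤ N → Set₁
AllEigenvaluesIntegral A =
  (K : HeytingField 0ℓ 0ℓ 0ℓ) → CharacteristicZero K →
  (μ : HeytingField.Carrier K) → IsEigenvalue K A μ →
  Σ[ c ∈ ℤ ] HeytingField._≈_ K μ (fromℤ (rawRing K) c)

------------------------------------------------------------------------
-- Spectra of finite graphs

record AdjacencyMatrix (Γ : Graph) : Set where
  open Graph Γ
  field
    size      : ℕ
    numbering : Inverse (≡.setoid (Fin size)) vertices

  vertex : Fin size → Vertex
  vertex = Inverse.to numbering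

  field
    entry   : Matrix ℤ size
    entry-≡ : ∀ i j → (Adj (vertex i) (vertex j) × entry i j ≡ 1ℤ)
                    ⊎ ((¬ Adj (vertex i) (vertex j)) × entry i j ≡ 0ℤ)

-- Renumbering the vertices conjugates the matrix by a permutation, so it
-- does not matter which numbering is used below.
Integral : Graph → Set₁
Integral Γ = Σ[ A ∈ AdjacencyMatrix Γ ]
  AllEigenvaluesIntegral (AdjacencyMatrix.entry A)

HasSpectrum : Graph → List ℤ → Set
HasSpectrum Γ λs = Σ[ A ∈ AdjacencyMatrix Γ ]
  IsSpectrum (AdjacencyMatrix.entry A) λs

{-# OPTIONS --safe #-}
-- Every element of T_{8n} is uniquely a^c b^(p + 2β + 4α) with c < n and bits p, β, α, and
-- (α, β, c, p), (α′, β′, c′, p′) are adjacent iff p ≠ p′, or p = p′, c = c′ and β ≠ β′.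
-- So vertices differing only in α are non-adjacent twins. Merging them, the determinant of x - A
-- is x^(4n) times that of x - 2A′, where now vertices differing only in β are adjacent twins;
-- merging those leaves (x + 2)^(2n) times the determinant of (x - 2) - 4 K_{n,n}, and merging the
-- two sides of K_{n,n} leaves (x - 2)^(2n - 2) ((x - 2)² - 16 n²). Integer polynomials agreeing at
-- all positive integers are equal. Integrality is proved by the same merging applied to an
-- eigenvector: if μ were apart from all the listed values, its class sums, hence its entries, vanish.
module Submission where

open import Defs
open import Algebra.Apartness.Bundles using (HeytingField; HeytingCommutativeRing)
open import Algebra.Bundles using (CommutativeRing; Group)
open import Algebra.Bundles.Raw using (RawRing)
import Algebra.Definitions.RawMonoid as RawMonoidDefinitions
import Algebra.Definitions.RawSemiring as RawSemiringDefinitions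
import Algebra.Properties.Group as GroupProperties
import Algebra.Properties.Monoid.Mult as MonoidMult
import Algebra.Properties.Ring as RingProperties
import Algebra.Properties.Semiring.Sum as SemiringSum
import Algebra.Solver.Ring.NaturalCoefficients.Default as SemiringSolver
open import Data.Empty using (⊥-elim)
open import Data.Fin.Base as Fin using (Fin; zero; suc; toℕ; fromℕ<; inject₁; punchIn; punchOut;
  _↑ˡ_; _↑ʳ_; splitAt; quotient; remainder; combine; remQuot)
open import Data.Fin.Induction using (<-weakInduction)
import Data.Fin.Properties as Fin
open import Data.Integer.Base as ℤ using (ℤ; +_; -[1+_]; -_; 0ℤ; 1ℤ; -1ℤ)
import Data.Integer.DivMod as ℤ
import Data.Integer.Properties as ℤ
open import Data.Integer.Tactic.RingSolver using (solve-∀)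
open import Data.List.Base using (List; []; _∷_; _++_; map; foldr; replicate)
open import Data.List.Relation.Unary.All as All using (All; []; _∷_)
open import Data.Nat.Base as ℕ using (ℕ; zero; suc; NonZero; _∸_)
import Data.Nat.Properties as ℕ
import Data.Nat.Tactic.RingSolver as ℕ
open import Data.Product.Base using (∃-syntax; Σ-syntax; _×_; _,_; proj₁; proj₂; uncurry)
open import Data.Sign.Base as Sign using (Sign)
import Data.Sign.Properties as Sign
open import Data.Sum.Base using (_⊎_; inj₁; inj₂; [_,_]′)
open import Data.Vec.Functional using (updateAt) renaming (_∷_ to _∷ᶠ_)
open import Data.Vec.Functional.Properties using (updateAt-updates; updateAt-minimal)
open import Function.Base using (_∘_; id)
open import Function.Bundles using (Inverse)
open import Level using (0ℓ)
open import Relation.Binary.Construct.Closure.ReflexiveTransitive using (_◅_) renaming (ε to nil)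
open import Relation.Binary.Definitions using (tri<; tri≈; tri>)
open import Relation.Binary.PropositionalEquality as ≡ using (_≡_; _≢_; cong; cong₂; module ≡-Reasoning)
import Relation.Binary.Reasoning.Setoid as SetoidReasoning
open import Relation.Nullary using (¬_; Dec; yes; no)
open import Relation.Unary using (_∈_)

-- The twins come from the shape of `S`. The element b² is central, aⁿ = b⁴ and aⁿb² = b⁶, so `S`
-- consists of ⟨b²⟩ without ⟨b⁴⟩ together with all elements having an odd exponent of b. Hence `S`
-- is invariant under multiplication by b⁴, and `S` enlarged by ⟨b⁴⟩ is invariant under b²; these
-- are the two kinds of twins. The quotient by ⟨b²⟩ is dihedral of order 2n with all reflections as
-- connection set, which explains K_{n,n}. The characteristic polynomial is a Laplace expansion over
-- coefficient lists. Evaluation commutes with it, so the determinant work is done over ℤ at one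
-- point x at a time, where equality is propositional. Expansion along the first row makes columns
-- accessible to induction, so merging is built from column operations and one expansion along a
-- cleared first row. In a Heyting field neither equality nor apartness need be decidable, so an
-- eigenvalue cannot be compared with the listed values by cases; this shapes the argument for
-- integrality.

open RawSemiringDefinitions (RawRing.rawSemiring ℤ.+-*-rawRing)
  using (sum) renaming (_^_ to _^ᶻ_)
open RawSemiringDefinitions (RawRing.rawSemiring ℤ[x]) using ()
  renaming (sum to sumₚ; _^_ to _^ₚ_)
open SemiringSum ℤ.+-*-semiring using (sum-cong-≗; ∑-distrib-+; *-distribˡ-sum; sum-replicate-zero)

-- Column operations on integer determinants

-- Opaque because integer sums and products unfold eagerly, which defeats inference of A from det A.
opaque
  detℤ : ∀ {N} → Matrix ℤ N → ℤ
  detℤ = det ℤ.+-*-rawRing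

infix 4 _≐_
_≐_ : ∀ {N} → Matrix ℤ N → Matrix ℤ N → Set
A ≐ B = ∀ i j → A i j ≡ B i j

minor : ∀ {N} → Matrix ℤ (suc N) → Fin (suc N) → Matrix ℤ N
minor A j i k = A (suc i) (punchIn j k)

term : ∀ {N} → Matrix ℤ (suc N) → Fin (suc N) → ℤ
term A j = (-1ℤ ^ᶻ toℕ j) ℤ.* (A zero j ℤ.* detℤ (minor A j))

opaque
  unfolding detℤ

  det-empty : (A : Matrix ℤ 0) → detℤ A ≡ 1ℤ
  det-empty A = ≡.refl

  det-expand : ∀ {N} (A : Matrix ℤ (suc N)) → detℤ A ≡ sum (term A)
  det-expand A = ≡.refl

det-cong : ∀ {N} {A B : Matrix ℤ N} → A ≐ B → detℤ A ≡ detℤ B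
det-cong {zero}  {A} {B} A≐B = ≡.trans (det-empty A) (≡.sym (det-empty B))
det-cong {suc N} {A} {B} A≐B = begin
  detℤ A        ≡⟨ det-expand A ⟩
  sum (term A)  ≡⟨ sum-cong-≗ (λ j → cong ((-1ℤ ^ᶻ toℕ j) ℤ.*_)
                     (cong₂ ℤ._*_ (A≐B zero j) (det-cong λ i k → A≐B (suc i) (punchIn j k)))) ⟩
  sum (term B)  ≡⟨ det-expand B ⟨
  detℤ B        ∎
  where open ≡-Reasoning

sum-linear : ∀ {N} (f g h : Fin N → ℤ) c → (∀ i → f i ≡ g i ℤ.+ c ℤ.* h i) →
             sum f ≡ sum g ℤ.+ c ℤ.* sum h
sum-linear f g h c f≡g+ch = begin
  sum f                               ≡⟨ sum-cong-≗ f≡g+ch ⟩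
  sum (λ i → g i ℤ.+ c ℤ.* h i)       ≡⟨ ∑-distrib-+ g (λ i → c ℤ.* h i) ⟩
  sum g ℤ.+ sum (λ i → c ℤ.* h i)     ≡⟨ cong (ℤ._+_ (sum g)) (*-distribˡ-sum c h) ⟨
  sum g ℤ.+ c ℤ.* sum h               ∎
  where open ≡-Reasoning

punchIn-≢ : ∀ {N} {j k : Fin (suc N)} (j≢k : j ≢ k) {l} → l ≢ punchOut j≢k → punchIn j l ≢ k
punchIn-≢ {j = j} j≢k {l} l≢ eq = l≢ (Fin.punchIn-injective j l _
  (≡.trans eq (≡.sym (Fin.punchIn-punchOut j≢k))))

-- In the Laplace term of column `k` the dependence on that column sits in the entry, and the minor
-- omits it. In every other term it sits in the minor, where the column has become number
-- `punchOut j≢k`, and induction applies.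
det-linear : ∀ {N} (k : Fin N) {A B C : Matrix ℤ N} c →
             (∀ i j → j ≢ k → A i j ≡ B i j) →
             (∀ i j → j ≢ k → A i j ≡ C i j) →
             (∀ i → A i k ≡ B i k ℤ.+ c ℤ.* C i k) →
             detℤ A ≡ detℤ B ℤ.+ c ℤ.* detℤ C
det-linear {suc N} k {A} {B} {C} c A≡B A≡C A≡B+cC = begin
  detℤ A                                  ≡⟨ det-expand A ⟩
  sum (term A)                            ≡⟨ sum-linear (term A) (term B) (term C) c linear-term ⟩
  sum (term B) ℤ.+ c ℤ.* sum (term C)     ≡⟨ cong₂ (λ x y → x ℤ.+ c ℤ.* y) (det-expand B) (det-expand C) ⟨
  detℤ B ℤ.+ c ℤ.* detℤ C                 ∎
  where
  open ≡-Reasoning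
  linear-term : ∀ j → term A j ≡ term B j ℤ.+ c ℤ.* term C j
  linear-term j with j Fin.≟ k
  ... | yes ≡.refl
    rewrite A≡B+cC zero
          | det-cong {A = minor A j} {minor B j}
              (λ i l → A≡B (suc i) (punchIn j l) (Fin.punchInᵢ≢i j l))
          | det-cong {A = minor C j} {minor B j}
              (λ i l → ≡.trans (≡.sym (A≡C (suc i) (punchIn j l) (Fin.punchInᵢ≢i j l)))
                               (A≡B (suc i) (punchIn j l) (Fin.punchInᵢ≢i j l)))
    = distribute (-1ℤ ^ᶻ toℕ j) (B zero j) (C zero j) c (detℤ (minor B j))
    where
    distribute : ∀ s x y c d → s ℤ.* ((x ℤ.+ c ℤ.* y) ℤ.* d) ≡
                 s ℤ.* (x ℤ.* d) ℤ.+ c ℤ.* (s ℤ.* (y ℤ.* d))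
    distribute = solve-∀
  ... | no j≢k
    rewrite ≡.sym (A≡B zero j j≢k) | ≡.sym (A≡C zero j j≢k)
          | det-linear (punchOut j≢k) {minor A j} {minor B j} {minor C j} c
              (λ i l l≢ → A≡B (suc i) (punchIn j l) (punchIn-≢ j≢k l≢))
              (λ i l l≢ → A≡C (suc i) (punchIn j l) (punchIn-≢ j≢k l≢))
              (λ i → ≡.subst (λ l → A (suc i) l ≡ B (suc i) l ℤ.+ c ℤ.* C (suc i) l)
                       (≡.sym (Fin.punchIn-punchOut j≢k)) (A≡B+cC (suc i)))
    = distribute (-1ℤ ^ᶻ toℕ j) (A zero j) (detℤ (minor B j)) (detℤ (minor C j)) c
    where
    distribute : ∀ s x y z c → s ℤ.* (x ℤ.* (y ℤ.+ c ℤ.* z)) ≡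
                 s ℤ.* (x ℤ.* y) ℤ.+ c ℤ.* (s ℤ.* (x ℤ.* z))
    distribute = solve-∀

sum-zero : ∀ {N} (f : Fin N → ℤ) → (∀ i → f i ≡ 0ℤ) → sum f ≡ 0ℤ
sum-zero {N} f f≡0 = ≡.trans (sum-cong-≗ f≡0) (sum-replicate-zero N)

sum-adjacent-pair : ∀ {N} (k : Fin N) (f : Fin (suc N) → ℤ) →
                    (∀ j → j ≢ inject₁ k → j ≢ suc k → f j ≡ 0ℤ) →
                    sum f ≡ f (inject₁ k) ℤ.+ f (suc k)
sum-adjacent-pair zero f f≡0 = begin
  f zero ℤ.+ (f (suc zero) ℤ.+ sum (λ j → f (suc (suc j))))
    ≡⟨ cong (λ z → f zero ℤ.+ (f (suc zero) ℤ.+ z))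
         (sum-zero (λ j → f (suc (suc j))) (λ j → f≡0 (suc (suc j)) (λ ()) (λ ()))) ⟩
  f zero ℤ.+ (f (suc zero) ℤ.+ 0ℤ)
    ≡⟨ cong (ℤ._+_ (f zero)) (ℤ.+-identityʳ _) ⟩
  f zero ℤ.+ f (suc zero) ∎
  where open ≡-Reasoning
sum-adjacent-pair (suc k) f f≡0 = begin
  f zero ℤ.+ sum (f ∘ suc)
    ≡⟨ cong₂ ℤ._+_ (f≡0 zero (λ ()) (λ ()))
         (sum-adjacent-pair k (f ∘ suc) λ j j≢ j≢′ →
           f≡0 (suc j) (j≢ ∘ Fin.suc-injective) (j≢′ ∘ Fin.suc-injective)) ⟩
  0ℤ ℤ.+ (f (suc (inject₁ k)) ℤ.+ f (suc (suc k)))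
    ≡⟨ ℤ.+-identityˡ _ ⟩
  f (suc (inject₁ k)) ℤ.+ f (suc (suc k)) ∎
  where open ≡-Reasoning

punchIn-adjacent : ∀ {N} (k : Fin (suc N)) (j : Fin (suc (suc N))) →
                   j ≢ inject₁ k → j ≢ suc k →
                   ∃[ l ] (punchIn j (inject₁ l) ≡ inject₁ k × punchIn j (suc l) ≡ suc k)
punchIn-adjacent zero    zero          j≢k j≢k+1 = ⊥-elim (j≢k ≡.refl)
punchIn-adjacent zero    (suc zero)    j≢k j≢k+1 = ⊥-elim (j≢k+1 ≡.refl)
punchIn-adjacent {suc N} zero (suc (suc j)) j≢k j≢k+1 = zero , ≡.refl , ≡.refl
punchIn-adjacent (suc k) zero          j≢k j≢k+1 = k , ≡.refl , ≡.refl
punchIn-adjacent {suc N} (suc k) (suc j) j≢k j≢k+1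
  with l , eq , eq′ ← punchIn-adjacent k j (j≢k ∘ cong suc) (j≢k+1 ∘ cong suc)
  = suc l , cong suc eq , cong suc eq′

punchIn-equal-entries : ∀ {N} {X : Set} (k : Fin N) (r : Fin (suc N) → X) →
                        r (inject₁ k) ≡ r (suc k) →
                        ∀ l → r (punchIn (inject₁ k) l) ≡ r (punchIn (suc k) l)
punchIn-equal-entries zero    r eq zero    = ≡.sym eq
punchIn-equal-entries zero    r eq (suc l) = ≡.refl
punchIn-equal-entries (suc k) r eq zero    = ≡.refl
punchIn-equal-entries (suc k) r eq (suc l) = punchIn-equal-entries k (r ∘ suc) eq l

-- Deleting a column outside the pair leaves a minor with two equal neighbouring columns, so
-- induction removes all terms but two. These share their entry and their minor and carry opposite
-- signs, since neighbouring columns have numbers of different parity.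
det-equal-adjacent : ∀ {N} (k : Fin N) (A : Matrix ℤ (suc N)) →
                     (∀ i → A i (inject₁ k) ≡ A i (suc k)) → detℤ A ≡ 0ℤ
det-equal-adjacent {suc N} k A eq = begin
  detℤ A                                  ≡⟨ det-expand A ⟩
  sum (term A)                            ≡⟨ sum-adjacent-pair k (term A) other-terms ⟩
  term A (inject₁ k) ℤ.+ term A (suc k)   ≡⟨ cancelling-terms ⟩
  0ℤ                                      ∎
  where
  open ≡-Reasoning
  other-terms : ∀ j → j ≢ inject₁ k → j ≢ suc k → term A j ≡ 0ℤ
  other-terms j j≢k j≢k+1 with l , eqˡ , eqʳ ← punchIn-adjacent k j j≢k j≢k+1
    rewrite det-equal-adjacent l (minor A j)
              (λ i → ≡.trans (cong (A (suc i)) eqˡ)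
                       (≡.trans (eq (suc i)) (cong (A (suc i)) (≡.sym eqʳ))))
          | ℤ.*-zeroʳ (A zero j)
    = ℤ.*-zeroʳ (-1ℤ ^ᶻ toℕ j)
  cancelling-terms : term A (inject₁ k) ℤ.+ term A (suc k) ≡ 0ℤ
  cancelling-terms
    rewrite Fin.toℕ-inject₁ k | eq zero
          | det-cong {A = minor A (inject₁ k)} {minor A (suc k)}
              (λ i → punchIn-equal-entries k (A (suc i)) (eq (suc i)))
    = cancel (-1ℤ ^ᶻ toℕ k) (A zero (suc k) ℤ.* detℤ (minor A (suc k)))
    where
    cancel : ∀ s x → s ℤ.* x ℤ.+ (-1ℤ ℤ.* s) ℤ.* x ≡ 0ℤ
    cancel = solve-∀

replaceColumn : ∀ {N} → Matrix ℤ N → Fin N → (Fin N → ℤ) → Matrix ℤ N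
replaceColumn A k u i = updateAt (A i) k (λ _ → u i)

replaceColumn-at : ∀ {N} (A : Matrix ℤ N) k u i → replaceColumn A k u i k ≡ u i
replaceColumn-at A k u i = updateAt-updates k (A i)

replaceColumn-off : ∀ {N} (A : Matrix ℤ N) k u i {j} → j ≢ k →
                    replaceColumn A k u i j ≡ A i j
replaceColumn-off A k u i j≢k = updateAt-minimal _ k (A i) j≢k

det-replaceColumn-+ : ∀ {N} (A : Matrix ℤ N) k u v →
  detℤ (replaceColumn A k (λ i → u i ℤ.+ v i)) ≡
  detℤ (replaceColumn A k u) ℤ.+ detℤ (replaceColumn A k v)
det-replaceColumn-+ A k u v = ≡.trans
  (det-linear k {replaceColumn A k u+v} {replaceColumn A k u} {replaceColumn A k v} 1ℤ
    (λ i j j≢k → ≡.trans (replaceColumn-off A k u+v i j≢k) (≡.sym (replaceColumn-off A k u i j≢k)))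
    (λ i j j≢k → ≡.trans (replaceColumn-off A k u+v i j≢k) (≡.sym (replaceColumn-off A k v i j≢k)))
    (λ i → ≡.trans (replaceColumn-at A k u+v i)
             (≡.sym (cong₂ ℤ._+_ (replaceColumn-at A k u i)
               (≡.trans (ℤ.*-identityˡ (replaceColumn A k v i k)) (replaceColumn-at A k v i))))))
  (cong (ℤ._+_ (detℤ (replaceColumn A k u))) (ℤ.*-identityˡ (detℤ (replaceColumn A k v))))
  where
  u+v : Fin _ → ℤ
  u+v i = u i ℤ.+ v i

inject₁≢suc : ∀ {N} {k : Fin N} → inject₁ k ≢ suc k
inject₁≢suc {k = k} eq =
  ℕ.1+n≢n (≡.sym (≡.trans (≡.sym (Fin.toℕ-inject₁ k)) (cong toℕ eq)))

-- Polarisation of det-equal-adjacent.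
det-swap-adjacent : ∀ {N} (k : Fin N) (A : Matrix ℤ (suc N)) (u v : Fin (suc N) → ℤ) →
  detℤ (replaceColumn (replaceColumn A (inject₁ k) u) (suc k) v) ℤ.+
  detℤ (replaceColumn (replaceColumn A (inject₁ k) v) (suc k) u) ≡ 0ℤ
det-swap-adjacent k A u v = begin
  D u v ℤ.+ D v u
    ≡⟨ regroup (D u v) (D v u) ⟩
  (0ℤ ℤ.+ D u v) ℤ.+ (D v u ℤ.+ 0ℤ)
    ≡⟨ cong₂ (λ x y → (x ℤ.+ D u v) ℤ.+ (D v u ℤ.+ y)) (D-diagonal u) (D-diagonal v) ⟨
  (D u u ℤ.+ D u v) ℤ.+ (D v u ℤ.+ D v v)
    ≡⟨ cong₂ ℤ._+_ (det-replaceColumn-+ (replaceColumn A (inject₁ k) u) (suc k) u v)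
         (det-replaceColumn-+ (replaceColumn A (inject₁ k) v) (suc k) u v) ⟨
  D u u+v ℤ.+ D v u+v
    ≡⟨ D-+ˡ ⟨
  D u+v u+v
    ≡⟨ D-diagonal u+v ⟩
  0ℤ ∎
  where
  open ≡-Reasoning
  M : (x y : Fin _ → ℤ) → Matrix ℤ _
  M x y = replaceColumn (replaceColumn A (inject₁ k) x) (suc k) y
  D : (x y : Fin _ → ℤ) → ℤ
  D x y = detℤ (M x y)
  u+v : Fin _ → ℤ
  u+v i = u i ℤ.+ v i
  M-at : ∀ x y i → M x y i (inject₁ k) ≡ x i
  M-at x y i = ≡.trans (replaceColumn-off (replaceColumn A (inject₁ k) x) (suc k) y i inject₁≢suc)
                       (replaceColumn-at A (inject₁ k) x i)
  D-diagonal : ∀ x → D x x ≡ 0ℤ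
  D-diagonal x = det-equal-adjacent k (M x x) λ i →
    ≡.trans (M-at x x i) (≡.sym (replaceColumn-at (replaceColumn A (inject₁ k) x) (suc k) x i))
  M-off : ∀ x x′ y i j → j ≢ inject₁ k → M x y i j ≡ M x′ y i j
  M-off x x′ y i j j≢ with j Fin.≟ suc k
  ... | yes ≡.refl = ≡.trans (replaceColumn-at (replaceColumn A (inject₁ k) x) (suc k) y i)
                       (≡.sym (replaceColumn-at (replaceColumn A (inject₁ k) x′) (suc k) y i))
  ... | no  j≢′    = ≡.trans (off x) (≡.sym (off x′))
    where
    off : ∀ z → M z y i j ≡ A i j
    off z = ≡.trans (replaceColumn-off (replaceColumn A (inject₁ k) z) (suc k) y i j≢′)
                    (replaceColumn-off A (inject₁ k) z i j≢)
  D-+ˡ : D u+v u+v ≡ D u u+v ℤ.+ D v u+v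
  D-+ˡ = ≡.trans
    (det-linear (inject₁ k) {M u+v u+v} {M u u+v} {M v u+v} 1ℤ
      (M-off u+v u u+v) (M-off u+v v u+v)
      (λ i → ≡.trans (M-at u+v u+v i)
        (≡.sym (cong₂ ℤ._+_ (M-at u u+v i)
          (≡.trans (ℤ.*-identityˡ (M v u+v i (inject₁ k))) (M-at v u+v i))))))
    (cong (ℤ._+_ (D u u+v)) (ℤ.*-identityˡ (D v u+v)))
  regroup : ∀ x y → x ℤ.+ y ≡ (0ℤ ℤ.+ x) ℤ.+ (y ℤ.+ 0ℤ)
  regroup = solve-∀

-- Induction moves the right-hand column towards `k`: exchanging it with its left neighbour negates
-- the determinant and brings the pair one step closer, until the two columns are adjacent. `k` and
-- `A` stay quantified because the exchange changes the matrix.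
det-equal-columns-< : ∀ {N} (l k : Fin (suc N)) (A : Matrix ℤ (suc N)) → k Fin.< l →
                      (∀ i → A i k ≡ A i l) → detℤ A ≡ 0ℤ
det-equal-columns-< = <-weakInduction
  (λ l → ∀ k A → k Fin.< l → (∀ i → A i k ≡ A i l) → detℤ A ≡ 0ℤ)
  (λ _ _ ())
  step
  where
  step : ∀ l →
         (∀ k A → k Fin.< inject₁ l → (∀ i → A i k ≡ A i (inject₁ l)) → detℤ A ≡ 0ℤ) →
         ∀ k A → k Fin.< suc l → (∀ i → A i k ≡ A i (suc l)) → detℤ A ≡ 0ℤ
  step l hyp k A k<l+1 eq with k Fin.≟ inject₁ l
  ... | yes ≡.refl = det-equal-adjacent l A eq
  ... | no  k≢l    = begin
    detℤ A
      ≡⟨ det-cong (λ i j → ≡.sym (unchanged i j)) ⟩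
    D w u
      ≡⟨ ℤ.+-identityʳ _ ⟨
    D w u ℤ.+ 0ℤ
      ≡⟨ cong (ℤ._+_ (D w u)) (hyp k (M u w) k<l λ i →
           ≡.trans (at-k u w i) (≡.sym (at-l u w i))) ⟨
    D w u ℤ.+ D u w
      ≡⟨ det-swap-adjacent l A w u ⟩
    0ℤ ∎
    where
    open ≡-Reasoning
    u w : Fin _ → ℤ
    u i = A i (suc l)
    w i = A i (inject₁ l)
    M : (x y : Fin _ → ℤ) → Matrix ℤ _
    M x y = replaceColumn (replaceColumn A (inject₁ l) x) (suc l) y
    D : (x y : Fin _ → ℤ) → ℤ
    D x y = detℤ (M x y)
    k<l : k Fin.< inject₁ l
    k<l = ℕ.≤∧≢⇒< (≡.subst (toℕ k ℕ.≤_) (≡.sym (Fin.toℕ-inject₁ l)) (ℕ.≤-pred k<l+1))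
            (k≢l ∘ Fin.toℕ-injective)
    k≢l+1 : k ≢ suc l
    k≢l+1 ≡.refl = ℕ.<-irrefl ≡.refl k<l+1
    at-l : ∀ x y i → M x y i (inject₁ l) ≡ x i
    at-l x y i = ≡.trans
      (replaceColumn-off (replaceColumn A (inject₁ l) x) (suc l) y i inject₁≢suc)
      (replaceColumn-at A (inject₁ l) x i)
    off : ∀ x y i {j} → j ≢ inject₁ l → j ≢ suc l → M x y i j ≡ A i j
    off x y i j≢l j≢l+1 = ≡.trans
      (replaceColumn-off (replaceColumn A (inject₁ l) x) (suc l) y i j≢l+1)
      (replaceColumn-off A (inject₁ l) x i j≢l)
    at-k : ∀ x y i → M x y i k ≡ u i
    at-k x y i = ≡.trans (off x y i k≢l k≢l+1) (eq i)
    unchanged : ∀ i j → M w u i j ≡ A i j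
    unchanged i j with j Fin.≟ inject₁ l | j Fin.≟ suc l
    ... | _          | yes ≡.refl = replaceColumn-at (replaceColumn A (inject₁ l) w) (suc l) u i
    ... | yes ≡.refl | no _       = at-l w u i
    ... | no j≢l     | no j≢l+1   = off w u i j≢l j≢l+1

det-equal-columns : ∀ {N} {k l : Fin N} (A : Matrix ℤ N) → k ≢ l →
                    (∀ i → A i k ≡ A i l) → detℤ A ≡ 0ℤ
det-equal-columns {suc N} {k} {l} A k≢l eq with Fin.<-cmp k l
... | tri< k<l _ _ = det-equal-columns-< l k A k<l eq
... | tri≈ _ k≡l _ = ⊥-elim (k≢l k≡l)
... | tri> _ _ l<k = det-equal-columns-< k l A l<k (≡.sym ∘ eq)

det-add-column : ∀ {N} {k l : Fin N} {A B : Matrix ℤ N} c → k ≢ l →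
                 (∀ i j → j ≢ k → B i j ≡ A i j) →
                 (∀ i → B i k ≡ A i k ℤ.+ c ℤ.* A i l) →
                 detℤ B ≡ detℤ A
det-add-column {k = k} {l} {A} {B} c k≢l B≡A B≡A+cA = begin
  detℤ B                      ≡⟨ det-linear k {B} {A} {C} c B≡A
                                   (λ i j j≢k → ≡.trans (B≡A i j j≢k) (≡.sym (C-off i j≢k)))
                                   (λ i → ≡.trans (B≡A+cA i)
                                     (cong (λ z → A i k ℤ.+ c ℤ.* z) (≡.sym (C-at i)))) ⟩
  detℤ A ℤ.+ c ℤ.* detℤ C     ≡⟨ cong (λ z → detℤ A ℤ.+ c ℤ.* z)
                                   (det-equal-columns C k≢l λ i →
                                     ≡.trans (C-at i) (≡.sym (C-off i (k≢l ∘ ≡.sym)))) ⟩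
  detℤ A ℤ.+ c ℤ.* 0ℤ         ≡⟨ cong (ℤ._+_ (detℤ A)) (ℤ.*-zeroʳ c) ⟩
  detℤ A ℤ.+ 0ℤ               ≡⟨ ℤ.+-identityʳ _ ⟩
  detℤ A                      ∎
  where
  open ≡-Reasoning
  C : Matrix ℤ _
  C = replaceColumn A k (λ i → A i l)
  C-at : ∀ i → C i k ≡ A i l
  C-at = replaceColumn-at A k _
  C-off : ∀ i {j} → j ≢ k → C i j ≡ A i j
  C-off = replaceColumn-off A k _

-- An arbitrary functional `F` takes the place of the determinant so that the induction can freeze
-- the first column inside `F` and go on with one column fewer, while the matrix behind `F` keeps
-- its size. `F-cong` stands in for function extensionality.
add-multiples : ∀ {N M} (u : Fin M → ℤ) (F : (Fin N → Fin M → ℤ) → ℤ) →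
  (∀ {w w′} → (∀ j i → w j i ≡ w′ j i) → F w ≡ F w′) →
  (∀ {w w′} k c → (∀ j i → j ≢ k → w′ j i ≡ w j i) →
                  (∀ i → w′ k i ≡ w k i ℤ.+ c ℤ.* u i) → F w′ ≡ F w) →
  ∀ {w w′} (c : Fin N → ℤ) → (∀ j i → w′ j i ≡ w j i ℤ.+ c j ℤ.* u i) → F w′ ≡ F w
add-multiples {zero}  u F F-cong F-add c eq = F-cong λ ()
add-multiples {suc N} u F F-cong F-add {w} {w′} c eq = begin
  F w′                       ≡⟨ F-add zero (c zero) off (eq zero) ⟩
  F (w zero ∷ᶠ (w′ ∘ suc))   ≡⟨ add-multiples u (λ v → F (w zero ∷ᶠ v))
                                  (λ v≡ → F-cong λ { zero i → ≡.refl ; (suc j) i → v≡ j i })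
                                  (λ k d v≡ v≡+ → F-add (suc k) d
                                    (λ { zero i _ → ≡.refl ; (suc j) i j≢k → v≡ j i (j≢k ∘ cong suc) })
                                    v≡+)
                                  {w ∘ suc} {w′ ∘ suc} (c ∘ suc) (eq ∘ suc) ⟩
  F (w zero ∷ᶠ (w ∘ suc))    ≡⟨ F-cong (λ { zero i → ≡.refl ; (suc j) i → ≡.refl }) ⟩
  F w                        ∎
  where
  open ≡-Reasoning
  off : ∀ j i → j ≢ zero → w′ j i ≡ (w zero ∷ᶠ (w′ ∘ suc)) j i
  off zero    i 0≢0 = ⊥-elim (0≢0 ≡.refl)
  off (suc j) i _   = ≡.refl

det-add-first-column : ∀ {N} {A B : Matrix ℤ (suc N)} (c : Fin N → ℤ) →
                       (∀ i → B i zero ≡ A i zero) →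
                       (∀ i j → B i (suc j) ≡ A i (suc j) ℤ.+ c j ℤ.* A i zero) →
                       detℤ B ≡ detℤ A
det-add-first-column {A = A} {B} c B≡A B≡A+cA = begin
  detℤ B
    ≡⟨ det-cong {A = B} {withColumns λ j i → B i (suc j)} (λ { i zero → B≡A i ; i (suc j) → ≡.refl }) ⟩
  detℤ (withColumns λ j i → B i (suc j))
    ≡⟨ add-multiples (λ i → A i zero) (detℤ ∘ withColumns)
         (λ w≡ → det-cong λ { i zero → ≡.refl ; i (suc j) → w≡ j i })
         (λ {w} {w′} k d w≡ w≡+ →
           det-add-column {k = suc k} {zero} {withColumns w} {withColumns w′} d (λ ())
             (λ { i zero _ → ≡.refl ; i (suc j) j≢k → w≡ j i (j≢k ∘ cong suc) })
             w≡+)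
         {λ j i → A i (suc j)} c (λ j i → B≡A+cA i j) ⟩
  detℤ (withColumns λ j i → A i (suc j))
    ≡⟨ det-cong {A = withColumns λ j i → A i (suc j)} {A}
         (λ { i zero → ≡.refl ; i (suc j) → ≡.refl }) ⟩
  detℤ A ∎
  where
  open ≡-Reasoning
  withColumns : (Fin _ → Fin _ → ℤ) → Matrix ℤ _
  withColumns w i = A i zero ∷ᶠ λ j → w j i

det-first-row : ∀ {N} (A : Matrix ℤ (suc N)) → (∀ j → A zero (suc j) ≡ 0ℤ) →
                detℤ A ≡ A zero zero ℤ.* detℤ (λ i j → A (suc i) (suc j))
det-first-row A A₀≡0 = begin
  detℤ A
    ≡⟨ det-expand A ⟩
  term A zero ℤ.+ sum (term A ∘ suc)
    ≡⟨ cong₂ ℤ._+_ (ℤ.*-identityˡ (A zero zero ℤ.* detℤ (minor A zero))) (sum-zero (term A ∘ suc) λ j →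
         ≡.trans (cong (λ z → (-1ℤ ^ᶻ toℕ (suc j)) ℤ.* (z ℤ.* detℤ (minor A (suc j)))) (A₀≡0 j))
                 (ℤ.*-zeroʳ (-1ℤ ^ᶻ toℕ (suc j)))) ⟩
  A zero zero ℤ.* detℤ (λ i j → A (suc i) (suc j)) ℤ.+ 0ℤ
    ≡⟨ ℤ.+-identityʳ _ ⟩
  A zero zero ℤ.* detℤ (λ i j → A (suc i) (suc j)) ∎
  where open ≡-Reasoning

δ : ∀ {N} → Fin N → Fin N → ℤ
δ i j with i Fin.≟ j
... | yes _ = 1ℤ
... | no  _ = 0ℤ

δ-refl : ∀ {N} (i : Fin N) → δ i i ≡ 1ℤ
δ-refl i with i Fin.≟ i
... | yes _  = ≡.refl
... | no i≢i = ⊥-elim (i≢i ≡.refl)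

δ-≢ : ∀ {N} {i j : Fin N} → i ≢ j → δ i j ≡ 0ℤ
δ-≢ {i = i} {j} i≢j with i Fin.≟ j
... | yes i≡j = ⊥-elim (i≢j i≡j)
... | no _    = ≡.refl

δ-injective : ∀ {N M} (f : Fin N → Fin M) → (∀ {i j} → f i ≡ f j → i ≡ j) →
              ∀ i j → δ (f i) (f j) ≡ δ i j
δ-injective f inj i j with i Fin.≟ j
... | yes ≡.refl = δ-refl (f i)
... | no i≢j     = δ-≢ (i≢j ∘ inj)

δ-suc : ∀ {N} (i j : Fin N) → δ (suc i) (suc j) ≡ δ i j
δ-suc = δ-injective suc Fin.suc-injective

-- By linearity the first column splits into a copy of column `suc v`, which contributes 0, and d
-- times the difference of two unit vectors. Subtracting multiples of that difference from the other
-- columns clears the first row, and its entry -1 at `suc v` has the effect of adding row `zero` to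
-- row `suc v`.
det-merge : ∀ {N} (A : Matrix ℤ (suc N)) (v : Fin N) d →
            (∀ i → A i zero ≡ A i (suc v) ℤ.+ d ℤ.* (δ i zero ℤ.- δ i (suc v))) →
            detℤ A ≡ d ℤ.* detℤ (λ i j → A (suc i) (suc j) ℤ.+ δ i v ℤ.* A zero (suc j))
det-merge A v d col₀ = begin
  detℤ A
    ≡⟨ det-linear zero {A} {B} {C} d
         (λ { i zero 0≢0 → ⊥-elim (0≢0 ≡.refl) ; i (suc j) _ → ≡.refl })
         (λ { i zero 0≢0 → ⊥-elim (0≢0 ≡.refl) ; i (suc j) _ → ≡.refl })
         col₀ ⟩
  detℤ B ℤ.+ d ℤ.* detℤ C
    ≡⟨ cong₂ (λ x y → x ℤ.+ d ℤ.* y)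
         (det-equal-columns {k = zero} {suc v} B (λ ()) (λ i → ≡.refl))
         (≡.sym (det-add-first-column {A = C} {D} (λ j → - A zero (suc j))
           (λ i → ≡.refl) (λ i j → ≡.refl))) ⟩
  0ℤ ℤ.+ d ℤ.* detℤ D
    ≡⟨ ℤ.+-identityˡ _ ⟩
  d ℤ.* detℤ D
    ≡⟨ cong (d ℤ.*_) (det-first-row D λ j → clear (A zero (suc j))) ⟩
  d ℤ.* (1ℤ ℤ.* detℤ (λ i j → D (suc i) (suc j)))
    ≡⟨ cong (d ℤ.*_) (ℤ.*-identityˡ (detℤ (λ i j → D (suc i) (suc j)))) ⟩
  d ℤ.* detℤ (λ i j → D (suc i) (suc j))
    ≡⟨ cong (d ℤ.*_) (det-cong λ i j → ≡.trans
         (cong (λ z → A (suc i) (suc j) ℤ.+ - A zero (suc j) ℤ.* (0ℤ ℤ.- z)) (δ-suc i v))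
         (rearrange (A (suc i) (suc j)) (A zero (suc j)) (δ i v))) ⟩
  d ℤ.* detℤ (λ i j → A (suc i) (suc j) ℤ.+ δ i v ℤ.* A zero (suc j)) ∎
  where
  open ≡-Reasoning
  withFirst : (Fin _ → ℤ) → Matrix ℤ _
  withFirst u i = u i ∷ᶠ λ j → A i (suc j)
  B C D : Matrix ℤ _
  B = withFirst λ i → A i (suc v)
  C = withFirst λ i → δ i zero ℤ.- δ i (suc v)
  D i zero    = C i zero
  D i (suc j) = C i (suc j) ℤ.+ - A zero (suc j) ℤ.* C i zero
  clear : ∀ x → x ℤ.+ - x ℤ.* 1ℤ ≡ 0ℤ
  clear = solve-∀
  rearrange : ∀ x y z → x ℤ.+ - y ℤ.* (0ℤ ℤ.- z) ≡ x ℤ.+ z ℤ.* y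
  rearrange = solve-∀

-- Merging twins

↑ˡ≢↑ʳ : ∀ {k N} (i : Fin k) (j : Fin N) → i ↑ˡ N ≢ k ↑ʳ j
↑ˡ≢↑ʳ (suc i) j eq = ↑ˡ≢↑ʳ i j (Fin.suc-injective eq)

-- The characteristic matrix, at the point d, of the weighted blow-up of the matrix - B along cls.
blowUp : ∀ {N} {X : Set} → ℤ → (Fin N → ℤ) → (X → X → ℤ) → (Fin N → X) → Matrix ℤ N
blowUp d w B cls i j = d ℤ.* δ i j ℤ.+ w i ℤ.* B (cls i) (cls j)

module _ {X : Set} (d : ℤ) (B : X → X → ℤ) where

  -- Vertices of the same class have columns that differ only on the diagonal, as `det-merge`
  -- requires. Their rows of `B` agree too, so adding one row to the other merely adds the weights;
  -- this is why the weights multiply rows.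
  det-merge-twins : ∀ {N} (w : Fin (suc N) → ℤ) (cls : Fin (suc N) → X) (v : Fin N) →
    cls zero ≡ cls (suc v) →
    detℤ (blowUp d w B cls) ≡
    d ℤ.* detℤ (blowUp d (λ i → w (suc i) ℤ.+ δ i v ℤ.* w zero) B (cls ∘ suc))
  det-merge-twins w cls v eq = ≡.trans
    (det-merge (blowUp d w B cls) v d twin-columns)
    (cong (ℤ._*_ (d)) (det-cong merged))
    where
    rearrange : ∀ d x y z → d ℤ.* x ℤ.+ z ≡ d ℤ.* y ℤ.+ z ℤ.+ d ℤ.* (x ℤ.- y)
    rearrange = solve-∀
    twin-columns : ∀ i → blowUp d w B cls i zero ≡
      blowUp d w B cls i (suc v) ℤ.+ d ℤ.* (δ i zero ℤ.- δ i (suc v))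
    twin-columns i rewrite eq =
      rearrange d (δ i zero) (δ i (suc v)) (w i ℤ.* B (cls i) (cls (suc v)))
    merge-same : ∀ d x w₁ w₀ z → (d ℤ.* x ℤ.+ w₁ ℤ.* z) ℤ.+ 1ℤ ℤ.* (d ℤ.* 0ℤ ℤ.+ w₀ ℤ.* z) ≡
      d ℤ.* x ℤ.+ (w₁ ℤ.+ 1ℤ ℤ.* w₀) ℤ.* z
    merge-same = solve-∀
    merge-other : ∀ x y w₁ w₀ z → (x ℤ.+ w₁ ℤ.* z) ℤ.+ 0ℤ ℤ.* y ≡
      x ℤ.+ (w₁ ℤ.+ 0ℤ ℤ.* w₀) ℤ.* z
    merge-other = solve-∀
    merged : (λ i j → blowUp d w B cls (suc i) (suc j) ℤ.+ δ i v ℤ.* blowUp d w B cls zero (suc j)) ≐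
      blowUp d (λ i → w (suc i) ℤ.+ δ i v ℤ.* w zero) B (cls ∘ suc)
    merged i j with i Fin.≟ v
    ... | yes ≡.refl rewrite eq | δ-suc i j =
      merge-same d (δ i j) (w (suc i)) (w zero) (B (cls (suc v)) (cls (suc j)))
    ... | no _ rewrite δ-suc i j =
      merge-other (d ℤ.* δ i j) (blowUp d w B cls zero (suc j))
        (w (suc i)) (w zero) (B (cls (suc i)) (cls (suc j)))

  blowUp-cong : ∀ {N} {w w′ : Fin N → ℤ} {cls cls′ : Fin N → X} →
    (∀ i → w i ≡ w′ i) → (∀ i → cls i ≡ cls′ i) → blowUp d w B cls ≐ blowUp d w′ B cls′
  blowUp-cong w≡ cls≡ i j =
    cong₂ (λ x y → d ℤ.* δ i j ℤ.+ x ℤ.* y) (w≡ i) (cong₂ B (cls≡ i) (cls≡ j))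

  -- Every target `t i` lies outside the block that disappears. Removing one vertex therefore leaves
  -- the weights of the vertices still to be removed untouched (`w₁-left`), and the contributions to
  -- a target just add up.
  det-merge-block : ∀ {N} k (w : Fin (k ℕ.+ N) → ℤ) (cls : Fin (k ℕ.+ N) → X) (t : Fin k → Fin N) →
    (∀ i → cls (i ↑ˡ N) ≡ cls (k ↑ʳ t i)) →
    detℤ (blowUp d w B cls) ≡
    d ℤ.^ k ℤ.* detℤ (blowUp d (λ p → w (k ↑ʳ p) ℤ.+ sum (λ i → δ p (t i) ℤ.* w (i ↑ˡ N))) B
                            (λ p → cls (k ↑ʳ p)))
  det-merge-block zero w cls t eq = ≡.sym (≡.trans
    (ℤ.*-identityˡ (detℤ (blowUp d (λ p → w p ℤ.+ 0ℤ) B cls)))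
    (det-cong (blowUp-cong (λ p → ℤ.+-identityʳ (w p)) (λ _ → ≡.refl))))
  det-merge-block {N} (suc k) w cls t eq = begin
    detℤ (blowUp d w B cls)
      ≡⟨ det-merge-twins w cls (k ↑ʳ t zero) (eq zero) ⟩
    d ℤ.* detℤ (blowUp d w₁ B (cls ∘ suc))
      ≡⟨ cong (ℤ._*_ (d)) (det-merge-block k w₁ (cls ∘ suc) (t ∘ suc) (eq ∘ suc)) ⟩
    d ℤ.* (d ℤ.^ k ℤ.* detℤ (blowUp d w₂ B (λ p → cls (suc k ↑ʳ p))))
      ≡⟨ ℤ.*-assoc d (d ℤ.^ k) _ ⟨
    d ℤ.^ suc k ℤ.* detℤ (blowUp d w₂ B (λ p → cls (suc k ↑ʳ p)))
      ≡⟨ cong (ℤ._*_ (d ℤ.^ suc k)) (det-cong (blowUp-cong w₂-total (λ _ → ≡.refl))) ⟩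
    d ℤ.^ suc k ℤ.* detℤ (blowUp d w₃ B (λ p → cls (suc k ↑ʳ p))) ∎
    where
    open ≡-Reasoning
    w₁ : Fin (k ℕ.+ N) → ℤ
    w₁ i = w (suc i) ℤ.+ δ i (k ↑ʳ t zero) ℤ.* w zero
    w₂ w₃ : Fin N → ℤ
    w₂ p = w₁ (k ↑ʳ p) ℤ.+ sum (λ i → δ p (t (suc i)) ℤ.* w₁ (i ↑ˡ N))
    w₃ p = w (suc k ↑ʳ p) ℤ.+ sum (λ i → δ p (t i) ℤ.* w (i ↑ˡ N))
    w₁-left : ∀ i → w₁ (i ↑ˡ N) ≡ w (suc (i ↑ˡ N))
    w₁-left i rewrite δ-≢ {i = i ↑ˡ N} {k ↑ʳ t zero} (↑ˡ≢↑ʳ i (t zero)) =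
      ℤ.+-identityʳ (w (suc (i ↑ˡ N)))
    w₂-total : ∀ p → w₂ p ≡ w₃ p
    w₂-total p
      rewrite δ-injective (k ↑ʳ_) (Fin.↑ʳ-injective k _ _) p (t zero)
            | sum-cong-≗ (λ i → cong (δ p (t (suc i)) ℤ.*_) (w₁-left i))
      = ℤ.+-assoc (w (suc k ↑ʳ p)) (δ p (t zero) ℤ.* w zero) _

sum-δ : ∀ {N} (i : Fin N) (f : Fin N → ℤ) → sum (λ j → δ i j ℤ.* f j) ≡ f i
sum-δ zero f = begin
  1ℤ ℤ.* f zero ℤ.+ sum (λ j → δ zero (suc j) ℤ.* f (suc j))
    ≡⟨ cong₂ ℤ._+_ (ℤ.*-identityˡ (f zero)) (sum-zero (λ j → 0ℤ ℤ.* f (suc j)) (λ _ → ≡.refl)) ⟩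
  f zero ℤ.+ 0ℤ
    ≡⟨ ℤ.+-identityʳ (f zero) ⟩
  f zero ∎
  where open ≡-Reasoning
sum-δ (suc i) f = begin
  0ℤ ℤ.* f zero ℤ.+ sum (λ j → δ (suc i) (suc j) ℤ.* f (suc j))
    ≡⟨ ℤ.+-identityˡ _ ⟩
  sum (λ j → δ (suc i) (suc j) ℤ.* f (suc j))
    ≡⟨ sum-cong-≗ (λ j → cong (ℤ._* f (suc j)) (δ-suc i j)) ⟩
  sum (λ j → δ i j ℤ.* f (suc j))
    ≡⟨ sum-δ i (f ∘ suc) ⟩
  f (suc i) ∎
  where open ≡-Reasoning

fold : ∀ N → Fin (N ℕ.+ N) → Fin N
fold N i = [ id , id ]′ (splitAt N i)

fold-↑ˡ : ∀ {N} (i : Fin N) → fold N (i ↑ˡ N) ≡ i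
fold-↑ˡ {N} i rewrite Fin.splitAt-↑ˡ N i N = ≡.refl

fold-↑ʳ : ∀ {N} (i : Fin N) → fold N (N ↑ʳ i) ≡ i
fold-↑ʳ {N} i rewrite Fin.splitAt-↑ʳ N N i = ≡.refl

det-double : ∀ {N} d w (B : Fin N → Fin N → ℤ) →
  detℤ (blowUp d (λ _ → w) B (fold N)) ≡
  d ℤ.^ N ℤ.* detℤ (λ i j → d ℤ.* δ i j ℤ.+ (w ℤ.+ w) ℤ.* B i j)
det-double {N} d w B = ≡.trans
  (det-merge-block d B N (λ _ → w) (fold N) id (λ i → ≡.trans (fold-↑ˡ i) (≡.sym (fold-↑ʳ i))))
  (cong (ℤ._*_ (d ℤ.^ N)) (det-cong (blowUp-cong d B
    (λ p → cong (ℤ._+_ w) (sum-δ p (λ _ → w))) fold-↑ʳ)))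

opaque
  unfolding detℤ

  det-2×2 : (A : Matrix ℤ 2) → detℤ A ≡
    A zero zero ℤ.* A (suc zero) (suc zero) ℤ.- A zero (suc zero) ℤ.* A (suc zero) zero
  det-2×2 A = expand (A zero zero) (A zero (suc zero)) (A (suc zero) zero) (A (suc zero) (suc zero))
    where
    expand : ∀ x y z u →
      1ℤ ℤ.* (x ℤ.* (1ℤ ℤ.* (u ℤ.* 1ℤ) ℤ.+ 0ℤ)) ℤ.+
      ((-1ℤ ℤ.* 1ℤ) ℤ.* (y ℤ.* (1ℤ ℤ.* (z ℤ.* 1ℤ) ℤ.+ 0ℤ)) ℤ.+ 0ℤ) ≡
      x ℤ.* u ℤ.- y ℤ.* z
    expand = solve-∀

-- Weighted K_{n,n} and the determinant of the adjacency matrix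

bit : ∀ n → Fin (n ℕ.* 2) → Fin 2
bit n = remainder {n} 2

-- The shape of weights that the induction in `det-bipartite` preserves: the front pair has absorbed
-- the vertices already removed, the others still have their initial weight.
firstTwo : ∀ {N} → ℤ → ℤ → Fin (2 ℕ.+ N) → ℤ
firstTwo u v zero          = u
firstTwo u v (suc zero)    = u
firstTwo u v (suc (suc i)) = v

distinct : ∀ {N} → Fin N → Fin N → ℤ
distinct i j = 1ℤ ℤ.- δ i j

-- Merging the front pair into the next pair contributes d² and replaces the weights (u, v) by (u +
-- v, v). After m such steps one vertex per side is left, of weight u + m v, and the last factor is
-- a 2×2 determinant.
det-bipartite : ∀ m d u v →
  detℤ (blowUp d (firstTwo u v) (λ p q → - distinct p q) (bit (suc m))) ≡
  d ℤ.^ (m ℕ.* 2) ℤ.* (d ℤ.* d ℤ.- (u ℤ.+ + m ℤ.* v) ℤ.* (u ℤ.+ + m ℤ.* v))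
det-bipartite zero d u v = ≡.trans
  (det-2×2 (blowUp d (firstTwo u v) (λ p q → - distinct p q) (bit 1)))
  (evaluate d u v)
  where
  evaluate : ∀ d u v →
    (d ℤ.* 1ℤ ℤ.+ u ℤ.* 0ℤ) ℤ.* (d ℤ.* 1ℤ ℤ.+ u ℤ.* 0ℤ) ℤ.-
    (d ℤ.* 0ℤ ℤ.+ u ℤ.* -1ℤ) ℤ.* (d ℤ.* 0ℤ ℤ.+ u ℤ.* -1ℤ) ≡
    1ℤ ℤ.* (d ℤ.* d ℤ.- (u ℤ.+ 0ℤ ℤ.* v) ℤ.* (u ℤ.+ 0ℤ ℤ.* v))
  evaluate = solve-∀
det-bipartite (suc m) d u v = begin
  detℤ (blowUp d (firstTwo u v) B (bit (2 ℕ.+ m)))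
    ≡⟨ det-merge-block d B 2 (firstTwo u v) (bit (2 ℕ.+ m)) (_↑ˡ (m ℕ.* 2))
         (λ { zero → ≡.refl ; (suc zero) → ≡.refl }) ⟩
  d ℤ.^ 2 ℤ.* detℤ (blowUp d w B (bit (suc m)))
    ≡⟨ cong (ℤ._*_ (d ℤ.^ 2)) (det-cong (blowUp-cong d B {cls = bit (suc m)} w≡ (λ _ → ≡.refl))) ⟩
  d ℤ.^ 2 ℤ.* detℤ (blowUp d (firstTwo (u ℤ.+ v) v) B (bit (suc m)))
    ≡⟨ cong (ℤ._*_ (d ℤ.^ 2)) (det-bipartite m d (u ℤ.+ v) v) ⟩
  d ℤ.^ 2 ℤ.* (d ℤ.^ (m ℕ.* 2) ℤ.*
    (d ℤ.* d ℤ.- (u ℤ.+ v ℤ.+ + m ℤ.* v) ℤ.* (u ℤ.+ v ℤ.+ + m ℤ.* v)))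
    ≡⟨ regroup d (d ℤ.^ (m ℕ.* 2)) u v (+ m) ⟩
  d ℤ.^ (suc m ℕ.* 2) ℤ.*
    (d ℤ.* d ℤ.- (u ℤ.+ + suc m ℤ.* v) ℤ.* (u ℤ.+ + suc m ℤ.* v)) ∎
  where
  open ≡-Reasoning
  B : Fin 2 → Fin 2 → ℤ
  B p q = - distinct p q
  w : Fin (suc m ℕ.* 2) → ℤ
  w p = firstTwo u v (2 ↑ʳ p) ℤ.+
    sum (λ i → δ p (i ↑ˡ (m ℕ.* 2)) ℤ.* firstTwo {suc m ℕ.* 2} u v (i ↑ˡ (suc m ℕ.* 2)))
  w≡ : ∀ p → w p ≡ firstTwo (u ℤ.+ v) v p
  w≡ zero          = first u v
    where
    first : ∀ u v → v ℤ.+ (1ℤ ℤ.* u ℤ.+ (0ℤ ℤ.* u ℤ.+ 0ℤ)) ≡ u ℤ.+ v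
    first = solve-∀
  w≡ (suc zero)    = second u v
    where
    second : ∀ u v → v ℤ.+ (0ℤ ℤ.* u ℤ.+ (1ℤ ℤ.* u ℤ.+ 0ℤ)) ≡ u ℤ.+ v
    second = solve-∀
  w≡ (suc (suc p)) = ℤ.+-identityʳ v
  regroup : ∀ d D u v m →
    (d ℤ.* (d ℤ.* 1ℤ)) ℤ.* (D ℤ.* (d ℤ.* d ℤ.- (u ℤ.+ v ℤ.+ m ℤ.* v) ℤ.* (u ℤ.+ v ℤ.+ m ℤ.* v))) ≡
    (d ℤ.* (d ℤ.* D)) ℤ.*
    (d ℤ.* d ℤ.- (u ℤ.+ (1ℤ ℤ.+ m) ℤ.* v) ℤ.* (u ℤ.+ (1ℤ ℤ.+ m) ℤ.* v))
  regroup = solve-∀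

-- quarterEntry is indexed by (c, p) and halfEntry by (β, c, p); δ q q′ - δ r r′ is 1 iff only β differs.
quarterEntry : ∀ n → Matrix ℤ (n ℕ.* 2)
quarterEntry n q q′ = distinct (bit n q) (bit n q′)

halfEntry : ∀ n → Matrix ℤ (n ℕ.* 2 ℕ.+ n ℕ.* 2)
halfEntry n r r′ = quarterEntry n q q′ ℤ.+ (δ q q′ ℤ.- δ r r′)
  where q = fold (n ℕ.* 2) r ; q′ = fold (n ℕ.* 2) r′

half size : ℕ → ℕ
half n = n ℕ.* 2 ℕ.+ n ℕ.* 2
size n = half n ℕ.+ half n

adjacency : ∀ n → Matrix ℤ (size n)
adjacency n i j = halfEntry n (fold (half n) i) (fold (half n) j)

det-adjacency : ∀ m x → let n = suc m in
  detℤ (λ i j → x ℤ.* δ i j ℤ.- adjacency n i j) ≡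
  x ℤ.^ half n ℤ.* ((x ℤ.+ + 2) ℤ.^ (n ℕ.* 2) ℤ.* ((x ℤ.- + 2) ℤ.^ (m ℕ.* 2) ℤ.*
    ((x ℤ.- + 2) ℤ.* (x ℤ.- + 2) ℤ.- (+ n ℤ.* + 4) ℤ.* (+ n ℤ.* + 4))))
det-adjacency m x = begin
  detℤ (λ i j → x ℤ.* δ i j ℤ.- adjacency n i j)
    ≡⟨ det-cong (λ i j → scale₁ (x ℤ.* δ i j) (adjacency n i j)) ⟩
  detℤ (blowUp x (λ _ → 1ℤ) (λ r r′ → - halfEntry n r r′) (fold (half n)))
    ≡⟨ det-double x 1ℤ (λ r r′ → - halfEntry n r r′) ⟩
  x ℤ.^ half n ℤ.* detℤ (λ r r′ → x ℤ.* δ r r′ ℤ.+ + 2 ℤ.* - halfEntry n r r′)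
    ≡⟨ cong (ℤ._*_ (x ℤ.^ half n)) (det-cong λ r r′ →
         scale₂ x (δ r r′) (δ (fold (n ℕ.* 2) r) (fold (n ℕ.* 2) r′))
           (quarterEntry n (fold (n ℕ.* 2) r) (fold (n ℕ.* 2) r′))) ⟩
  x ℤ.^ half n ℤ.* detℤ (blowUp (x ℤ.+ + 2) (λ _ → + 2)
    (λ q q′ → - (quarterEntry n q q′ ℤ.+ δ q q′)) (fold (n ℕ.* 2)))
    ≡⟨ cong (ℤ._*_ (x ℤ.^ half n)) (det-double (x ℤ.+ + 2) (+ 2)
         (λ q q′ → - (quarterEntry n q q′ ℤ.+ δ q q′))) ⟩
  x ℤ.^ half n ℤ.* ((x ℤ.+ + 2) ℤ.^ (n ℕ.* 2) ℤ.* detℤ (λ q q′ →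
    (x ℤ.+ + 2) ℤ.* δ q q′ ℤ.+ + 4 ℤ.* - (quarterEntry n q q′ ℤ.+ δ q q′)))
    ≡⟨ cong (λ z → x ℤ.^ half n ℤ.* ((x ℤ.+ + 2) ℤ.^ (n ℕ.* 2) ℤ.* z)) (det-cong λ q q′ →
         ≡.trans (scale₃ x (δ q q′) (quarterEntry n q q′))
           (cong (λ z → (x ℤ.- + 2) ℤ.* δ q q′ ℤ.+ z ℤ.* - quarterEntry n q q′)
             (≡.sym (constant q)))) ⟩
  x ℤ.^ half n ℤ.* ((x ℤ.+ + 2) ℤ.^ (n ℕ.* 2) ℤ.* detℤ
    (blowUp (x ℤ.- + 2) (firstTwo (+ 4) (+ 4)) (λ p p′ → - distinct p p′) (bit n)))
    ≡⟨ cong (λ z → x ℤ.^ half n ℤ.* ((x ℤ.+ + 2) ℤ.^ (n ℕ.* 2) ℤ.* z))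
         (≡.trans (det-bipartite m (x ℤ.- + 2) (+ 4) (+ 4))
           (cong (λ z → (x ℤ.- + 2) ℤ.^ (m ℕ.* 2) ℤ.* ((x ℤ.- + 2) ℤ.* (x ℤ.- + 2) ℤ.- z ℤ.* z))
             (collect (+ m)))) ⟩
  x ℤ.^ half n ℤ.* ((x ℤ.+ + 2) ℤ.^ (n ℕ.* 2) ℤ.* ((x ℤ.- + 2) ℤ.^ (m ℕ.* 2) ℤ.*
    ((x ℤ.- + 2) ℤ.* (x ℤ.- + 2) ℤ.- (+ n ℤ.* + 4) ℤ.* (+ n ℤ.* + 4)))) ∎
  where
  open ≡-Reasoning
  n = suc m
  scale₁ : ∀ x y → x ℤ.- y ≡ x ℤ.+ 1ℤ ℤ.* - y
  scale₁ = solve-∀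
  -- The summand `- δ r r′` of `halfEntry` is diagonal; carrying the weight 2 and a second minus
  -- sign, it raises x to x + 2. What remains depends only on the folded indices.
  scale₂ : ∀ x r q y → x ℤ.* r ℤ.+ + 2 ℤ.* - (y ℤ.+ (q ℤ.- r)) ≡
                       (x ℤ.+ + 2) ℤ.* r ℤ.+ + 2 ℤ.* - (y ℤ.+ q)
  scale₂ = solve-∀
  -- Now the term `δ q q′` has become diagonal as well; with the weight 4 it lowers x + 2 to x - 2.
  scale₃ : ∀ x q y → (x ℤ.+ + 2) ℤ.* q ℤ.+ + 4 ℤ.* - (y ℤ.+ q) ≡
                     (x ℤ.- + 2) ℤ.* q ℤ.+ + 4 ℤ.* - y
  scale₃ = solve-∀
  constant : ∀ {N} (q : Fin (2 ℕ.+ N)) → firstTwo (+ 4) (+ 4) q ≡ + 4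
  constant zero          = ≡.refl
  constant (suc zero)    = ≡.refl
  constant (suc (suc q)) = ≡.refl
  collect : ∀ m → + 4 ℤ.+ m ℤ.* + 4 ≡ (1ℤ ℤ.+ m) ℤ.* + 4
  collect = solve-∀

-- Evaluation of integer polynomials

eval : ℤ → Poly → ℤ
eval x []      = 0ℤ
eval x (c ∷ p) = c ℤ.+ x ℤ.* eval x p

linearFactors : List ℤ → Poly
linearFactors = foldr (λ c p → (x- c) *ₚ p) (1ℤ ∷ [])

module _ (x : ℤ) where

  eval-+ : ∀ p q → eval x (p +ₚ q) ≡ eval x p ℤ.+ eval x q
  eval-+ []      q       = ≡.sym (ℤ.+-identityˡ (eval x q))
  eval-+ (c ∷ p) []      = ≡.sym (ℤ.+-identityʳ (eval x (c ∷ p)))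
  eval-+ (c ∷ p) (d ∷ q) rewrite eval-+ p q = regroup c d x (eval x p) (eval x q)
    where
    regroup : ∀ c d x y z → (c ℤ.+ d) ℤ.+ x ℤ.* (y ℤ.+ z) ≡ (c ℤ.+ x ℤ.* y) ℤ.+ (d ℤ.+ x ℤ.* z)
    regroup = solve-∀

  eval-scale : ∀ c p → eval x (map (c ℤ.*_) p) ≡ c ℤ.* eval x p
  eval-scale c []      = ≡.sym (ℤ.*-zeroʳ c)
  eval-scale c (d ∷ p) rewrite eval-scale c p = regroup c d x (eval x p)
    where
    regroup : ∀ c d x y → c ℤ.* d ℤ.+ x ℤ.* (c ℤ.* y) ≡ c ℤ.* (d ℤ.+ x ℤ.* y)
    regroup = solve-∀

  eval-* : ∀ p q → eval x (p *ₚ q) ≡ eval x p ℤ.* eval x q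
  eval-* []      q = ≡.refl
  eval-* (c ∷ p) q
    rewrite eval-+ (map (c ℤ.*_) q) (0ℤ ∷ (p *ₚ q)) | eval-scale c q | eval-* p q =
    regroup c x (eval x p) (eval x q)
    where
    regroup : ∀ c x y z → c ℤ.* z ℤ.+ (0ℤ ℤ.+ x ℤ.* (y ℤ.* z)) ≡ (c ℤ.+ x ℤ.* y) ℤ.* z
    regroup = solve-∀

  eval-neg : ∀ p → eval x (map (λ c → - c) p) ≡ - eval x p
  eval-neg []      = ≡.refl
  eval-neg (c ∷ p) rewrite eval-neg p = regroup c x (eval x p)
    where
    regroup : ∀ c x y → - c ℤ.+ x ℤ.* - y ≡ - (c ℤ.+ x ℤ.* y)
    regroup = solve-∀

  eval-constant : ∀ c → eval x (c ∷ []) ≡ c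
  eval-constant c rewrite ℤ.*-zeroʳ x = ℤ.+-identityʳ c

  eval-linear : ∀ c → eval x (x- c) ≡ x ℤ.- c
  eval-linear c = simplify c x
    where
    simplify : ∀ c x → - c ℤ.+ x ℤ.* (1ℤ ℤ.+ x ℤ.* 0ℤ) ≡ x ℤ.- c
    simplify = solve-∀

  eval-^ : ∀ p k → eval x (p ^ₚ k) ≡ eval x p ^ᶻ k
  eval-^ p zero    = eval-constant 1ℤ
  eval-^ p (suc k) = ≡.trans (eval-* p (p ^ₚ k)) (cong (ℤ._*_ (eval x p)) (eval-^ p k))

  eval-sum : ∀ {N} (f : Fin N → Poly) → eval x (sumₚ f) ≡ sum (λ i → eval x (f i))
  eval-sum {zero}  f = ≡.refl
  eval-sum {suc N} f = ≡.trans (eval-+ (f zero) (sumₚ (f ∘ suc)))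
    (cong (ℤ._+_ (eval x (f zero))) (eval-sum (f ∘ suc)))

  eval-det : ∀ {N} (M : Matrix Poly N) → eval x (det ℤ[x] M) ≡ detℤ (λ i j → eval x (M i j))
  eval-det {zero}  M = ≡.trans (eval-constant 1ℤ) (≡.sym (det-empty _))
  eval-det {suc N} M = begin
    eval x (sumₚ termₚ)           ≡⟨ eval-sum termₚ ⟩
    sum (λ j → eval x (termₚ j))  ≡⟨ sum-cong-≗ eval-term ⟩
    sum (term M[x])               ≡⟨ det-expand M[x] ⟨
    detℤ M[x]                     ∎
    where
    open ≡-Reasoning
    M[x] : Matrix ℤ (suc N)
    M[x] i j = eval x (M i j)
    minorₚ : Fin (suc N) → Matrix Poly N
    minorₚ j i k = M (suc i) (Fin.punchIn j k)
    sign : ℕ → Poly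
    sign k = (-1ℤ ∷ []) ^ₚ k
    termₚ : Fin (suc N) → Poly
    termₚ j = sign (toℕ j) *ₚ (M zero j *ₚ det ℤ[x] (minorₚ j))
    eval-term : ∀ j → eval x (termₚ j) ≡ term M[x] j
    eval-term j
      rewrite eval-* (sign (toℕ j)) (M zero j *ₚ det ℤ[x] (minorₚ j))
            | eval-* (M zero j) (det ℤ[x] (minorₚ j))
            | eval-det (minorₚ j)
            | eval-^ (-1ℤ ∷ []) (toℕ j)
            | eval-constant -1ℤ
      = ≡.refl

  eval-charMatrix : ∀ {N} (A : Matrix ℤ N) i j →
                    eval x (charMatrix A i j) ≡ x ℤ.* δ i j ℤ.- A i j
  eval-charMatrix A i j with i Fin.≟ j
  ... | yes _ = ≡.trans (eval-linear (A i j)) (cong (ℤ._- A i j) (≡.sym (ℤ.*-identityʳ x)))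
  ... | no  _ = ≡.trans (eval-constant (- A i j))
                  (≡.trans (≡.sym (ℤ.+-identityˡ (- A i j)))
                    (cong (ℤ._- A i j) (≡.sym (ℤ.*-zeroʳ x))))

  eval-charpoly : ∀ {N} (A : Matrix ℤ N) →
                  eval x (charpoly A) ≡ detℤ (λ i j → x ℤ.* δ i j ℤ.- A i j)
  eval-charpoly A = ≡.trans (eval-det (charMatrix A)) (det-cong (eval-charMatrix A))

  linearProduct : List ℤ → ℤ
  linearProduct = foldr (λ c y → (x ℤ.- c) ℤ.* y) 1ℤ

  eval-linearFactors : ∀ λs → eval x (linearFactors λs) ≡ linearProduct λs
  eval-linearFactors []       = eval-constant 1ℤ
  eval-linearFactors (c ∷ λs) =
    ≡.trans (eval-* (x- c) (linearFactors λs)) (cong₂ ℤ._*_ (eval-linear c) (eval-linearFactors λs))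

  linearProduct-++ : ∀ λs μs → linearProduct (λs ++ μs) ≡ linearProduct λs ℤ.* linearProduct μs
  linearProduct-++ []       μs = ≡.sym (ℤ.*-identityˡ (linearProduct μs))
  linearProduct-++ (c ∷ λs) μs = ≡.trans
    (cong (ℤ._*_ (x ℤ.- c)) (linearProduct-++ λs μs))
    (≡.sym (ℤ.*-assoc (x ℤ.- c) (linearProduct λs) (linearProduct μs)))

  linearProduct-replicate : ∀ k c → linearProduct (replicate k c) ≡ (x ℤ.- c) ℤ.^ k
  linearProduct-replicate zero    c = ≡.refl
  linearProduct-replicate (suc k) c = cong (ℤ._*_ (x ℤ.- c)) (linearProduct-replicate k c)

-- At x = |c| + 1, the constant term c is a multiple of x, hence zero.
vanishing⇒zero : ∀ p → (∀ k → eval (+ suc k) p ≡ 0ℤ) → ∀ k → coeff p k ≡ 0ℤ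
vanishing⇒zero []      p≡0 k = ≡.refl
vanishing⇒zero (c ∷ p) p≡0 k = coefficients k
  where
  ∣c∣≡x∣p∣ : ℤ.∣ c ∣ ≡ suc ℤ.∣ c ∣ ℕ.* ℤ.∣ eval (+ suc ℤ.∣ c ∣) p ∣
  ∣c∣≡x∣p∣ = begin
    ℤ.∣ c ∣            ≡⟨ cong ℤ.∣_∣ (ℤ.i-j≡0⇒i≡j c (- (x ℤ.* y))
                           (≡.trans (cong (ℤ._+_ c) (ℤ.neg-involutive (x ℤ.* y))) (p≡0 ℤ.∣ c ∣))) ⟩
    ℤ.∣ - (x ℤ.* y) ∣  ≡⟨ ℤ.∣-i∣≡∣i∣ (x ℤ.* y) ⟩
    ℤ.∣ x ℤ.* y ∣      ≡⟨ ℤ.abs-* x y ⟩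
    suc ℤ.∣ c ∣ ℕ.* ℤ.∣ y ∣ ∎
    where
    open ≡-Reasoning
    x y : ℤ
    x = + suc ℤ.∣ c ∣
    y = eval x p
  too-small : ∀ m r → m ≡ suc m ℕ.* r → m ≡ 0
  too-small m zero    eq = ≡.trans eq (ℕ.*-zeroʳ (suc m))
  too-small m (suc r) eq = ⊥-elim (ℕ.1+n≰n
    (≡.subst (suc m ℕ.≤_) (≡.sym eq) (ℕ.m≤m*n (suc m) (suc r))))
  c≡0 : c ≡ 0ℤ
  c≡0 = ℤ.∣i∣≡0⇒i≡0 (too-small ℤ.∣ c ∣ _ ∣c∣≡x∣p∣)
  -- The evaluation points are nonzero, so the factor in front of the tail can be cancelled; at the
  -- point 0 this would fail.
  tail≡0 : ∀ k → eval (+ suc k) p ≡ 0ℤ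
  tail≡0 k with ℤ.i*j≡0⇒i≡0∨j≡0 (+ suc k) {eval (+ suc k) p}
                  (≡.trans (≡.sym (≡.trans (cong (ℤ._+ _) c≡0) (ℤ.+-identityˡ _))) (p≡0 k))
  ... | inj₂ y≡0 = y≡0
  coefficients : ∀ k → coeff (c ∷ p) k ≡ 0ℤ
  coefficients zero    = c≡0
  coefficients (suc k) = vanishing⇒zero p tail≡0 k

coeff-+ : ∀ p q k → coeff (p +ₚ q) k ≡ coeff p k ℤ.+ coeff q k
coeff-+ []      q       k       = ≡.sym (ℤ.+-identityˡ (coeff q k))
coeff-+ (c ∷ p) []      k       = ≡.sym (ℤ.+-identityʳ (coeff (c ∷ p) k))
coeff-+ (c ∷ p) (d ∷ q) zero    = ≡.refl
coeff-+ (c ∷ p) (d ∷ q) (suc k) = coeff-+ p q k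

coeff-neg : ∀ p k → coeff (map (λ c → - c) p) k ≡ - coeff p k
coeff-neg []      k       = ≡.refl
coeff-neg (c ∷ p) zero    = ≡.refl
coeff-neg (c ∷ p) (suc k) = coeff-neg p k

eval-injective : ∀ p q → (∀ k → eval (+ suc k) p ≡ eval (+ suc k) q) → ∀ k → coeff p k ≡ coeff q k
eval-injective p q p≡q k = ℤ.i-j≡0⇒i≡j (coeff p k) (coeff q k) (begin
  coeff p k ℤ.- coeff q k                      ≡⟨ cong (ℤ._+_ (coeff p k)) (coeff-neg q k) ⟨
  coeff p k ℤ.+ coeff (map (λ c → - c) q) k    ≡⟨ coeff-+ p (map (λ c → - c) q) k ⟨
  coeff (p +ₚ map (λ c → - c) q) k             ≡⟨ vanishing⇒zero (p +ₚ map (λ c → - c) q) difference k ⟩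
  0ℤ                                           ∎)
  where
  open ≡-Reasoning
  difference : ∀ k → eval (+ suc k) (p +ₚ map (λ c → - c) q) ≡ 0ℤ
  difference k
    rewrite eval-+ (+ suc k) p (map (λ c → - c) q) | eval-neg (+ suc k) q | p≡q k =
    ℤ.+-inverseʳ (eval (+ suc k) q)

-- The characteristic polynomial of the adjacency matrix

eigenvalues : ℕ → List ℤ
eigenvalues n =
    (- (+ (4 ℕ.* n)) ℤ.+ + 2)
  ∷ (+ (4 ℕ.* n) ℤ.+ + 2)
  ∷ replicate (2 ℕ.* n ∸ 2) (+ 2)
  ++ replicate (2 ℕ.* n) (- (+ 2))
  ++ replicate (4 ℕ.* n) (+ 0)

adjacency-spectrum : ∀ m → IsSpectrum (adjacency (suc m)) (eigenvalues (suc m))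
adjacency-spectrum m = 
  eval-injective (charpoly (adjacency n)) (linearFactors (eigenvalues n)) λ k → agree (+ suc k)
  where
  open ≡-Reasoning
  n = suc m
  quadruple : ∀ n → 4 ℕ.* n ≡ n ℕ.* 2 ℕ.+ n ℕ.* 2
  quadruple = ℕ.solve-∀
  -- A difference of squares: (x - 2)² - N² = (x - 2 + N)(x - 2 - N), with N = 4n.
  factorise : ∀ x D E F N →
    F ℤ.* (E ℤ.* (D ℤ.* ((x ℤ.- + 2) ℤ.* (x ℤ.- + 2) ℤ.- N ℤ.* N))) ≡
    (x ℤ.- (- N ℤ.+ + 2)) ℤ.* ((x ℤ.- (N ℤ.+ + 2)) ℤ.* (D ℤ.* (E ℤ.* F)))
  factorise = solve-∀
  factors : ∀ x j k l → linearProduct x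
    (replicate j (+ 2) ++ replicate k (- (+ 2)) ++ replicate l (+ 0)) ≡
    (x ℤ.- + 2) ℤ.^ j ℤ.* ((x ℤ.+ + 2) ℤ.^ k ℤ.* x ℤ.^ l)
  factors x j k l = begin
    linearProduct x (replicate j (+ 2) ++ replicate k (- (+ 2)) ++ replicate l (+ 0))
      ≡⟨ linearProduct-++ x (replicate j (+ 2)) (replicate k (- (+ 2)) ++ replicate l (+ 0)) ⟩
    linearProduct x (replicate j (+ 2)) ℤ.*
      linearProduct x (replicate k (- (+ 2)) ++ replicate l (+ 0))
      ≡⟨ cong₂ ℤ._*_ (linearProduct-replicate x j (+ 2))
           (linearProduct-++ x (replicate k (- (+ 2))) (replicate l (+ 0))) ⟩
    (x ℤ.- + 2) ℤ.^ j ℤ.* (linearProduct x (replicate k (- (+ 2))) ℤ.*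
      linearProduct x (replicate l (+ 0)))
      ≡⟨ cong₂ (λ y z → (x ℤ.- + 2) ℤ.^ j ℤ.* (y ℤ.* z))
           (linearProduct-replicate x k (- (+ 2)))
           (≡.trans (linearProduct-replicate x l (+ 0)) (cong (ℤ._^ l) (ℤ.+-identityʳ x))) ⟩
    (x ℤ.- + 2) ℤ.^ j ℤ.* ((x ℤ.+ + 2) ℤ.^ k ℤ.* x ℤ.^ l) ∎
  outer : ℤ → ℤ → ℤ → ℤ
  outer x N y = (x ℤ.- (- N ℤ.+ + 2)) ℤ.* ((x ℤ.- (N ℤ.+ + 2)) ℤ.* y)
  inner : ℤ → ℕ → ℕ → ℕ → ℤ
  inner x j k l = (x ℤ.- + 2) ℤ.^ j ℤ.* ((x ℤ.+ + 2) ℤ.^ k ℤ.* x ℤ.^ l)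
  inner-cong : ∀ x {j j′ k k′ l l′} → j ≡ j′ → k ≡ k′ → l ≡ l′ → inner x j k l ≡ inner x j′ k′ l′
  inner-cong x ≡.refl ≡.refl ≡.refl = ≡.refl
  agree : ∀ x → eval x (charpoly (adjacency n)) ≡
                eval x (linearFactors (eigenvalues n))
  agree x = begin
    eval x (charpoly (adjacency n))
      ≡⟨ eval-charpoly x (adjacency n) ⟩
    detℤ (λ i j → x ℤ.* δ i j ℤ.- adjacency n i j)
      ≡⟨ det-adjacency m x ⟩
    x ℤ.^ half n ℤ.* ((x ℤ.+ + 2) ℤ.^ (n ℕ.* 2) ℤ.* ((x ℤ.- + 2) ℤ.^ (m ℕ.* 2) ℤ.*
      ((x ℤ.- + 2) ℤ.* (x ℤ.- + 2) ℤ.- (+ n ℤ.* + 4) ℤ.* (+ n ℤ.* + 4))))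
      ≡⟨ factorise x ((x ℤ.- + 2) ℤ.^ (m ℕ.* 2)) ((x ℤ.+ + 2) ℤ.^ (n ℕ.* 2))
           (x ℤ.^ half n) (+ n ℤ.* + 4) ⟩
    outer x (+ n ℤ.* + 4) (inner x (m ℕ.* 2) (n ℕ.* 2) (half n))
      -- As n is `suc m`, `n * 2 ∸ 2` computes to `m * 2`, so the truncated subtraction in the
      -- listed multiplicity loses nothing.
      ≡⟨ cong₂ (outer x) (≡.trans (≡.sym (ℤ.pos-* n 4)) (cong +_ (ℕ.*-comm n 4)))
           (inner-cong x (cong (_∸ 2) (ℕ.*-comm n 2)) (ℕ.*-comm n 2) (≡.sym (quadruple n))) ⟩
    outer x (+ (4 ℕ.* n)) (inner x (2 ℕ.* n ∸ 2) (2 ℕ.* n) (4 ℕ.* n))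
      ≡⟨ cong (outer x (+ (4 ℕ.* n))) (factors x (2 ℕ.* n ∸ 2) (2 ℕ.* n) (4 ℕ.* n)) ⟨
    linearProduct x (eigenvalues n)
      ≡⟨ eval-linearFactors x (eigenvalues n) ⟨
    eval x (linearFactors (eigenvalues n)) ∎

-- Integer powers in a group

-- Steps by `1ℤ ℤ.+ r` in both directions hide the two constructors of ℤ. For identities in a group
-- one computation then serves twice: the downward step is the upward one followed by cancellation.
ℤ-induction : ∀ {p} (P : ℤ → Set p) → P 0ℤ → (∀ r → P r → P (1ℤ ℤ.+ r)) →
              (∀ r → P (1ℤ ℤ.+ r) → P r) → ∀ r → P r
ℤ-induction P P₀ up down (+ zero)      = P₀
ℤ-induction P P₀ up down (+ suc k)     = up (+ k) (ℤ-induction P P₀ up down (+ k))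
ℤ-induction P P₀ up down -[1+ zero ]   = down -[1+ 0 ] P₀
ℤ-induction P P₀ up down -[1+ suc k ]  = down -[1+ suc k ] (ℤ-induction P P₀ up down -[1+ k ])

module IntegerPowers {c ℓ} (G : Group c ℓ) where
  private module G = Group G
  open Group G using (_≈_) renaming (Carrier to C; _∙_ to _·_; ε to e; _⁻¹ to inv)
  open GroupProperties G using (⁻¹-anti-homo-∙; inverseˡ-unique; ∙-cancelˡ)
  open RawMonoidDefinitions G.rawMonoid using () renaming (_×_ to _times_)
  open MonoidMult G.monoid using (×-homo-+; ×-congʳ)
  open SetoidReasoning G.setoid

  pow : C → ℤ → C
  pow x (+ k)    = k times x
  pow x -[1+ k ] = inv (suc k times x)

  pow-suc : ∀ x r → pow x (1ℤ ℤ.+ r) ≈ x · pow x r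
  pow-suc x (+ k)        = G.refl
  pow-suc x -[1+ zero ]  = begin
    e               ≈⟨ G.inverseʳ x ⟨
    x · inv x       ≈⟨ G.∙-congˡ (G.⁻¹-cong (G.identityʳ x)) ⟨
    x · inv (x · e) ∎
  pow-suc x -[1+ suc k ] = begin
    inv y                  ≈⟨ G.identityˡ (inv y) ⟨
    e · inv y              ≈⟨ G.∙-congʳ (G.inverseʳ x) ⟨
    (x · inv x) · inv y    ≈⟨ G.assoc x (inv x) (inv y) ⟩
    x · (inv x · inv y)    ≈⟨ G.∙-congˡ (⁻¹-anti-homo-∙ y x) ⟨
    x · inv (y · x)        ≈⟨ G.∙-congˡ (G.⁻¹-cong commute) ⟩
    x · inv (x · y)        ∎
    where
    y = suc k times x
    commute : y · x ≈ x · y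
    commute = begin
      y · x                ≈⟨ G.∙-congˡ (G.identityʳ x) ⟨
      y · (1 times x)      ≈⟨ ×-homo-+ x (suc k) 1 ⟨
      (suc k ℕ.+ 1) times x ≡⟨ cong (_times x) (ℕ.+-comm (suc k) 1) ⟩
      x · y                ∎

  pow-+ : ∀ x r s → pow x (r ℤ.+ s) ≈ pow x r · pow x s
  pow-+ x r s = ℤ-induction (λ r → pow x (r ℤ.+ s) ≈ pow x r · pow x s)
    (begin
      pow x (0ℤ ℤ.+ s)  ≡⟨ cong (pow x) (ℤ.+-identityˡ s) ⟩
      pow x s           ≈⟨ G.identityˡ (pow x s) ⟨
      e · pow x s       ∎)
    (λ r hyp → begin
      pow x (1ℤ ℤ.+ r ℤ.+ s)      ≈⟨ first-factor r ⟩
      x · pow x (r ℤ.+ s)         ≈⟨ G.∙-congˡ hyp ⟩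
      x · (pow x r · pow x s)     ≈⟨ G.assoc x (pow x r) (pow x s) ⟨
      (x · pow x r) · pow x s     ≈⟨ G.∙-congʳ (pow-suc x r) ⟨
      pow x (1ℤ ℤ.+ r) · pow x s  ∎)
    (λ r hyp → ∙-cancelˡ x (pow x (r ℤ.+ s)) (pow x r · pow x s) (begin
      x · pow x (r ℤ.+ s)         ≈⟨ first-factor r ⟨
      pow x (1ℤ ℤ.+ r ℤ.+ s)      ≈⟨ hyp ⟩
      pow x (1ℤ ℤ.+ r) · pow x s  ≈⟨ G.∙-congʳ (pow-suc x r) ⟩
      (x · pow x r) · pow x s     ≈⟨ G.assoc x (pow x r) (pow x s) ⟩
      x · (pow x r · pow x s)     ∎))
    r
    where
    first-factor : ∀ r → pow x (1ℤ ℤ.+ r ℤ.+ s) ≈ x · pow x (r ℤ.+ s)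
    first-factor r = G.trans (G.reflexive (cong (pow x) (ℤ.+-assoc 1ℤ r s))) (pow-suc x (r ℤ.+ s))

  pow-neg : ∀ x r → pow x (- r) ≈ inv (pow x r)
  pow-neg x r = inverseˡ-unique (pow x (- r)) (pow x r) (begin
    pow x (- r) · pow x r  ≈⟨ pow-+ x (- r) r ⟨
    pow x (- r ℤ.+ r)      ≡⟨ cong (pow x) (ℤ.+-inverseˡ r) ⟩
    e                      ∎)

  pow-* : ∀ x r s → pow x (r ℤ.* s) ≈ pow (pow x r) s
  pow-* x r = ℤ-induction (λ s → pow x (r ℤ.* s) ≈ pow (pow x r) s)
    (G.reflexive (cong (pow x) (ℤ.*-zeroʳ r)))
    (λ s hyp → begin
      pow x (r ℤ.* (1ℤ ℤ.+ s))         ≈⟨ first-factor s ⟩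
      pow x r · pow x (r ℤ.* s)        ≈⟨ G.∙-congˡ hyp ⟩
      pow x r · pow (pow x r) s        ≈⟨ pow-suc (pow x r) s ⟨
      pow (pow x r) (1ℤ ℤ.+ s)         ∎)
    (λ s hyp → ∙-cancelˡ (pow x r) (pow x (r ℤ.* s)) (pow (pow x r) s) (begin
      pow x r · pow x (r ℤ.* s)        ≈⟨ first-factor s ⟨
      pow x (r ℤ.* (1ℤ ℤ.+ s))         ≈⟨ hyp ⟩
      pow (pow x r) (1ℤ ℤ.+ s)         ≈⟨ pow-suc (pow x r) s ⟩
      pow x r · pow (pow x r) s        ∎))
    where
    first-factor : ∀ s → pow x (r ℤ.* (1ℤ ℤ.+ s)) ≈ pow x r · pow x (r ℤ.* s)
    first-factor s = G.trans (G.reflexive (cong (pow x) (distribute r s))) (pow-+ x r (r ℤ.* s))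
      where
      distribute : ∀ r s → r ℤ.* (1ℤ ℤ.+ s) ≡ r ℤ.+ r ℤ.* s
      distribute = solve-∀

  pow-cong : ∀ {x y} → x ≈ y → ∀ r → pow x r ≈ pow y r
  pow-cong x≈y (+ k)    = ×-congʳ k x≈y
  pow-cong x≈y -[1+ k ] = G.⁻¹-cong (×-congʳ (suc k) x≈y)

  pow-e : ∀ r → pow e r ≈ e
  -- The base `e` is read as `pow e 0ℤ`, so the exponents multiply to zero.
  pow-e r = G.trans (G.sym (pow-* e 0ℤ r)) (G.reflexive (cong (pow e) (ℤ.*-zeroˡ r)))

-- The sign (-1)^s, formed as a power in the two-element group of signs so that `pow-+` makes it
-- multiplicative for negative exponents too.
alternating : ℤ → ℤ
alternating s = IntegerPowers.pow Sign.*-group Sign.- s ℤ.◃ 1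

module _ where
  open IntegerPowers Sign.*-group

  alternating-+ : ∀ r s → alternating (r ℤ.+ s) ≡ alternating r ℤ.* alternating s
  alternating-+ r s = ≡.trans (cong (ℤ._◃ 1) (pow-+ Sign.- r s)) (multiply (pow Sign.- r) (pow Sign.- s))
    where
    multiply : ∀ s t → (s Sign.* t) ℤ.◃ 1 ≡ (s ℤ.◃ 1) ℤ.* (t ℤ.◃ 1)
    multiply Sign.- Sign.- = ≡.refl
    multiply Sign.- Sign.+ = ≡.refl
    multiply Sign.+ Sign.- = ≡.refl
    multiply Sign.+ Sign.+ = ≡.refl

alternating-cases : ∀ s → alternating s ≡ 1ℤ ⊎ alternating s ≡ -1ℤ
alternating-cases s with IntegerPowers.pow Sign.*-group Sign.- s
... | Sign.+ = inj₁ ≡.refl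
... | Sign.- = inj₂ ≡.refl

alternating² : ∀ s → alternating s ℤ.* alternating s ≡ 1ℤ
alternating² s with alternating s | alternating-cases s
... | _ | inj₁ ≡.refl = ≡.refl
... | _ | inj₂ ≡.refl = ≡.refl

alternating-double : ∀ s → alternating (+ 2 ℤ.* s) ≡ 1ℤ
alternating-double s = begin
  alternating (+ 2 ℤ.* s)              ≡⟨ cong alternating (double s) ⟩
  alternating (s ℤ.+ s)                ≡⟨ alternating-+ s s ⟩
  alternating s ℤ.* alternating s      ≡⟨ alternating² s ⟩
  1ℤ                                   ∎
  where
  open ≡-Reasoning
  double : ∀ s → + 2 ℤ.* s ≡ s ℤ.+ s
  double = solve-∀

alternating-+-double : ∀ r s → alternating (r ℤ.+ + 2 ℤ.* s) ≡ alternating r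
alternating-+-double r s = begin
  alternating (r ℤ.+ + 2 ℤ.* s)                ≡⟨ alternating-+ r (+ 2 ℤ.* s) ⟩
  alternating r ℤ.* alternating (+ 2 ℤ.* s)    ≡⟨ cong (ℤ._*_ (alternating r)) (alternating-double s) ⟩
  alternating r ℤ.* 1ℤ                         ≡⟨ ℤ.*-identityʳ (alternating r) ⟩
  alternating r                                ∎
  where open ≡-Reasoning

alternating-neg : ∀ s → alternating (- s) ≡ alternating s
alternating-neg s = ≡.trans
  (≡.sym (alternating-+-double (- s) s))
  (cong alternating (cancel s))
  where
  cancel : ∀ s → - s ℤ.+ + 2 ℤ.* s ≡ s
  cancel = solve-∀

-- The word problem in T_{8n}

-- The exponents of a word in the group ⟨a, b ∣ b⁻¹ab = a⁻¹⟩ ≅ ℤ ⋊ ℤ, where it equals a^(expᵃ x) b^(expᵇ x).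
expᵇ : Term Letter → ℤ
expᵇ (gen 𝕒)  = 0ℤ
expᵇ (gen 𝕓)  = 1ℤ
expᵇ ε        = 0ℤ
expᵇ (x ∙ y)  = expᵇ x ℤ.+ expᵇ y
expᵇ (x ⁻¹)   = - expᵇ x

expᵃ : Term Letter → ℤ
expᵃ (gen 𝕒)  = 1ℤ
expᵃ (gen 𝕓)  = 0ℤ
expᵃ ε        = 0ℤ
expᵃ (x ∙ y)  = expᵃ x ℤ.+ alternating (expᵇ x) ℤ.* expᵃ y
expᵃ (x ⁻¹)   = - (alternating (expᵇ x) ℤ.* expᵃ x)

expᵃ-a^ : ∀ k → expᵃ (a ^ k) ≡ + k
expᵃ-a^ zero    = ≡.refl
expᵃ-a^ (suc k) rewrite expᵃ-a^ k = cong (ℤ._+_ 1ℤ) (ℤ.*-identityˡ (+ k))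

expᵇ-a^ : ∀ k → expᵇ (a ^ k) ≡ 0ℤ
expᵇ-a^ zero    = ≡.refl
expᵇ-a^ (suc k) rewrite expᵇ-a^ k = ≡.refl

expᵃ-b^ : ∀ k → expᵃ (b ^ k) ≡ 0ℤ
expᵃ-b^ zero    = ≡.refl
expᵃ-b^ (suc k) rewrite expᵃ-b^ k = ≡.refl

expᵇ-b^ : ∀ k → expᵇ (b ^ k) ≡ + k
expᵇ-b^ zero    = ≡.refl
expᵇ-b^ (suc k) rewrite expᵇ-b^ k = ≡.refl

module Presentation (n : ℕ) where
  open Group (T n) using (_≈_)
  open IntegerPowers (T n)

  -- Equality modulo the normal subgroup { (n k , 4 l) ∣ k + l even } of ℤ ⋊ ℤ; here k = 2 j - l.
  Congruent : Term Letter → Term Letter → Set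
  Congruent x y = Σ[ j ∈ ℤ ] Σ[ l ∈ ℤ ]
    ( expᵇ x ≡ expᵇ y ℤ.+ + 4 ℤ.* l
    × expᵃ x ≡ expᵃ y ℤ.+ + n ℤ.* (+ 2 ℤ.* j ℤ.- l) )

  congruent-refl : ∀ {x y} → expᵇ x ≡ expᵇ y → expᵃ x ≡ expᵃ y → Congruent x y
  congruent-refl {x} {y} eqᵇ eqᵃ =
    0ℤ , 0ℤ , ≡.trans eqᵇ (≡.sym (ℤ.+-identityʳ (expᵇ y)))
            , ≡.trans eqᵃ (≡.sym (≡.trans (cong (ℤ._+_ (expᵃ y)) (ℤ.*-zeroʳ (+ n)))
                                          (ℤ.+-identityʳ (expᵃ y))))

  congruent-alternating : ∀ {x y} → Congruent x y → alternating (expᵇ x) ≡ alternating (expᵇ y)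
  congruent-alternating {x} {y} (j , l , eqᵇ , _) =
    ≡.trans (cong alternating (≡.trans eqᵇ (cong (ℤ._+_ (expᵇ y)) (four l))))
            (alternating-+-double (expᵇ y) (+ 2 ℤ.* l))
    where
    four : ∀ l → + 4 ℤ.* l ≡ + 2 ℤ.* (+ 2 ℤ.* l)
    four = solve-∀

  private
    sumᵇ : ∀ s t l₁ l₂ → (s ℤ.+ + 4 ℤ.* l₁) ℤ.+ (t ℤ.+ + 4 ℤ.* l₂) ≡
           s ℤ.+ t ℤ.+ + 4 ℤ.* (l₁ ℤ.+ l₂)
    sumᵇ = solve-∀

    negᵇ : ∀ s l → - (s ℤ.+ + 4 ℤ.* l) ≡ - s ℤ.+ + 4 ℤ.* - l
    negᵇ = solve-∀

  congruent-∙ : ∀ {x x′ y y′} → Congruent x x′ → Congruent y y′ → Congruent (x ∙ y) (x′ ∙ y′)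
  congruent-∙ {x} {x′} {y} {y′} x~x′@(j₁ , l₁ , eqᵇ₁ , eqᵃ₁) (j₂ , l₂ , eqᵇ₂ , eqᵃ₂)
    rewrite congruent-alternating {x} {x′} x~x′ | eqᵇ₁ | eqᵃ₁ | eqᵇ₂ | eqᵃ₂
    with alternating (expᵇ x′) | alternating-cases (expᵇ x′)
  ... | _ | inj₁ ≡.refl = j₁ ℤ.+ j₂ , l₁ ℤ.+ l₂ ,
      sumᵇ (expᵇ x′) (expᵇ y′) l₁ l₂ , sumᵃ (expᵃ x′) (expᵃ y′) j₁ j₂ l₁ l₂ (+ n)
    where
    sumᵃ : ∀ r q j₁ j₂ l₁ l₂ n →
      (r ℤ.+ n ℤ.* (+ 2 ℤ.* j₁ ℤ.- l₁)) ℤ.+ 1ℤ ℤ.* (q ℤ.+ n ℤ.* (+ 2 ℤ.* j₂ ℤ.- l₂)) ≡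
      r ℤ.+ 1ℤ ℤ.* q ℤ.+ n ℤ.* (+ 2 ℤ.* (j₁ ℤ.+ j₂) ℤ.- (l₁ ℤ.+ l₂))
    sumᵃ = solve-∀
  -- An odd exponent of b in front reverses k₂ = 2 j₂ - l₂ but keeps l₂. Solving k₁ - k₂ = 2 j - (l₁
  -- + l₂) for j gives this witness.
  ... | _ | inj₂ ≡.refl = j₁ ℤ.+ l₂ ℤ.- j₂ , l₁ ℤ.+ l₂ ,
      sumᵇ (expᵇ x′) (expᵇ y′) l₁ l₂ , sumᵃ (expᵃ x′) (expᵃ y′) j₁ j₂ l₁ l₂ (+ n)
    where
    sumᵃ : ∀ r q j₁ j₂ l₁ l₂ n →
      (r ℤ.+ n ℤ.* (+ 2 ℤ.* j₁ ℤ.- l₁)) ℤ.+ -1ℤ ℤ.* (q ℤ.+ n ℤ.* (+ 2 ℤ.* j₂ ℤ.- l₂)) ≡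
      r ℤ.+ -1ℤ ℤ.* q ℤ.+ n ℤ.* (+ 2 ℤ.* (j₁ ℤ.+ l₂ ℤ.- j₂) ℤ.- (l₁ ℤ.+ l₂))
    sumᵃ = solve-∀

  congruent-⁻¹ : ∀ {x y} → Congruent x y → Congruent (x ⁻¹) (y ⁻¹)
  congruent-⁻¹ {x} {y} x~y@(j , l , eqᵇ , eqᵃ)
    rewrite congruent-alternating {x} {y} x~y | eqᵇ | eqᵃ
    with alternating (expᵇ y) | alternating-cases (expᵇ y)
  ... | _ | inj₁ ≡.refl = - j , - l , negᵇ (expᵇ y) l , negᵃ (expᵃ y) j l (+ n)
    where
    negᵃ : ∀ r j l n → - (1ℤ ℤ.* (r ℤ.+ n ℤ.* (+ 2 ℤ.* j ℤ.- l))) ≡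
           - (1ℤ ℤ.* r) ℤ.+ n ℤ.* (+ 2 ℤ.* - j ℤ.- - l)
    negᵃ = solve-∀
  -- Inversion with an odd exponent of b keeps k = 2 j - l while l changes sign, so the new j has to
  -- satisfy 2 j′ + l = 2 j - l.
  ... | _ | inj₂ ≡.refl = j ℤ.- l , - l , negᵇ (expᵇ y) l , negᵃ (expᵃ y) j l (+ n)
    where
    negᵃ : ∀ r j l n → - (-1ℤ ℤ.* (r ℤ.+ n ℤ.* (+ 2 ℤ.* j ℤ.- l))) ≡
           - (-1ℤ ℤ.* r) ℤ.+ n ℤ.* (+ 2 ℤ.* (j ℤ.- l) ℤ.- - l)
    negᵃ = solve-∀

  congruent-sym : ∀ {x y} → Congruent x y → Congruent y x
  congruent-sym {x} {y} (j , l , eqᵇ , eqᵃ) rewrite eqᵇ | eqᵃ =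
    - j , - l , cancelᵇ (expᵇ y) l , cancelᵃ (expᵃ y) j l (+ n)
    where
    cancelᵇ : ∀ s l → s ≡ s ℤ.+ + 4 ℤ.* l ℤ.+ + 4 ℤ.* - l
    cancelᵇ = solve-∀
    cancelᵃ : ∀ r j l n → r ≡ r ℤ.+ n ℤ.* (+ 2 ℤ.* j ℤ.- l) ℤ.+ n ℤ.* (+ 2 ℤ.* - j ℤ.- - l)
    cancelᵃ = solve-∀

  congruent-trans : ∀ {x y z} → Congruent x y → Congruent y z → Congruent x z
  congruent-trans {x} {y} {z} (j₁ , l₁ , eqᵇ₁ , eqᵃ₁) (j₂ , l₂ , eqᵇ₂ , eqᵃ₂)
    rewrite eqᵇ₁ | eqᵃ₁ | eqᵇ₂ | eqᵃ₂ =
    j₁ ℤ.+ j₂ , l₁ ℤ.+ l₂ , mergeᵇ (expᵇ z) l₁ l₂ , mergeᵃ (expᵃ z) j₁ j₂ l₁ l₂ (+ n)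
    where
    mergeᵇ : ∀ s l₁ l₂ → s ℤ.+ + 4 ℤ.* l₂ ℤ.+ + 4 ℤ.* l₁ ≡ s ℤ.+ + 4 ℤ.* (l₁ ℤ.+ l₂)
    mergeᵇ = solve-∀
    mergeᵃ : ∀ r j₁ j₂ l₁ l₂ n →
      r ℤ.+ n ℤ.* (+ 2 ℤ.* j₂ ℤ.- l₂) ℤ.+ n ℤ.* (+ 2 ℤ.* j₁ ℤ.- l₁) ≡
      r ℤ.+ n ℤ.* (+ 2 ℤ.* (j₁ ℤ.+ j₂) ℤ.- (l₁ ℤ.+ l₂))
    mergeᵃ = solve-∀

  -- `Generated` is the least congruence with the group laws and the relations, so it suffices that
  -- `Congruent` has all of these. The conjugation relation holds in ℤ ⋊ ℤ already; the other three
  -- have (k, l) equal to (2, 0), (0, 2) and (1, -1), expressed through k = 2 j - l. This is the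
  -- direction that keeps elements of the presented group apart.
  ≈⇒congruent : ∀ {x y} → x ≈ y → Congruent x y
  ≈⇒congruent (relation a²ⁿ≈e) = 1ℤ , 0ℤ , expᵇ-a^ (2 ℕ.* n) ,
    ≡.trans (expᵃ-a^ (2 ℕ.* n)) (≡.trans (ℤ.pos-* 2 n) (expand (+ n)))
    where
    expand : ∀ n → + 2 ℤ.* n ≡ 0ℤ ℤ.+ n ℤ.* (+ 2 ℤ.* 1ℤ ℤ.- 0ℤ)
    expand = solve-∀
  ≈⇒congruent (relation b⁸≈e) = 1ℤ , + 2 , ≡.refl , expand (+ n)
    where
    expand : ∀ n → 0ℤ ≡ 0ℤ ℤ.+ n ℤ.* (+ 2 ℤ.* 1ℤ ℤ.- + 2)
    expand = solve-∀
  ≈⇒congruent (relation aⁿ≈b⁴) = 0ℤ , -1ℤ , expᵇ-a^ n , ≡.trans (expᵃ-a^ n) (expand (+ n))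
    where
    expand : ∀ n → n ≡ 0ℤ ℤ.+ n ℤ.* (+ 2 ℤ.* 0ℤ ℤ.- -1ℤ)
    expand = solve-∀
  ≈⇒congruent (relation b⁻¹ab≈a⁻¹) =
    congruent-refl {(b ⁻¹ ∙ a) ∙ b} {a ⁻¹} ≡.refl ≡.refl
  ≈⇒congruent {x} refl = congruent-refl {x} {x} ≡.refl ≡.refl
  ≈⇒congruent (sym {x} {y} x≈y) = congruent-sym {x} {y} (≈⇒congruent x≈y)
  ≈⇒congruent (trans {x} {y} {z} x≈y y≈z) =
    congruent-trans {x} {y} {z} (≈⇒congruent x≈y) (≈⇒congruent y≈z)
  ≈⇒congruent (∙-cong {x} {x′} {y} {y′} x≈x′ y≈y′) =
    congruent-∙ {x} {x′} {y} {y′} (≈⇒congruent x≈x′) (≈⇒congruent y≈y′)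
  ≈⇒congruent (⁻¹-cong {x} {y} x≈y) = congruent-⁻¹ {x} {y} (≈⇒congruent x≈y)
  ≈⇒congruent (assoc x y z) = congruent-refl {(x ∙ y) ∙ z} {x ∙ (y ∙ z)}
    (ℤ.+-assoc (expᵇ x) (expᵇ y) (expᵇ z))
    (≡.trans
      (cong (λ α → expᵃ x ℤ.+ alternating (expᵇ x) ℤ.* expᵃ y ℤ.+ α ℤ.* expᵃ z)
        (alternating-+ (expᵇ x) (expᵇ y)))
      (regroup (expᵃ x) (expᵃ y) (expᵃ z) (alternating (expᵇ x)) (alternating (expᵇ y))))
    where
    regroup : ∀ r q p α β → r ℤ.+ α ℤ.* q ℤ.+ (α ℤ.* β) ℤ.* p ≡ r ℤ.+ α ℤ.* (q ℤ.+ β ℤ.* p)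
    regroup = solve-∀
  ≈⇒congruent (identityˡ x) = congruent-refl {ε ∙ x} {x}
    (ℤ.+-identityˡ (expᵇ x))
    (≡.trans (ℤ.+-identityˡ (1ℤ ℤ.* expᵃ x)) (ℤ.*-identityˡ (expᵃ x)))
  ≈⇒congruent (identityʳ x) = congruent-refl {x ∙ ε} {x}
    (ℤ.+-identityʳ (expᵇ x))
    (≡.trans (cong (ℤ._+_ (expᵃ x)) (ℤ.*-zeroʳ (alternating (expᵇ x)))) (ℤ.+-identityʳ (expᵃ x)))
  ≈⇒congruent (inverseˡ x) = congruent-refl {x ⁻¹ ∙ x} {ε}
    (ℤ.+-inverseˡ (expᵇ x))
    (≡.trans (cong (λ α → - (alternating (expᵇ x) ℤ.* expᵃ x) ℤ.+ α ℤ.* expᵃ x)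
                   (alternating-neg (expᵇ x)))
             (ℤ.+-inverseˡ (alternating (expᵇ x) ℤ.* expᵃ x)))
  ≈⇒congruent (inverseʳ x) = congruent-refl {x ∙ x ⁻¹} {ε}
    (ℤ.+-inverseʳ (expᵇ x))
    (≡.trans (regroup (expᵃ x) (alternating (expᵇ x)))
      (≡.trans (cong (λ z → expᵃ x ℤ.- z ℤ.* expᵃ x) (alternating² (expᵇ x)))
        (cancel (expᵃ x))))
    where
    regroup : ∀ r α → r ℤ.+ α ℤ.* - (α ℤ.* r) ≡ r ℤ.- (α ℤ.* α) ℤ.* r
    regroup = solve-∀
    cancel : ∀ r → r ℤ.- 1ℤ ℤ.* r ≡ 0ℤ
    cancel = solve-∀

  open GroupProperties (T n) using (∙-cancelˡ; ⁻¹-anti-homo-∙)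
  open Group (T n) using (setoid; reflexive)
  open SetoidReasoning setoid

  A B : ℤ → Term Letter
  A = pow a
  B = pow b

  b∙a : b ∙ a ≈ a ⁻¹ ∙ b
  b∙a = begin
    b ∙ a                        ≈⟨ identityˡ (b ∙ a) ⟨
    ε ∙ (b ∙ a)                  ≈⟨ ∙-cong (inverseˡ a) refl ⟨
    (a ⁻¹ ∙ a) ∙ (b ∙ a)         ≈⟨ assoc (a ⁻¹) a (b ∙ a) ⟩
    a ⁻¹ ∙ (a ∙ (b ∙ a))         ≈⟨ ∙-cong refl a∙b∙a ⟩
    a ⁻¹ ∙ b                     ∎
    where
    a∙b : a ∙ b ≈ b ∙ a ⁻¹
    a∙b = begin
      a ∙ b                      ≈⟨ identityˡ (a ∙ b) ⟨
      ε ∙ (a ∙ b)                ≈⟨ ∙-cong (inverseʳ b) refl ⟨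
      (b ∙ b ⁻¹) ∙ (a ∙ b)       ≈⟨ assoc b (b ⁻¹) (a ∙ b) ⟩
      b ∙ (b ⁻¹ ∙ (a ∙ b))       ≈⟨ ∙-cong refl (assoc (b ⁻¹) a b) ⟨
      b ∙ ((b ⁻¹ ∙ a) ∙ b)       ≈⟨ ∙-cong refl (relation b⁻¹ab≈a⁻¹) ⟩
      b ∙ a ⁻¹                   ∎
    a∙b∙a : a ∙ (b ∙ a) ≈ b
    a∙b∙a = begin
      a ∙ (b ∙ a)                ≈⟨ assoc a b a ⟨
      (a ∙ b) ∙ a                ≈⟨ ∙-cong a∙b refl ⟩
      (b ∙ a ⁻¹) ∙ a             ≈⟨ assoc b (a ⁻¹) a ⟩
      b ∙ (a ⁻¹ ∙ a)             ≈⟨ ∙-cong refl (inverseˡ a) ⟩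
      b ∙ ε                      ≈⟨ identityʳ b ⟩
      b                          ∎

  b∙A : ∀ r → b ∙ A r ≈ A (- r) ∙ b
  b∙A = ℤ-induction (λ r → b ∙ A r ≈ A (- r) ∙ b)
    (trans (identityʳ b) (sym (identityˡ b)))
    (λ r hyp → begin
      b ∙ (A (1ℤ ℤ.+ r))         ≈⟨ left r ⟩
      a ⁻¹ ∙ (b ∙ A r)           ≈⟨ ∙-cong refl hyp ⟩
      a ⁻¹ ∙ (A (- r) ∙ b)       ≈⟨ right r ⟨
      A (- (1ℤ ℤ.+ r)) ∙ b       ∎)
    (λ r hyp → ∙-cancelˡ (a ⁻¹) (b ∙ A r) (A (- r) ∙ b) (begin
      a ⁻¹ ∙ (b ∙ A r)           ≈⟨ left r ⟨
      b ∙ (A (1ℤ ℤ.+ r))         ≈⟨ hyp ⟩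
      A (- (1ℤ ℤ.+ r)) ∙ b       ≈⟨ right r ⟩
      a ⁻¹ ∙ (A (- r) ∙ b)       ∎))
    where
    left : ∀ r → b ∙ A (1ℤ ℤ.+ r) ≈ a ⁻¹ ∙ (b ∙ A r)
    left r = begin
      b ∙ A (1ℤ ℤ.+ r)           ≈⟨ ∙-cong refl (pow-suc a r) ⟩
      b ∙ (a ∙ A r)              ≈⟨ assoc b a (A r) ⟨
      (b ∙ a) ∙ A r              ≈⟨ ∙-cong b∙a refl ⟩
      (a ⁻¹ ∙ b) ∙ A r           ≈⟨ assoc (a ⁻¹) b (A r) ⟩
      a ⁻¹ ∙ (b ∙ A r)           ∎
    right : ∀ r → A (- (1ℤ ℤ.+ r)) ∙ b ≈ a ⁻¹ ∙ (A (- r) ∙ b)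
    right r = begin
      A (- (1ℤ ℤ.+ r)) ∙ b       ≡⟨ cong (λ s → A s ∙ b) (ℤ.neg-distrib-+ 1ℤ r) ⟩
      A (-1ℤ ℤ.+ - r) ∙ b        ≈⟨ ∙-cong (pow-+ a -1ℤ (- r)) refl ⟩
      (A -1ℤ ∙ A (- r)) ∙ b      ≈⟨ ∙-cong (∙-cong (⁻¹-cong (identityʳ a)) refl) refl ⟩
      (a ⁻¹ ∙ A (- r)) ∙ b       ≈⟨ assoc (a ⁻¹) (A (- r)) b ⟩
      a ⁻¹ ∙ (A (- r) ∙ b)       ∎

  B∙A : ∀ s r → B s ∙ A r ≈ A (alternating s ℤ.* r) ∙ B s
  B∙A s r = ℤ-induction (λ s → B s ∙ A r ≈ A (alternating s ℤ.* r) ∙ B s)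
    (begin
      ε ∙ A r             ≈⟨ identityˡ (A r) ⟩
      A r                 ≡⟨ cong A (ℤ.*-identityˡ r) ⟨
      A (1ℤ ℤ.* r)        ≈⟨ identityʳ (A (1ℤ ℤ.* r)) ⟨
      A (1ℤ ℤ.* r) ∙ ε    ∎)
    (λ s hyp → begin
      B (1ℤ ℤ.+ s) ∙ A r                       ≈⟨ left s ⟩
      b ∙ (B s ∙ A r)                          ≈⟨ ∙-cong refl hyp ⟩
      b ∙ (A (alternating s ℤ.* r) ∙ B s)      ≈⟨ right s ⟨
      A (alternating (1ℤ ℤ.+ s) ℤ.* r) ∙ B (1ℤ ℤ.+ s) ∎)
    (λ s hyp → ∙-cancelˡ b (B s ∙ A r) (A (alternating s ℤ.* r) ∙ B s) (begin
      b ∙ (B s ∙ A r)                          ≈⟨ left s ⟨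
      B (1ℤ ℤ.+ s) ∙ A r                       ≈⟨ hyp ⟩
      A (alternating (1ℤ ℤ.+ s) ℤ.* r) ∙ B (1ℤ ℤ.+ s) ≈⟨ right s ⟩
      b ∙ (A (alternating s ℤ.* r) ∙ B s)      ∎))
    s
    where
    left : ∀ s → B (1ℤ ℤ.+ s) ∙ A r ≈ b ∙ (B s ∙ A r)
    left s = trans (∙-cong (pow-suc b s) refl) (assoc b (B s) (A r))
    negate : ∀ s → alternating (1ℤ ℤ.+ s) ℤ.* r ≡ - (alternating s ℤ.* r)
    negate s = ≡.trans (cong (ℤ._* r) (alternating-+ 1ℤ s)) (move (alternating s) r)
      where
      move : ∀ α r → (-1ℤ ℤ.* α) ℤ.* r ≡ - (α ℤ.* r)
      move = solve-∀
    right : ∀ s → A (alternating (1ℤ ℤ.+ s) ℤ.* r) ∙ B (1ℤ ℤ.+ s) ≈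
                  b ∙ (A (alternating s ℤ.* r) ∙ B s)
    right s = begin
      A (alternating (1ℤ ℤ.+ s) ℤ.* r) ∙ B (1ℤ ℤ.+ s)  ≈⟨ ∙-cong (reflexive (cong A (negate s))) (pow-suc b s) ⟩
      A (- (alternating s ℤ.* r)) ∙ (b ∙ B s)  ≈⟨ assoc (A (- (alternating s ℤ.* r))) b (B s) ⟨
      (A (- (alternating s ℤ.* r)) ∙ b) ∙ B s  ≈⟨ ∙-cong (b∙A (alternating s ℤ.* r)) refl ⟨
      (b ∙ A (alternating s ℤ.* r)) ∙ B s      ≈⟨ assoc b (A (alternating s ℤ.* r)) (B s) ⟩
      b ∙ (A (alternating s ℤ.* r) ∙ B s)      ∎

  -- Only the conjugation relation is used, so the exponents are those of ℤ ⋊ ℤ, not yet reduced by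
  -- the remaining relations.
  normal-form : ∀ x → x ≈ A (expᵃ x) ∙ B (expᵇ x)
  normal-form (gen 𝕒) = sym (trans (identityʳ (a ∙ ε)) (identityʳ a))
  normal-form (gen 𝕓) = sym (trans (identityˡ (b ∙ ε)) (identityʳ b))
  normal-form ε       = sym (identityˡ ε)
  normal-form (x ∙ y) = begin
    x ∙ y                             ≈⟨ ∙-cong (normal-form x) (normal-form y) ⟩
    (A r ∙ B s) ∙ (A q ∙ B t)         ≈⟨ assoc (A r) (B s) (A q ∙ B t) ⟩
    A r ∙ (B s ∙ (A q ∙ B t))         ≈⟨ ∙-cong refl (assoc (B s) (A q) (B t)) ⟨
    A r ∙ ((B s ∙ A q) ∙ B t)         ≈⟨ ∙-cong refl (∙-cong (B∙A s q) refl) ⟩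
    A r ∙ ((A q′ ∙ B s) ∙ B t)        ≈⟨ ∙-cong refl (assoc (A q′) (B s) (B t)) ⟩
    A r ∙ (A q′ ∙ (B s ∙ B t))        ≈⟨ assoc (A r) (A q′) (B s ∙ B t) ⟨
    (A r ∙ A q′) ∙ (B s ∙ B t)        ≈⟨ ∙-cong (pow-+ a r q′) (pow-+ b s t) ⟨
    A (r ℤ.+ q′) ∙ B (s ℤ.+ t)        ∎
    where
    r = expᵃ x
    s = expᵇ x
    q = expᵃ y
    t = expᵇ y
    q′ = alternating s ℤ.* q
  normal-form (x ⁻¹) = begin
    x ⁻¹                                       ≈⟨ ⁻¹-cong (normal-form x) ⟩
    (A r ∙ B s) ⁻¹                             ≈⟨ ⁻¹-anti-homo-∙ (A r) (B s) ⟩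
    B s ⁻¹ ∙ A r ⁻¹                            ≈⟨ ∙-cong (pow-neg b s) (pow-neg a r) ⟨
    B (- s) ∙ A (- r)                          ≈⟨ B∙A (- s) (- r) ⟩
    A (alternating (- s) ℤ.* - r) ∙ B (- s)    ≡⟨ cong (λ q → A q ∙ B (- s)) exponent ⟩
    A (- (alternating s ℤ.* r)) ∙ B (- s)      ∎
    where
    r = expᵃ x
    s = expᵇ x
    exponent : alternating (- s) ℤ.* - r ≡ - (alternating s ℤ.* r)
    exponent = ≡.trans (cong (ℤ._* - r) (alternating-neg s)) (≡.sym (ℤ.neg-distribʳ-* (alternating s) r))

  ^≡pow : ∀ x k → x ^ k ≡ pow x (+ k)
  ^≡pow x zero    = ≡.refl
  ^≡pow x (suc k) = cong (x ∙_) (^≡pow x k)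

  A[n*]≈B[4*] : ∀ z → A (+ n ℤ.* z) ≈ B (+ 4 ℤ.* z)
  A[n*]≈B[4*] z = begin
    A (+ n ℤ.* z)     ≈⟨ pow-* a (+ n) z ⟩
    pow (A (+ n)) z   ≈⟨ pow-cong {A (+ n)} {B (+ 4)}
                           (trans (reflexive (≡.sym (^≡pow a n))) (relation aⁿ≈b⁴)) z ⟩
    pow (B (+ 4)) z   ≈⟨ pow-* b (+ 4) z ⟨
    B (+ 4 ℤ.* z)     ∎

  B[8*]≈ε : ∀ z → B (+ 8 ℤ.* z) ≈ ε
  B[8*]≈ε z = begin
    B (+ 8 ℤ.* z)     ≈⟨ pow-* b (+ 8) z ⟩
    pow (b ^ 8) z     ≈⟨ pow-cong (relation b⁸≈e) z ⟩
    pow ε z           ≈⟨ pow-e z ⟩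
    ε                 ∎

  -- The surplus a^(n(2j - l)) b^(4l) becomes b^(8j) by aⁿ = b⁴, and this is trivial by b⁸ = e. The
  -- summands of the exponent of b are exchanged beforehand so that the two surplus powers meet.
  congruent⇒≈ : ∀ {x y} → Congruent x y → x ≈ y
  congruent⇒≈ {x} {y} (j , l , eqᵇ , eqᵃ) = begin
    x                                                ≈⟨ normal-form x ⟩
    A (expᵃ x) ∙ B (expᵇ x)                          ≡⟨ cong₂ (λ r s → A r ∙ B s) eqᵃ
                                                          (≡.trans eqᵇ (ℤ.+-comm s (+ 4 ℤ.* l))) ⟩
    A (r ℤ.+ + n ℤ.* z) ∙ B (+ 4 ℤ.* l ℤ.+ s)        ≈⟨ ∙-cong (pow-+ a r (+ n ℤ.* z)) (pow-+ b (+ 4 ℤ.* l) s) ⟩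
    (A r ∙ A (+ n ℤ.* z)) ∙ (B (+ 4 ℤ.* l) ∙ B s)    ≈⟨ assoc (A r) (A (+ n ℤ.* z)) (B (+ 4 ℤ.* l) ∙ B s) ⟩
    A r ∙ (A (+ n ℤ.* z) ∙ (B (+ 4 ℤ.* l) ∙ B s))    ≈⟨ ∙-cong refl (assoc (A (+ n ℤ.* z)) (B (+ 4 ℤ.* l)) (B s)) ⟨
    A r ∙ ((A (+ n ℤ.* z) ∙ B (+ 4 ℤ.* l)) ∙ B s)    ≈⟨ ∙-cong refl (∙-cong trivial refl) ⟩
    A r ∙ (ε ∙ B s)                                  ≈⟨ ∙-cong refl (identityˡ (B s)) ⟩
    A r ∙ B s                                        ≈⟨ normal-form y ⟨
    y                                                ∎
    where
    r = expᵃ y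
    s = expᵇ y
    z = + 2 ℤ.* j ℤ.- l
    collect : ∀ j l → + 4 ℤ.* (+ 2 ℤ.* j ℤ.- l) ℤ.+ + 4 ℤ.* l ≡ + 8 ℤ.* j
    collect = solve-∀
    trivial : A (+ n ℤ.* z) ∙ B (+ 4 ℤ.* l) ≈ ε
    trivial = begin
      A (+ n ℤ.* z) ∙ B (+ 4 ℤ.* l)   ≈⟨ ∙-cong (A[n*]≈B[4*] z) refl ⟩
      B (+ 4 ℤ.* z) ∙ B (+ 4 ℤ.* l)   ≈⟨ pow-+ b (+ 4 ℤ.* z) (+ 4 ℤ.* l) ⟨
      B (+ 4 ℤ.* z ℤ.+ + 4 ℤ.* l)     ≡⟨ cong B (collect j l) ⟩
      B (+ 8 ℤ.* j)                   ≈⟨ B[8*]≈ε j ⟩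
      ε                               ∎

-- The connection set

parity : ∀ h → ∃[ g ] (h ≡ + 2 ℤ.* g ⊎ h ≡ 1ℤ ℤ.+ + 2 ℤ.* g)
parity h with h ℤ.%ℕ 2 | ℤ.n%ℕd<d h 2 | ℤ.a≡a%ℕn+[a/ℕn]*n h 2
... | 0 | _ | eq = h ℤ./ℕ 2 ,
  inj₁ (≡.trans eq (≡.trans (ℤ.+-identityˡ _) (ℤ.*-comm (h ℤ./ℕ 2) (+ 2))))
... | 1 | _ | eq = h ℤ./ℕ 2 , inj₂ (≡.trans eq (cong (ℤ._+_ 1ℤ) (ℤ.*-comm (h ℤ./ℕ 2) (+ 2))))
... | suc (suc _) | ℕ.s≤s (ℕ.s≤s ()) | _

odd≢even : ∀ h g → 1ℤ ℤ.+ + 2 ℤ.* h ≢ + 2 ℤ.* g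
odd≢even h g eq = -1≢1 (begin
  -1ℤ                              ≡⟨ alternating-+-double 1ℤ h ⟨
  alternating (1ℤ ℤ.+ + 2 ℤ.* h)   ≡⟨ cong alternating eq ⟩
  alternating (+ 2 ℤ.* g)          ≡⟨ alternating-double g ⟩
  1ℤ                               ∎)
  where
  open ≡-Reasoning
  -1≢1 : -1ℤ ≢ 1ℤ
  -1≢1 ()

2+4*≢4* : ∀ l g → + 2 ℤ.+ + 4 ℤ.* l ≢ + 4 ℤ.* g
2+4*≢4* l g eq = odd≢even l g (ℤ.*-cancelˡ-≡ (+ 2) _ _ (begin
  + 2 ℤ.* (1ℤ ℤ.+ + 2 ℤ.* l)   ≡⟨ double l ⟩
  + 2 ℤ.+ + 4 ℤ.* l            ≡⟨ eq ⟩
  + 4 ℤ.* g                    ≡⟨ ℤ.*-assoc (+ 2) (+ 2) g ⟩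
  + 2 ℤ.* (+ 2 ℤ.* g)          ∎))
  where
  open ≡-Reasoning
  double : ∀ l → + 2 ℤ.* (1ℤ ℤ.+ + 2 ℤ.* l) ≡ + 2 ℤ.+ + 4 ℤ.* l
  double = solve-∀

residue-unique : ∀ {d} (u v : Fin d) z → + toℕ u ≡ + toℕ v ℤ.+ + d ℤ.* z → u ≡ v
residue-unique {d} u v (+ zero) eq = Fin.toℕ-injective (ℤ.+-injective
  (≡.trans eq (≡.trans (cong (ℤ._+_ (+ toℕ v)) (ℤ.*-zeroʳ (+ d))) (ℤ.+-identityʳ (+ toℕ v)))))
residue-unique {d} u v (+ suc k) eq = ⊥-elim (too-large u v k eq)
  where
  too-large : ∀ {d} (u v : Fin d) k → + toℕ u ≢ + toℕ v ℤ.+ + d ℤ.* + suc k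
  too-large {d} u v k eq = ℕ.<-irrefl (ℤ.+-injective
    (≡.trans eq (≡.sym (≡.trans (ℤ.pos-+ (toℕ v) (d ℕ.* suc k)) (cong (ℤ._+_ (+ toℕ v)) (ℤ.pos-* d (suc k)))))))
    (ℕ.<-≤-trans (Fin.toℕ<n u) (ℕ.≤-trans (ℕ.m≤m*n d (suc k)) (ℕ.m≤n+m (d ℕ.* suc k) (toℕ v))))
-- A negative multiple turns positive when `u` and `v` trade places.
residue-unique {d} u v -[1+ k ] eq = ≡.sym (residue-unique v u (+ suc k)
  (≡.trans (cancel (+ toℕ v) (+ d) (+ suc k)) (cong (ℤ._+ + d ℤ.* + suc k) (≡.sym eq))))
  where
  cancel : ∀ v d k → v ≡ (v ℤ.+ d ℤ.* - k) ℤ.+ d ℤ.* k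
  cancel = solve-∀

module ConnectionSet (n : ℕ) where
  open Presentation n
  open Group (T n) using (_≈_; reflexive)

  -- `S` in terms of exponents: `S₂` is the set of elements with odd exponent of b, and a^(nk) b^(2
  -- + 4l) is b² or aⁿb² according to the parity of k + l. In this form closure under inversion and
  -- conjugation is integer arithmetic.
  InS : Term Letter → Set
  InS x = (∃[ h ] expᵇ x ≡ 1ℤ ℤ.+ + 2 ℤ.* h)
        ⊎ (∃[ k ] ∃[ l ] (expᵃ x ≡ + n ℤ.* k × expᵇ x ≡ + 2 ℤ.+ + 4 ℤ.* l))

  S⇒InS : ∀ {x} → x ∈ S n → InS x
  S⇒InS (inj₁ (inj₁ x≈b²)) with j , l , eqᵇ , eqᵃ ← ≈⇒congruent x≈b² =
    inj₂ (+ 2 ℤ.* j ℤ.- l , l , ≡.trans eqᵃ (ℤ.+-identityˡ _) , eqᵇ)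
  S⇒InS {x} (inj₁ (inj₂ x≈aⁿb²)) with j , l , eqᵇ , eqᵃ ← ≈⇒congruent x≈aⁿb² =
    inj₂ (1ℤ ℤ.+ (+ 2 ℤ.* j ℤ.- l) , l , exponentᵃ , exponentᵇ)
    where
    open ≡-Reasoning
    exponentᵃ : expᵃ x ≡ + n ℤ.* (1ℤ ℤ.+ (+ 2 ℤ.* j ℤ.- l))
    exponentᵃ = begin
      expᵃ x
        ≡⟨ eqᵃ ⟩
      (expᵃ (a ^ n) ℤ.+ alternating (expᵇ (a ^ n)) ℤ.* 0ℤ) ℤ.+ + n ℤ.* (+ 2 ℤ.* j ℤ.- l)
        ≡⟨ cong₂ (λ r α → (r ℤ.+ α) ℤ.+ + n ℤ.* (+ 2 ℤ.* j ℤ.- l))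
             (expᵃ-a^ n) (ℤ.*-zeroʳ (alternating (expᵇ (a ^ n)))) ⟩
      (+ n ℤ.+ 0ℤ) ℤ.+ + n ℤ.* (+ 2 ℤ.* j ℤ.- l)
        ≡⟨ collect (+ n) (+ 2 ℤ.* j ℤ.- l) ⟩
      + n ℤ.* (1ℤ ℤ.+ (+ 2 ℤ.* j ℤ.- l)) ∎
      where
      collect : ∀ n z → (n ℤ.+ 0ℤ) ℤ.+ n ℤ.* z ≡ n ℤ.* (1ℤ ℤ.+ z)
      collect = solve-∀
    exponentᵇ : expᵇ x ≡ + 2 ℤ.+ + 4 ℤ.* l
    exponentᵇ = ≡.trans eqᵇ (cong (λ s → s ℤ.+ + 2 ℤ.+ + 4 ℤ.* l) (expᵇ-a^ n))
  S⇒InS {x} (inj₂ (y , y∈⟨a⟩ , x≈)) = inj₁ (odd x≈)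
    where
    even : y ∈ ⟨a⟩ n → ∃[ g ] expᵇ y ≡ + 4 ℤ.* g
    even (k , inj₁ y≈aᵏ) with _ , l , eqᵇ , _ ← ≈⇒congruent y≈aᵏ =
      l , ≡.trans eqᵇ (≡.trans (cong (ℤ._+ + 4 ℤ.* l) (expᵇ-a^ k)) (ℤ.+-identityˡ _))
    even (k , inj₂ y≈a⁻ᵏ) with _ , l , eqᵇ , _ ← ≈⇒congruent y≈a⁻ᵏ =
      l , ≡.trans eqᵇ (≡.trans (cong (λ s → - s ℤ.+ + 4 ℤ.* l) (expᵇ-a^ k)) (ℤ.+-identityˡ _))
    odd : x ≈ y ∙ b ⊎ x ≈ y ∙ b ^ 3 → ∃[ h ] expᵇ x ≡ 1ℤ ℤ.+ + 2 ℤ.* h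
    odd (inj₁ x≈yb) with _ , l , eqᵇ , _ ← ≈⇒congruent x≈yb | g , eq ← even y∈⟨a⟩ =
      + 2 ℤ.* (g ℤ.+ l) , ≡.trans eqᵇ (≡.trans (cong (λ s → s ℤ.+ 1ℤ ℤ.+ + 4 ℤ.* l) eq) (collect g l))
      where
      collect : ∀ g l → + 4 ℤ.* g ℤ.+ 1ℤ ℤ.+ + 4 ℤ.* l ≡ 1ℤ ℤ.+ + 2 ℤ.* (+ 2 ℤ.* (g ℤ.+ l))
      collect = solve-∀
    odd (inj₂ x≈yb³) with _ , l , eqᵇ , _ ← ≈⇒congruent x≈yb³ | g , eq ← even y∈⟨a⟩ =
      1ℤ ℤ.+ + 2 ℤ.* (g ℤ.+ l) , ≡.trans eqᵇ (≡.trans (cong (λ s → s ℤ.+ + 3 ℤ.+ + 4 ℤ.* l) eq) (collect g l))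
      where
      collect : ∀ g l → + 4 ℤ.* g ℤ.+ + 3 ℤ.+ + 4 ℤ.* l ≡ 1ℤ ℤ.+ + 2 ℤ.* (1ℤ ℤ.+ + 2 ℤ.* (g ℤ.+ l))
      collect = solve-∀

  exponents-A : ∀ r → expᵃ (A r) ≡ r × expᵇ (A r) ≡ 0ℤ
  exponents-A (+ k) rewrite ≡.sym (^≡pow a k) = expᵃ-a^ k , expᵇ-a^ k
  exponents-A -[1+ k ] = negative (A (+ suc k)) (exponents-A (+ suc k))
    where
    negative : ∀ x {r} → expᵃ x ≡ r × expᵇ x ≡ 0ℤ → expᵃ (x ⁻¹) ≡ - r × expᵇ (x ⁻¹) ≡ 0ℤ
    negative x {r} (eqᵃ , eqᵇ) rewrite eqᵇ | eqᵃ = cong -_ (ℤ.*-identityˡ r) , ≡.refl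

  A∈⟨a⟩ : ∀ r → A r ∈ ⟨a⟩ n
  A∈⟨a⟩ (+ k)    = k , inj₁ (reflexive (≡.sym (^≡pow a k)))
  A∈⟨a⟩ -[1+ k ] = suc k , inj₂ (reflexive (cong _⁻¹ (≡.sym (^≡pow a (suc k)))))

  -- Since aⁿ = b⁴, a surplus b^(4g) can be carried over to the power of a. Used for y = b and y =
  -- b³, the two residues mod 4 of an odd exponent.
  split-A : ∀ {x y} g → expᵃ y ≡ 0ℤ → expᵇ x ≡ expᵇ y ℤ.+ + 4 ℤ.* g → x ≈ A (expᵃ x ℤ.+ + n ℤ.* g) ∙ y
  split-A {x} {y} g eqᵃ eqᵇ with exponents-A (expᵃ x ℤ.+ + n ℤ.* g)
  ... | A≡r , A≡0 = congruent⇒≈ {x} {A (expᵃ x ℤ.+ + n ℤ.* g) ∙ y} (0ℤ , g , exponentᵇ , exponentᵃ)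
    where
    exponentᵇ : expᵇ x ≡ expᵇ (A (expᵃ x ℤ.+ + n ℤ.* g)) ℤ.+ expᵇ y ℤ.+ + 4 ℤ.* g
    exponentᵇ rewrite A≡0 | ℤ.+-identityˡ (expᵇ y) = eqᵇ
    exponentᵃ : expᵃ x ≡ expᵃ (A (expᵃ x ℤ.+ + n ℤ.* g)) ℤ.+
      alternating (expᵇ (A (expᵃ x ℤ.+ + n ℤ.* g))) ℤ.* expᵃ y ℤ.+ + n ℤ.* (+ 2 ℤ.* 0ℤ ℤ.- g)
    exponentᵃ rewrite A≡r | A≡0 | eqᵃ = collect (expᵃ x) (+ n) g
      where
      collect : ∀ r n g → r ≡ (r ℤ.+ n ℤ.* g) ℤ.+ 0ℤ ℤ.+ n ℤ.* (+ 2 ℤ.* 0ℤ ℤ.- g)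
      collect = solve-∀

  odd⇒S₂ : ∀ {x} h → expᵇ x ≡ 1ℤ ℤ.+ + 2 ℤ.* h → x ∈ S₂ n
  odd⇒S₂ {x} h eqᵇ with parity h
  ... | g , inj₁ ≡.refl = A r , A∈⟨a⟩ r , inj₁ (split-A {x} {b} g ≡.refl (≡.trans eqᵇ (expand g)))
    where
    r = expᵃ x ℤ.+ + n ℤ.* g
    expand : ∀ g → 1ℤ ℤ.+ + 2 ℤ.* (+ 2 ℤ.* g) ≡ 1ℤ ℤ.+ + 4 ℤ.* g
    expand = solve-∀
  ... | g , inj₂ ≡.refl = A r , A∈⟨a⟩ r , inj₂ (split-A {x} {b ^ 3} g ≡.refl (≡.trans eqᵇ (expand g)))
    where
    r = expᵃ x ℤ.+ + n ℤ.* g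
    expand : ∀ g → 1ℤ ℤ.+ + 2 ℤ.* (1ℤ ℤ.+ + 2 ℤ.* g) ≡ + 3 ℤ.+ + 4 ℤ.* g
    expand = solve-∀

  InS⇒S : ∀ {x} → InS x → x ∈ S n
  InS⇒S {x} (inj₁ (h , eqᵇ)) = inj₂ (odd⇒S₂ {x} h eqᵇ)
  InS⇒S {x} (inj₂ (k , l , eqᵃ , eqᵇ)) with parity (k ℤ.+ l)
  ... | j , inj₁ k+l≡2j = inj₁ (inj₁ (congruent⇒≈ {x} {b ^ 2} (j , l , eqᵇ ,
      ≡.trans eqᵃ (≡.trans (cong (+ n ℤ.*_) (difference k l k+l≡2j)) (≡.sym (ℤ.+-identityˡ _))))))
    where
    difference : ∀ k l {z} → k ℤ.+ l ≡ z → k ≡ z ℤ.- l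
    difference k l ≡.refl = cancel k l
      where
      cancel : ∀ k l → k ≡ k ℤ.+ l ℤ.- l
      cancel = solve-∀
  ... | j , inj₂ k+l≡1+2j = inj₁ (inj₂ (congruent⇒≈ {x} {a ^ n ∙ b ^ 2} (j , l , exponentᵇ , exponentᵃ)))
    where
    open ≡-Reasoning
    exponentᵇ : expᵇ x ≡ expᵇ (a ^ n) ℤ.+ + 2 ℤ.+ + 4 ℤ.* l
    exponentᵇ rewrite expᵇ-a^ n = eqᵇ
    shift : ∀ k l n j → k ℤ.+ l ≡ 1ℤ ℤ.+ + 2 ℤ.* j → n ℤ.* k ≡ (n ℤ.+ 0ℤ) ℤ.+ n ℤ.* (+ 2 ℤ.* j ℤ.- l)
    shift k l n j eq = begin
      n ℤ.* k                                    ≡⟨ add-l k l n ⟩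
      n ℤ.* (k ℤ.+ l ℤ.- l)                      ≡⟨ cong (λ z → n ℤ.* (z ℤ.- l)) eq ⟩
      n ℤ.* (1ℤ ℤ.+ + 2 ℤ.* j ℤ.- l)             ≡⟨ split l n j ⟩
      (n ℤ.+ 0ℤ) ℤ.+ n ℤ.* (+ 2 ℤ.* j ℤ.- l)     ∎
      where
      add-l : ∀ k l n → n ℤ.* k ≡ n ℤ.* (k ℤ.+ l ℤ.- l)
      add-l = solve-∀
      split : ∀ l n j → n ℤ.* (1ℤ ℤ.+ + 2 ℤ.* j ℤ.- l) ≡ (n ℤ.+ 0ℤ) ℤ.+ n ℤ.* (+ 2 ℤ.* j ℤ.- l)
      split = solve-∀
    exponentᵃ : expᵃ x ≡ expᵃ (a ^ n) ℤ.+ alternating (expᵇ (a ^ n)) ℤ.* 0ℤ ℤ.+ + n ℤ.* (+ 2 ℤ.* j ℤ.- l)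
    exponentᵃ rewrite expᵃ-a^ n | ℤ.*-zeroʳ (alternating (expᵇ (a ^ n))) =
      ≡.trans eqᵃ (shift k l (+ n) j k+l≡1+2j)

  S-respects : ∀ {x y} → x ≈ y → x ∈ S n → y ∈ S n
  S-respects x≈y (inj₁ (inj₁ x≈b²))  = inj₁ (inj₁ (trans (sym x≈y) x≈b²))
  S-respects x≈y (inj₁ (inj₂ x≈aⁿb²)) = inj₁ (inj₂ (trans (sym x≈y) x≈aⁿb²))
  S-respects x≈y (inj₂ (z , z∈⟨a⟩ , inj₁ x≈zb))  = inj₂ (z , z∈⟨a⟩ , inj₁ (trans (sym x≈y) x≈zb))
  S-respects x≈y (inj₂ (z , z∈⟨a⟩ , inj₂ x≈zb³)) = inj₂ (z , z∈⟨a⟩ , inj₂ (trans (sym x≈y) x≈zb³))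

  InS-inverse : ∀ x → InS x → InS (x ⁻¹)
  InS-inverse x (inj₁ (h , eqᵇ)) = inj₁ (-1ℤ ℤ.- h , ≡.trans (cong -_ eqᵇ) (negate h))
    where
    negate : ∀ h → - (1ℤ ℤ.+ + 2 ℤ.* h) ≡ 1ℤ ℤ.+ + 2 ℤ.* (-1ℤ ℤ.- h)
    negate = solve-∀
  InS-inverse x (inj₂ (k , l , eqᵃ , eqᵇ)) =
    inj₂ (- (α ℤ.* k) , -1ℤ ℤ.- l ,
      ≡.trans (cong (λ r → - (α ℤ.* r)) eqᵃ) (negateᵃ α (+ n) k) , ≡.trans (cong -_ eqᵇ) (negateᵇ l))
    where
    α = alternating (expᵇ x)
    negateᵃ : ∀ α n k → - (α ℤ.* (n ℤ.* k)) ≡ n ℤ.* - (α ℤ.* k)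
    negateᵃ = solve-∀
    negateᵇ : ∀ l → - (+ 2 ℤ.+ + 4 ℤ.* l) ≡ + 2 ℤ.+ + 4 ℤ.* (-1ℤ ℤ.- l)
    negateᵇ = solve-∀

  InS-conjugate : ∀ g x → InS x → InS ((g ⁻¹ ∙ x) ∙ g)
  InS-conjugate g x (inj₁ (h , eqᵇ)) = inj₁ (h , ≡.trans (cancel (expᵇ g) (expᵇ x)) eqᵇ)
    where
    cancel : ∀ t s → - t ℤ.+ s ℤ.+ t ≡ s
    cancel = solve-∀
  InS-conjugate g x (inj₂ (k , l , eqᵃ , eqᵇ)) =
    inj₂ (α ℤ.* k , l , exponentᵃ , ≡.trans (cancel t (expᵇ x)) eqᵇ)
    where
    open ≡-Reasoning
    t = expᵇ g
    α = alternating t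
    cancel : ∀ t s → - t ℤ.+ s ℤ.+ t ≡ s
    cancel = solve-∀
    double : ∀ l → + 2 ℤ.+ + 4 ℤ.* l ≡ + 2 ℤ.* (1ℤ ℤ.+ + 2 ℤ.* l)
    double = solve-∀
    -- The exponent of b in `x` is even, so both occurrences of `expᵃ g` carry the sign of `g`, once
    -- negated, and cancel.
    outer-sign : alternating (- t ℤ.+ expᵇ x) ≡ α
    outer-sign = begin
      alternating (- t ℤ.+ expᵇ x)                         ≡⟨ cong (λ s → alternating (- t ℤ.+ s)) (≡.trans eqᵇ (double l)) ⟩
      alternating (- t ℤ.+ + 2 ℤ.* (1ℤ ℤ.+ + 2 ℤ.* l))     ≡⟨ alternating-+-double (- t) (1ℤ ℤ.+ + 2 ℤ.* l) ⟩
      alternating (- t)                                    ≡⟨ alternating-neg t ⟩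
      α                                                    ∎
    exponentᵃ : - (α ℤ.* expᵃ g) ℤ.+ alternating (- t) ℤ.* expᵃ x ℤ.+
                alternating (- t ℤ.+ expᵇ x) ℤ.* expᵃ g ≡ + n ℤ.* (α ℤ.* k)
    exponentᵃ rewrite outer-sign | alternating-neg t | eqᵃ = simplify α (expᵃ g) (+ n) k
      where
      simplify : ∀ α q n k → - (α ℤ.* q) ℤ.+ α ℤ.* (n ℤ.* k) ℤ.+ α ℤ.* q ≡ n ℤ.* (α ℤ.* k)
      simplify = solve-∀

  isConnectionSet : IsConnectionSet (T n) (S n)
  isConnectionSet = record
    { respects = S-respects
    ; nonempty = b ^ 2 , inj₁ (inj₁ refl)
    ; e∉       = λ ε∈S → ε∉ (S⇒InS ε∈S)
    ; inverse  = λ {x} x∈S → InS⇒S {x ⁻¹} (InS-inverse x (S⇒InS x∈S))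
    }
    where
    ε∉ : ¬ InS ε
    ε∉ (inj₁ (h , eq))         = odd≢even h 0ℤ (≡.sym eq)
    ε∉ (inj₂ (k , l , _ , eq)) = 2+4*≢4* l 0ℤ (≡.sym eq)

  isNormalCayley : IsNormalCayley (T n) (S n) isConnectionSet
  isNormalCayley {x} (g , y≈x^g) x∈S =
    S-respects (sym y≈x^g) (InS⇒S {(g ⁻¹ ∙ x) ∙ g} (InS-conjugate g x (S⇒InS x∈S)))

  Γ : Graph
  Γ = Cay (T n) (S n) isConnectionSet

  odd⇒adjacent : ∀ x y h → expᵇ x ℤ.- expᵇ y ≡ 1ℤ ℤ.+ + 2 ℤ.* h → x ∙ y ⁻¹ ∈ S n
  odd⇒adjacent x y h eq = InS⇒S {x ∙ y ⁻¹} (inj₁ (h , eq))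

  -- Any two elements whose exponents of b differ in parity are adjacent. For equal parity a detour
  -- through `b ∙ y` works, so two steps always suffice.
  connected : Connected Γ
  connected x y with parity (expᵇ x ℤ.- expᵇ y)
  ... | h , inj₂ odd  = inj₂ (odd⇒adjacent x y h odd) ◅ nil
  ... | g , inj₁ even =
    inj₂ (odd⇒adjacent x (b ∙ y) (-1ℤ ℤ.+ g) (≡.trans (shift (expᵇ x) (expᵇ y))
           (≡.trans (cong (ℤ._+_ -1ℤ) even) (regroup g))))
    ◅ inj₂ (odd⇒adjacent (b ∙ y) y 0ℤ (cancel (expᵇ y)))
    ◅ nil
    where
    shift : ∀ s t → s ℤ.- (1ℤ ℤ.+ t) ≡ -1ℤ ℤ.+ (s ℤ.- t)
    shift = solve-∀
    regroup : ∀ g → -1ℤ ℤ.+ + 2 ℤ.* g ≡ 1ℤ ℤ.+ + 2 ℤ.* (-1ℤ ℤ.+ g)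
    regroup = solve-∀
    cancel : ∀ t → 1ℤ ℤ.+ t ℤ.- t ≡ 1ℤ ℤ.+ + 2 ℤ.* 0ℤ
    cancel = solve-∀

-- The adjacency matrix

module Vertices (m : ℕ) where
  private
    n = suc m
  open Presentation n
  open ConnectionSet n
  open Group (T n) using (_≈_; setoid)

  -- Together with `fold` this views `Fin (N + N)` as two copies of `Fin N`, in the layout that
  -- `det-double` merges. The coordinates of group elements are thereby tied to the determinant
  -- computation.
  highBit : ∀ N → Fin (N ℕ.+ N) → Fin 2
  highBit N i = [ (λ _ → zero) , (λ _ → suc zero) ]′ (splitAt N i)

  unfold : ∀ {N} → Fin 2 → Fin N → Fin (N ℕ.+ N)
  unfold {N} zero       i = i ↑ˡ N
  unfold {N} (suc zero) i = N ↑ʳ i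

  fold-unfold : ∀ {N} β (i : Fin N) → fold N (unfold β i) ≡ i
  fold-unfold zero       i = fold-↑ˡ i
  fold-unfold (suc zero) i = fold-↑ʳ i

  highBit-unfold : ∀ {N} β (i : Fin N) → highBit N (unfold β i) ≡ β
  highBit-unfold {N} zero       i rewrite Fin.splitAt-↑ˡ N i N = ≡.refl
  highBit-unfold {N} (suc zero) i rewrite Fin.splitAt-↑ʳ N N i = ≡.refl

  unfold-fold : ∀ N (i : Fin (N ℕ.+ N)) → unfold (highBit N i) (fold N i) ≡ i
  unfold-fold N i with splitAt N i in eq
  ... | inj₁ j = Fin.splitAt⁻¹-↑ˡ eq
  ... | inj₂ j = Fin.splitAt⁻¹-↑ʳ eq

  fold-injective : ∀ N {i j : Fin (N ℕ.+ N)} → highBit N i ≡ highBit N j → fold N i ≡ fold N j → i ≡ j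
  fold-injective N {i} {j} eq eq′ =
    ≡.trans (≡.sym (unfold-fold N i)) (≡.trans (cong₂ unfold eq eq′) (unfold-fold N j))

  -- A vertex a^c b^(4α + 2β + p) with c < n has index (α, β, c, p).
  coordα coordβ coordp : Fin (size n) → Fin 2
  coordα i = highBit (half n) i
  coordβ i = highBit (n ℕ.* 2) (fold (half n) i)
  coordp i = bit n (fold (n ℕ.* 2) (fold (half n) i))

  coordc : Fin (size n) → Fin n
  coordc i = quotient 2 (fold (n ℕ.* 2) (fold (half n) i))

  coordt : Fin (size n) → Fin 8
  coordt i = combine (coordα i) (combine {2} {2} (coordβ i) (coordp i))

  module _ (α β p : Fin 2) (c : Fin n) where
    private
      i = unfold {half n} α (unfold β (combine c p))
      q = fold (n ℕ.* 2) (fold (half n) i)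

      q≡ : q ≡ combine c p
      q≡ = ≡.trans (cong (fold (n ℕ.* 2)) (fold-unfold α (unfold β (combine c p))))
                   (fold-unfold β (combine c p))

    coordc-unfold : coordc i ≡ c
    coordc-unfold = ≡.trans (cong (quotient 2) q≡) (cong proj₁ (Fin.remQuot-combine c p))

    coordt-unfold : coordt i ≡ combine α (combine {2} {2} β p)
    coordt-unfold = cong₂ combine
      (highBit-unfold α (unfold β (combine c p)))
      (cong₂ (combine {2} {2})
        (≡.trans (cong (highBit (n ℕ.* 2)) (fold-unfold α (unfold β (combine c p))))
                 (highBit-unfold β (combine c p)))
        (≡.trans (cong (bit n) q≡) (cong proj₂ (Fin.remQuot-combine c p))))

  digits : Fin 8 → Fin 2 × Fin 2 × Fin 2
  digits t = quotient 4 t , remQuot 2 (remainder {2} 4 t)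

  index : Fin n → Fin 8 → Fin (size n)
  index c t = let α , β , p = digits t in unfold α (unfold β (combine c p))

  coordc-index : ∀ c t → coordc (index c t) ≡ c
  coordc-index c t = let α , β , p = digits t in coordc-unfold α β p c

  coordt-index : ∀ c t → coordt (index c t) ≡ t
  coordt-index c t = let α , β , p = digits t in begin
    coordt (index c t)            ≡⟨ coordt-unfold α β p c ⟩
    combine α (combine β p)       ≡⟨ cong (combine α) (Fin.combine-remQuot {2} 2 (remainder {2} 4 t)) ⟩
    combine α (remainder {2} 4 t) ≡⟨ Fin.combine-remQuot {2} 4 t ⟩
    t                             ∎
    where open ≡-Reasoning

  coord-injective : ∀ i j → coordc i ≡ coordc j → coordt i ≡ coordt j → i ≡ j
  coord-injective i j eqc eqt
    with eqα , eqβp ← Fin.combine-injective (coordα i) (combine {2} {2} (coordβ i) (coordp i)) (coordα j) _ eqt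
    with eqβ , eqp ← Fin.combine-injective (coordβ i) (coordp i) (coordβ j) (coordp j) eqβp =
    fold-injective (half n) eqα (fold-injective (n ℕ.* 2) eqβ (begin
      fold (n ℕ.* 2) (fold (half n) i)                       ≡⟨ Fin.combine-remQuot {n} 2 _ ⟨
      combine (coordc i) (coordp i)                          ≡⟨ cong₂ combine eqc eqp ⟩
      combine (coordc j) (coordp j)                          ≡⟨ Fin.combine-remQuot {n} 2 _ ⟩
      fold (n ℕ.* 2) (fold (half n) j)                       ∎))
    where open ≡-Reasoning

  word : Fin n → Fin 8 → Term Letter
  word c t = a ^ toℕ c ∙ b ^ toℕ t

  expᵃ-word : ∀ c t → expᵃ (word c t) ≡ + toℕ c
  expᵃ-word c t rewrite expᵃ-a^ (toℕ c) | expᵃ-b^ (toℕ t) | ℤ.*-zeroʳ (alternating (expᵇ (a ^ toℕ c))) =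
    ℤ.+-identityʳ (+ toℕ c)

  expᵇ-word : ∀ c t → expᵇ (word c t) ≡ + toℕ t
  expᵇ-word c t rewrite expᵇ-a^ (toℕ c) | expᵇ-b^ (toℕ t) = ≡.refl

  -- Modulo n the exponents of a determine c. Once they agree, n (2j - l) = 0 forces l = 2j, so the
  -- exponents of b differ by 8j and the residue modulo 8 determines t.
  word-injective : ∀ {c c′ t t′} → word c t ≈ word c′ t′ → c ≡ c′ × t ≡ t′
  word-injective {c} {c′} {t} {t′} eq
    with j , l , eqᵇ , eqᵃ ← ≈⇒congruent eq
    rewrite expᵃ-word c t | expᵃ-word c′ t′ | expᵇ-word c t | expᵇ-word c′ t′
    with ≡.refl ← residue-unique c c′ (+ 2 ℤ.* j ℤ.- l) eqᵃ =
    ≡.refl , residue-unique t t′ j (≡.trans eqᵇ (cong (ℤ._+_ (+ toℕ t′))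
      (≡.trans (cong (ℤ._*_ (+ 4)) l≡2j) (≡.sym (ℤ.*-assoc (+ 4) (+ 2) j)))))
    where
    cancel-c : ∀ c z → c ≡ c ℤ.+ z → z ≡ 0ℤ
    cancel-c c z eq = ≡.trans (add-sub c z) (≡.trans (cong (ℤ._- c) (≡.sym eq)) (ℤ.+-inverseʳ c))
      where
      add-sub : ∀ c z → z ≡ c ℤ.+ z ℤ.- c
      add-sub = solve-∀
    l≡2j : l ≡ + 2 ℤ.* j
    l≡2j with ℤ.i*j≡0⇒i≡0∨j≡0 (+ n) (cancel-c (+ toℕ c) (+ n ℤ.* (+ 2 ℤ.* j ℤ.- l)) eqᵃ)
    ... | inj₂ eq = ≡.sym (ℤ.i-j≡0⇒i≡j (+ 2 ℤ.* j) l eq)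

  divMod : ∀ d .{{_ : NonZero d}} z → ∃[ u ] ∃[ q ] z ≡ + toℕ {d} u ℤ.+ + d ℤ.* q
  divMod d z = fromℕ< (ℤ.n%ℕd<d z d) , z ℤ./ℕ d , (begin
    z                                                       ≡⟨ ℤ.a≡a%ℕn+[a/ℕn]*n z d ⟩
    + (z ℤ.%ℕ d) ℤ.+ (z ℤ./ℕ d) ℤ.* + d                     ≡⟨ cong₂ (λ u v → + u ℤ.+ v)
                                                                 (≡.sym (Fin.toℕ-fromℕ< (ℤ.n%ℕd<d z d)))
                                                                 (ℤ.*-comm (z ℤ./ℕ d) (+ d)) ⟩
    + toℕ (fromℕ< (ℤ.n%ℕd<d z d)) ℤ.+ + d ℤ.* (z ℤ./ℕ d)    ∎)
    where open ≡-Reasoning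

  -- Division by n splits off a^(nk) = b^(4k), which is added to the exponent of b before that is
  -- divided by 8. From t + 8q - 4k = t + 4(2q - k) one reads off the witnesses j = q and l = 2q -
  -- k.
  word-surjective : ∀ x → ∃[ c ] ∃[ t ] word c t ≈ x
  word-surjective x with divMod n (expᵃ x)
  ... | c , k , eqᵃ with divMod 8 (expᵇ x ℤ.+ + 4 ℤ.* k)
  ... | t , q , eqᵇ = c , t , sym (congruent⇒≈ {x} {word c t} (q , + 2 ℤ.* q ℤ.- k , exponentᵇ , exponentᵃ))
    where
    open ≡-Reasoning
    exponentᵇ : expᵇ x ≡ expᵇ (word c t) ℤ.+ + 4 ℤ.* (+ 2 ℤ.* q ℤ.- k)
    exponentᵇ = begin
      expᵇ x                                            ≡⟨ add-sub (expᵇ x) (+ 4 ℤ.* k) ⟩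
      expᵇ x ℤ.+ + 4 ℤ.* k ℤ.- + 4 ℤ.* k                ≡⟨ cong (ℤ._- + 4 ℤ.* k) eqᵇ ⟩
      + toℕ t ℤ.+ + 8 ℤ.* q ℤ.- + 4 ℤ.* k               ≡⟨ regroup (+ toℕ t) q k ⟩
      + toℕ t ℤ.+ + 4 ℤ.* (+ 2 ℤ.* q ℤ.- k)             ≡⟨ cong (ℤ._+ + 4 ℤ.* (+ 2 ℤ.* q ℤ.- k)) (expᵇ-word c t) ⟨
      expᵇ (word c t) ℤ.+ + 4 ℤ.* (+ 2 ℤ.* q ℤ.- k)     ∎
      where
      add-sub : ∀ s k → s ≡ s ℤ.+ k ℤ.- k
      add-sub = solve-∀
      regroup : ∀ t q k → t ℤ.+ + 8 ℤ.* q ℤ.- + 4 ℤ.* k ≡ t ℤ.+ + 4 ℤ.* (+ 2 ℤ.* q ℤ.- k)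
      regroup = solve-∀
    exponentᵃ : expᵃ x ≡ expᵃ (word c t) ℤ.+ + n ℤ.* (+ 2 ℤ.* q ℤ.- (+ 2 ℤ.* q ℤ.- k))
    exponentᵃ = begin
      expᵃ x                      ≡⟨ eqᵃ ⟩
      + toℕ c ℤ.+ + n ℤ.* k       ≡⟨ cong₂ (λ r z → r ℤ.+ + n ℤ.* z) (≡.sym (expᵃ-word c t)) (double-sub q k) ⟩
      expᵃ (word c t) ℤ.+ + n ℤ.* (+ 2 ℤ.* q ℤ.- (+ 2 ℤ.* q ℤ.- k)) ∎
      where
      double-sub : ∀ q k → k ≡ + 2 ℤ.* q ℤ.- (+ 2 ℤ.* q ℤ.- k)
      double-sub = solve-∀

  vertex : Fin (size n) → Term Letter
  vertex i = word (coordc i) (coordt i)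

  vertex-injective : ∀ i j → vertex i ≈ vertex j → i ≡ j
  vertex-injective i j eq = uncurry (coord-injective i j) (word-injective eq)

  number : Term Letter → Fin (size n)
  number x = index (proj₁ (word-surjective x)) (proj₁ (proj₂ (word-surjective x)))

  vertex-number : ∀ x → vertex (number x) ≈ x
  vertex-number x = let c , t , eq = word-surjective x in
    ≡.subst (_≈ x) (≡.sym (cong₂ word (coordc-index c t) (coordt-index c t))) eq

  numbering : Inverse (≡.setoid (Fin (size n))) setoid
  numbering = record
    { to        = vertex
    ; from      = number
    ; to-cong   = λ { ≡.refl → refl }
    ; from-cong = λ {x} {y} x≈y → vertex-injective (number x) (number y)
                    (trans (vertex-number x) (trans x≈y (sym (vertex-number y))))
    ; inverse   = (λ { {x} ≡.refl → vertex-number x })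
                , (λ {i} {x} x≈i → vertex-injective (number x) i (trans (vertex-number x) x≈i))
    }

  difference : Fin 2 → Fin 2 → ℤ
  difference β β′ = + toℕ β ℤ.- + toℕ β′

  difference-odd : ∀ {β β′} → β ≢ β′ → ∃[ h ] difference β β′ ≡ 1ℤ ℤ.+ + 2 ℤ.* h
  difference-odd {zero}     {zero}     0≢0 = ⊥-elim (0≢0 ≡.refl)
  difference-odd {zero}     {suc zero} _   = -1ℤ , ≡.refl
  difference-odd {suc zero} {zero}     _   = 0ℤ , ≡.refl
  difference-odd {suc zero} {suc zero} 1≢1 = ⊥-elim (1≢1 ≡.refl)

  expᵇ-vertex : ∀ i → expᵇ (vertex i) ≡ + toℕ (coordp i) ℤ.+ + 2 ℤ.* + toℕ (coordβ i) ℤ.+ + 4 ℤ.* + toℕ (coordα i)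
  expᵇ-vertex i = ≡.trans (expᵇ-word (coordc i) (coordt i)) (expand (coordα i) (coordβ i) (coordp i))
    where
    expand : ∀ α β p → + toℕ (combine α (combine {2} {2} β p)) ≡ + toℕ p ℤ.+ + 2 ℤ.* + toℕ β ℤ.+ + 4 ℤ.* + toℕ α
    expand zero       zero       zero       = ≡.refl
    expand zero       zero       (suc zero) = ≡.refl
    expand zero       (suc zero) zero       = ≡.refl
    expand zero       (suc zero) (suc zero) = ≡.refl
    expand (suc zero) zero       zero       = ≡.refl
    expand (suc zero) zero       (suc zero) = ≡.refl
    expand (suc zero) (suc zero) zero       = ≡.refl
    expand (suc zero) (suc zero) (suc zero) = ≡.refl

  module _ (i j : Fin (size n)) where
    private
      Δα = difference (coordα i) (coordα j)
      Δβ = difference (coordβ i) (coordβ j)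
      Δp = difference (coordp i) (coordp j)

    expᵇ-quotient : expᵇ (vertex i) ℤ.- expᵇ (vertex j) ≡ Δp ℤ.+ + 2 ℤ.* (Δβ ℤ.+ + 2 ℤ.* Δα)
    expᵇ-quotient rewrite expᵇ-vertex i | expᵇ-vertex j =
      regroup (+ toℕ (coordp i)) (+ toℕ (coordβ i)) (+ toℕ (coordα i))
              (+ toℕ (coordp j)) (+ toℕ (coordβ j)) (+ toℕ (coordα j))
      where
      regroup : ∀ p β α p′ β′ α′ → p ℤ.+ + 2 ℤ.* β ℤ.+ + 4 ℤ.* α ℤ.- (p′ ℤ.+ + 2 ℤ.* β′ ℤ.+ + 4 ℤ.* α′) ≡
        (p ℤ.- p′) ℤ.+ + 2 ℤ.* ((β ℤ.- β′) ℤ.+ + 2 ℤ.* (α ℤ.- α′))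
      regroup = solve-∀

    Δp≡0 : coordp i ≡ coordp j → Δp ≡ 0ℤ
    Δp≡0 eq rewrite eq = ℤ.+-inverseʳ (+ toℕ (coordp j))

    -- Equal p means equal parity of the exponents of b. The sign from the product and the sign from
    -- the inverse then coincide, and their product is 1.
    expᵃ-quotient : coordp i ≡ coordp j →
      expᵃ (vertex i ∙ vertex j ⁻¹) ≡ + toℕ (coordc i) ℤ.- + toℕ (coordc j)
    expᵃ-quotient eq = begin
      expᵃ (vertex i) ℤ.+ αᵢ ℤ.* - (αⱼ ℤ.* expᵃ (vertex j))
        ≡⟨ cong₂ (λ r q → r ℤ.+ αᵢ ℤ.* - (αⱼ ℤ.* q))
             (expᵃ-word (coordc i) (coordt i)) (expᵃ-word (coordc j) (coordt j)) ⟩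
      c ℤ.+ αᵢ ℤ.* - (αⱼ ℤ.* c′)
        ≡⟨ cong (λ α → c ℤ.+ α ℤ.* - (αⱼ ℤ.* c′)) αᵢ≡αⱼ ⟩
      c ℤ.+ αⱼ ℤ.* - (αⱼ ℤ.* c′)
        ≡⟨ regroup c c′ αⱼ ⟩
      c ℤ.- (αⱼ ℤ.* αⱼ) ℤ.* c′
        ≡⟨ cong (λ z → c ℤ.- z ℤ.* c′) (alternating² (expᵇ (vertex j))) ⟩
      c ℤ.- 1ℤ ℤ.* c′
        ≡⟨ cong (ℤ._-_ c) (ℤ.*-identityˡ c′) ⟩
      c ℤ.- c′ ∎
      where
      open ≡-Reasoning
      c = + toℕ (coordc i)
      c′ = + toℕ (coordc j)
      αᵢ = alternating (expᵇ (vertex i))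
      αⱼ = alternating (expᵇ (vertex j))
      regroup : ∀ c c′ α → c ℤ.+ α ℤ.* - (α ℤ.* c′) ≡ c ℤ.- (α ℤ.* α) ℤ.* c′
      regroup = solve-∀
      add-sub : ∀ s t → s ≡ t ℤ.+ (s ℤ.- t)
      add-sub = solve-∀
      αᵢ≡αⱼ : αᵢ ≡ αⱼ
      αᵢ≡αⱼ = begin
        αᵢ
          ≡⟨ cong alternating (add-sub (expᵇ (vertex i)) (expᵇ (vertex j))) ⟩
        alternating (expᵇ (vertex j) ℤ.+ (expᵇ (vertex i) ℤ.- expᵇ (vertex j)))
          ≡⟨ cong (λ s → alternating (expᵇ (vertex j) ℤ.+ s))
               (≡.trans expᵇ-quotient (≡.trans (cong (ℤ._+ + 2 ℤ.* (Δβ ℤ.+ + 2 ℤ.* Δα)) (Δp≡0 eq)) (ℤ.+-identityˡ _))) ⟩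
        alternating (expᵇ (vertex j) ℤ.+ + 2 ℤ.* (Δβ ℤ.+ + 2 ℤ.* Δα))
          ≡⟨ alternating-+-double (expᵇ (vertex j)) (Δβ ℤ.+ + 2 ℤ.* Δα) ⟩
        αⱼ ∎

    Adjacent : Set
    Adjacent = vertex i ∙ vertex j ⁻¹ ∈ S n

    p≢⇒adjacent : coordp i ≢ coordp j → Adjacent
    p≢⇒adjacent p≢p′ with h , odd ← difference-odd p≢p′ =
      odd⇒adjacent (vertex i) (vertex j) (h ℤ.+ (Δβ ℤ.+ + 2 ℤ.* Δα))
        (≡.trans expᵇ-quotient (≡.trans (cong (ℤ._+ + 2 ℤ.* (Δβ ℤ.+ + 2 ℤ.* Δα)) odd)
          (regroup h (Δβ ℤ.+ + 2 ℤ.* Δα))))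
      where
      regroup : ∀ h z → 1ℤ ℤ.+ + 2 ℤ.* h ℤ.+ + 2 ℤ.* z ≡ 1ℤ ℤ.+ + 2 ℤ.* (h ℤ.+ z)
      regroup = solve-∀

    β≢⇒adjacent : coordp i ≡ coordp j → coordc i ≡ coordc j → coordβ i ≢ coordβ j → Adjacent
    β≢⇒adjacent eqp eqc β≢β′ with h , odd ← difference-odd β≢β′ =
      InS⇒S {vertex i ∙ vertex j ⁻¹} (inj₂ (0ℤ , h ℤ.+ Δα , exponentᵃ , exponentᵇ))
      where
      exponentᵃ : expᵃ (vertex i ∙ vertex j ⁻¹) ≡ + n ℤ.* 0ℤ
      exponentᵃ = ≡.trans (expᵃ-quotient eqp)
        (≡.trans (cong (λ c → + toℕ c ℤ.- + toℕ (coordc j)) eqc)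
          (≡.trans (ℤ.+-inverseʳ (+ toℕ (coordc j))) (≡.sym (ℤ.*-zeroʳ (+ n)))))
      exponentᵇ : expᵇ (vertex i) ℤ.- expᵇ (vertex j) ≡ + 2 ℤ.+ + 4 ℤ.* (h ℤ.+ Δα)
      exponentᵇ = ≡.trans expᵇ-quotient
        (≡.trans (cong₂ (λ x y → x ℤ.+ + 2 ℤ.* (y ℤ.+ + 2 ℤ.* Δα)) (Δp≡0 eqp) odd) (regroup h Δα))
        where
        regroup : ∀ h z → 0ℤ ℤ.+ + 2 ℤ.* (1ℤ ℤ.+ + 2 ℤ.* h ℤ.+ + 2 ℤ.* z) ≡ + 2 ℤ.+ + 4 ℤ.* (h ℤ.+ z)
        regroup = solve-∀

    -- With equal p the exponents of b differ by 2(Δβ + 2Δα). This is even, which excludes `S₂`;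
    -- membership in `S₁` makes it 2 modulo 4, so Δβ is nonzero, and makes the difference of the c a
    -- multiple of n, hence zero.
    adjacent⇒ : coordp i ≡ coordp j → Adjacent → coordc i ≡ coordc j × coordβ i ≢ coordβ j
    adjacent⇒ eqp adj with S⇒InS adj
    ... | inj₁ (h , eq) = ⊥-elim (odd≢even h (Δβ ℤ.+ + 2 ℤ.* Δα)
            (≡.trans (≡.sym eq) (≡.trans expᵇ-quotient
              (≡.trans (cong (ℤ._+ + 2 ℤ.* (Δβ ℤ.+ + 2 ℤ.* Δα)) (Δp≡0 eqp)) (ℤ.+-identityˡ _)))))
    ... | inj₂ (k , l , eqᵃ , eqᵇ) =
        residue-unique (coordc i) (coordc j) k
          (≡.trans (add-sub (+ toℕ (coordc i)) (+ toℕ (coordc j)))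
            (cong (ℤ._+_ (+ toℕ (coordc j))) (≡.trans (≡.sym (expᵃ-quotient eqp)) eqᵃ)))
      , λ eqβ → 2+4*≢4* l Δα (≡.trans (≡.sym eqᵇ) (≡.trans expᵇ-quotient
          (≡.trans (cong₂ (λ x y → x ℤ.+ + 2 ℤ.* (y ℤ.+ + 2 ℤ.* Δα)) (Δp≡0 eqp) (Δβ≡0 eqβ)) (regroup Δα))))
      where
      add-sub : ∀ s t → s ≡ t ℤ.+ (s ℤ.- t)
      add-sub = solve-∀
      Δβ≡0 : coordβ i ≡ coordβ j → Δβ ≡ 0ℤ
      Δβ≡0 eq rewrite eq = ℤ.+-inverseʳ (+ toℕ (coordβ j))
      regroup : ∀ z → 0ℤ ℤ.+ + 2 ℤ.* (0ℤ ℤ.+ + 2 ℤ.* z) ≡ + 4 ℤ.* z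
      regroup = solve-∀

    private
      rᵢ = fold (half n) i
      rⱼ = fold (half n) j
      qᵢ = fold (n ℕ.* 2) rᵢ
      qⱼ = fold (n ℕ.* 2) rⱼ

    -- The triples (0, 0, 0) and (1, 1, 0) give 1, while (1, 0, 0) and (1, 1, 1) give 0. These are
    -- the four cases of `entry-correct`.
    value : ∀ {x y z} → δ (coordp i) (coordp j) ≡ x → δ qᵢ qⱼ ≡ y → δ rᵢ rⱼ ≡ z →
            adjacency n i j ≡ (1ℤ ℤ.- x) ℤ.+ (y ℤ.- z)
    value eqx eqy eqz = cong₂ ℤ._+_ (cong (ℤ._-_ 1ℤ) eqx) (cong₂ ℤ._-_ eqy eqz)

    q≡q′ : coordp i ≡ coordp j → coordc i ≡ coordc j → qᵢ ≡ qⱼ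
    q≡q′ p≡p′ c≡c′ = ≡.trans (≡.sym (Fin.combine-remQuot {n} 2 qᵢ))
      (≡.trans (cong₂ combine c≡c′ p≡p′) (Fin.combine-remQuot {n} 2 qⱼ))

    δ-≡ : ∀ {N} {k l : Fin N} → k ≡ l → δ k l ≡ 1ℤ
    δ-≡ {k = k} ≡.refl = δ-refl k

    entry-correct : (Adjacent × adjacency n i j ≡ 1ℤ) ⊎ (¬ Adjacent × adjacency n i j ≡ 0ℤ)
    entry-correct = cases (coordp i Fin.≟ coordp j) (coordc i Fin.≟ coordc j) (coordβ i Fin.≟ coordβ j)
      where
      cases : Dec (coordp i ≡ coordp j) → Dec (coordc i ≡ coordc j) → Dec (coordβ i ≡ coordβ j) →
              (Adjacent × adjacency n i j ≡ 1ℤ) ⊎ (¬ Adjacent × adjacency n i j ≡ 0ℤ)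
      cases (no p≢p′) _ _ = inj₁ (p≢⇒adjacent p≢p′ ,
        value (δ-≢ p≢p′) (δ-≢ (p≢p′ ∘ cong (bit n))) (δ-≢ (p≢p′ ∘ cong (bit n ∘ fold (n ℕ.* 2)))))
      cases (yes p≡p′) (no c≢c′) _ = inj₂ (c≢c′ ∘ proj₁ ∘ adjacent⇒ p≡p′ ,
        value (δ-≡ p≡p′) (δ-≢ (c≢c′ ∘ cong (quotient 2)))
          (δ-≢ (c≢c′ ∘ cong (quotient 2 ∘ fold (n ℕ.* 2)))))
      cases (yes p≡p′) (yes c≡c′) (no β≢β′) = inj₁ (β≢⇒adjacent p≡p′ c≡c′ β≢β′ ,
        value (δ-≡ p≡p′) (δ-≡ (q≡q′ p≡p′ c≡c′)) (δ-≢ (β≢β′ ∘ cong (highBit (n ℕ.* 2)))))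
      cases (yes p≡p′) (yes c≡c′) (yes β≡β′) =
        inj₂ ((λ adj → proj₂ (adjacent⇒ p≡p′ adj) β≡β′) ,
        value (δ-≡ p≡p′) (δ-≡ (q≡q′ p≡p′ c≡c′)) (δ-≡ (fold-injective (n ℕ.* 2) β≡β′ (q≡q′ p≡p′ c≡c′))))

  adjacencyMatrix : AdjacencyMatrix Γ
  adjacencyMatrix = record
    { size      = size n
    ; numbering = numbering
    ; entry     = adjacency n
    ; entry-≡   = entry-correct
    }

-- Eigenvalues in a Heyting field

distinctEigenvalues : ℤ → List ℤ
distinctEigenvalues 4n = 4n ℤ.+ + 2 ∷ - 4n ℤ.+ + 2 ∷ + 2 ∷ - + 2 ∷ 0ℤ ∷ []

module Scalars (K : HeytingField 0ℓ 0ℓ 0ℓ) where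
  private module K = HeytingField K
  open HeytingField K using (Carrier; _≈_; _#_; _+_; _*_; 0#; 1#)

  commutativeRing : CommutativeRing 0ℓ 0ℓ
  commutativeRing = HeytingCommutativeRing.commutativeRing K.heytingCommutativeRing

  open CommutativeRing commutativeRing using (ring; +-group; setoid; semiring; commutativeSemiring)
  open RingProperties ring using (-‿distribˡ-*)
  open SemiringSolver commutativeSemiring using (solve; _:+_; _:*_; _:=_)
  open SemiringSum semiring using (sum-cong-≋)
    renaming (sum to sumᴷ; ∑-distrib-+ to sumᴷ-+; *-distribˡ-sum to *-distribˡ-sumᴷ)
  open IntegerPowers +-group using (pow; pow-+; pow-neg)
  open SetoidReasoning setoid

  ι : ℤ → Carrier
  ι = fromℤ (rawRing K)

  -- Seeing `ι` as integer powers of `1#` in the additive group yields its additivity from the laws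
  -- of powers, without cases on signs.
  ι≈pow : ∀ z → ι z ≈ pow 1# z
  ι≈pow (+ k)    = K.refl
  ι≈pow -[1+ k ] = K.refl

  ι-+ : ∀ y z → ι (y ℤ.+ z) ≈ ι y + ι z
  ι-+ y z = begin
    ι (y ℤ.+ z)            ≈⟨ ι≈pow (y ℤ.+ z) ⟩
    pow 1# (y ℤ.+ z)       ≈⟨ pow-+ 1# y z ⟩
    pow 1# y + pow 1# z    ≈⟨ K.+-cong (ι≈pow y) (ι≈pow z) ⟨
    ι y + ι z              ∎

  ι-neg : ∀ z → ι (- z) ≈ K.- ι z
  ι-neg z = begin
    ι (- z)          ≈⟨ ι≈pow (- z) ⟩
    pow 1# (- z)     ≈⟨ pow-neg 1# z ⟩
    K.- pow 1# z     ≈⟨ K.-‿cong (ι≈pow z) ⟨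
    K.- ι z          ∎

  ι-+-* : ∀ y z x → ι (y ℤ.+ z) * x ≈ ι y * x + ι z * x
  ι-+-* y z x = K.trans (K.*-congʳ (ι-+ y z)) (K.distribʳ x (ι y) (ι z))

  ι-neg-* : ∀ z x → ι (- z) * x ≈ K.- (ι z * x)
  ι-neg-* z x = K.trans (K.*-congʳ (ι-neg z)) (K.sym (-‿distribˡ-* (ι z) x))

  ι1-* : ∀ x → ι 1ℤ * x ≈ x
  ι1-* x = K.trans (K.*-congʳ (K.+-identityʳ 1#)) (K.*-identityˡ x)

  ι2-* : ∀ x → ι (+ 2) * x ≈ x + x
  ι2-* x = K.trans (ι-+-* 1ℤ 1ℤ x) (K.+-cong (ι1-* x) (ι1-* x))

  -- In a Heyting field apartness amounts to invertibility of the difference, and invertibility can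
  -- be transported along an equation between differences.
  apart-from-zero : ∀ {x y z} → x # 0# → x ≈ y + (K.- z) → y # z
  apart-from-zero {x} {y} {z} x#0 x≈y-z with inv , invˡ , invʳ ← K.#⇒invertible x#0 =
    K.invertible⇒# (inv , K.trans (K.*-congˡ y-z≈x-0) invˡ , K.trans (K.*-congʳ y-z≈x-0) invʳ)
    where
    y-z≈x-0 : y + (K.- z) ≈ x + (K.- 0#)
    y-z≈x-0 = begin
      y + (K.- z)      ≈⟨ x≈y-z ⟨
      x                ≈⟨ K.+-identityʳ x ⟨
      x + 0#           ≈⟨ K.+-congˡ (RingProperties.-0#≈0# ring) ⟨
      x + (K.- 0#)     ∎

  cancel-eigenvalue : ∀ {μ c z} → μ # c → μ * z ≈ c * z → z ≈ 0#
  cancel-eigenvalue {μ} {c} {z} μ#c μz≈cz with inv , invˡ , _ ← K.#⇒invertible μ#c = begin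
    z                               ≈⟨ K.*-identityˡ z ⟨
    1# * z                          ≈⟨ K.*-congʳ invˡ ⟨
    (inv * (μ + (K.- c))) * z       ≈⟨ K.*-assoc inv (μ + (K.- c)) z ⟩
    inv * ((μ + (K.- c)) * z)       ≈⟨ K.*-congˡ (K.distribʳ z μ (K.- c)) ⟩
    inv * (μ * z + (K.- c) * z)     ≈⟨ K.*-congˡ (K.+-cong μz≈cz (K.sym (-‿distribˡ-* c z))) ⟩
    inv * (c * z + (K.- (c * z)))   ≈⟨ K.*-congˡ (K.-‿inverseʳ (c * z)) ⟩
    inv * 0#                        ≈⟨ K.zeroʳ inv ⟩
    0#                              ∎

  module _ (char0 : CharacteristicZero K) where

    ι-apart : ∀ {c d} → c ≢ d → ι c # ι d
    ι-apart {c} {d} c≢d with c ℤ.- d in eq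
    ... | + zero    = ⊥-elim (c≢d (ℤ.i-j≡0⇒i≡j c d eq))
    ... | + suc k   = apart-from-zero (char0 k) (K.trans (K.reflexive (cong ι (≡.sym eq)))
                        (K.trans (ι-+ c (- d)) (K.+-congˡ (ι-neg d))))
    ... | -[1+ k ]  = K.#-sym (apart-from-zero (char0 k) (K.trans (K.reflexive (cong ι flipped))
                        (K.trans (ι-+ d (- c)) (K.+-congˡ (ι-neg c)))))
      where
      flip : ∀ c d → d ℤ.- c ≡ - (c ℤ.- d)
      flip = solve-∀
      flipped : + suc k ≡ d ℤ.- c
      flipped = ≡.sym (≡.trans (flip c d) (cong -_ eq))

    -- By cotransitivity, μ is apart from all but at most one of finitely many integers.
    isolate : ∀ μ cs → ∃[ c ] All (λ d → d ≡ c ⊎ μ # ι d) cs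
    -- With no values to avoid, any integer can serve as the exception.
    isolate μ []       = 0ℤ , []
    isolate μ (d ∷ cs) with isolate μ cs
    ... | c , apart with d ℤ.≟ c
    ...   | yes d≡c = c , inj₁ d≡c ∷ apart
    ...   | no  d≢c with K.#-cotrans (ι-apart d≢c) μ
    ...     | inj₁ d#μ = c , inj₂ (K.#-sym d#μ) ∷ apart
    -- Now `μ` is apart from the former exception too, so the new value `d` can become the only
    -- exception.
    ...     | inj₂ μ#c = d , inj₁ ≡.refl ∷ All.map inj₂ (All.map (λ { (inj₁ ≡.refl) → μ#c ; (inj₂ μ#e) → μ#e }) apart)

    -- `isolate` leaves one candidate c. Apartness of `μ` from c would complete apartness from the
    -- whole list, so it is refuted, and tightness of apartness turns this into equality.
    integer-if-not-all-apart : ∀ μ cs → ¬ All (λ d → μ # ι d) cs → ∃[ c ] μ ≈ ι c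
    integer-if-not-all-apart μ cs ¬apart with isolate μ cs
    ... | c , apart = c , proj₁ (K.tight μ (ι c)) λ μ#c →
      ¬apart (All.map (λ { (inj₁ ≡.refl) → μ#c ; (inj₂ μ#d) → μ#d }) apart)

  -- Class sums of an eigenvector

  sumᴷ-split : ∀ M {N} (f : Fin (M ℕ.+ N) → Carrier) →
              sumᴷ f ≈ sumᴷ (λ i → f (i ↑ˡ N)) + sumᴷ (λ i → f (M ↑ʳ i))
  sumᴷ-split zero    f = K.sym (K.+-identityˡ (sumᴷ f))
  sumᴷ-split (suc M) f = K.trans (K.+-congˡ (sumᴷ-split M (f ∘ suc))) (K.sym (K.+-assoc _ _ _))

  foldSum : ∀ {N} → (Fin (N ℕ.+ N) → Carrier) → Fin N → Carrier
  foldSum {N} v i = v (i ↑ˡ N) + v (N ↑ʳ i)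

  sumᴷ-fold : ∀ {N} (f : Fin N → Carrier) (v : Fin (N ℕ.+ N) → Carrier) →
             sumᴷ (λ i → f (fold N i) * v i) ≈ sumᴷ (λ i → f i * foldSum v i)
  sumᴷ-fold {N} f v = begin
    sumᴷ (λ i → f (fold N i) * v i)
      ≈⟨ sumᴷ-split N (λ i → f (fold N i) * v i) ⟩
    sumᴷ (λ i → f (fold N (i ↑ˡ N)) * v (i ↑ˡ N)) + sumᴷ (λ i → f (fold N (N ↑ʳ i)) * v (N ↑ʳ i))
      ≈⟨ sumᴷ-+ (λ i → f (fold N (i ↑ˡ N)) * v (i ↑ˡ N)) (λ i → f (fold N (N ↑ʳ i)) * v (N ↑ʳ i)) ⟨
    sumᴷ (λ i → f (fold N (i ↑ˡ N)) * v (i ↑ˡ N) + f (fold N (N ↑ʳ i)) * v (N ↑ʳ i))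
      ≈⟨ sum-cong-≋ (λ i → K.trans
           (K.+-cong (K.*-congʳ (K.reflexive (cong f (fold-↑ˡ i)))) (K.*-congʳ (K.reflexive (cong f (fold-↑ʳ i)))))
           (K.sym (K.distribˡ (f i) (v (i ↑ˡ N)) (v (N ↑ʳ i))))) ⟩
    sumᴷ (λ i → f i * foldSum v i) ∎

  sumᴷ-ιδ : ∀ {N} (i : Fin N) (v : Fin N → Carrier) → sumᴷ (λ j → ι (δ i j) * v j) ≈ v i
  sumᴷ-ιδ zero v = begin
    ι 1ℤ * v zero + sumᴷ (λ j → 0# * v (suc j))
      ≈⟨ K.+-cong (ι1-* (v zero)) (K.sym (*-distribˡ-sumᴷ 0# (v ∘ suc))) ⟩
    v zero + 0# * sumᴷ (v ∘ suc)
      ≈⟨ K.+-congˡ (K.zeroˡ _) ⟩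
    v zero + 0#
      ≈⟨ K.+-identityʳ (v zero) ⟩
    v zero ∎
  sumᴷ-ιδ (suc i) v = begin
    0# * v zero + sumᴷ (λ j → ι (δ (suc i) (suc j)) * v (suc j))
      ≈⟨ K.+-cong (K.zeroˡ (v zero)) (sum-cong-≋ λ j → K.*-congʳ (K.reflexive (cong ι (δ-suc i j)))) ⟩
    0# + sumᴷ (λ j → ι (δ i j) * v (suc j))
      ≈⟨ K.+-identityˡ _ ⟩
    sumᴷ (λ j → ι (δ i j) * v (suc j))
      ≈⟨ sumᴷ-ιδ i (v ∘ suc) ⟩
    v (suc i) ∎

  sumᴷ-ι-+ : ∀ {N} (y z : Fin N → ℤ) (v : Fin N → Carrier) →
            sumᴷ (λ j → ι (y j ℤ.+ z j) * v j) ≈ sumᴷ (λ j → ι (y j) * v j) + sumᴷ (λ j → ι (z j) * v j)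
  sumᴷ-ι-+ y z v = K.trans (sum-cong-≋ λ j → ι-+-* (y j) (z j) (v j))
    (sumᴷ-+ (λ j → ι (y j) * v j) (λ j → ι (z j) * v j))

  sumᴷ-bits : ∀ n (f : Fin 2 → Carrier) →
             sumᴷ (λ q → f (bit n q)) ≈ ι (+ n) * (f zero + f (suc zero))
  sumᴷ-bits zero    f = K.sym (K.zeroˡ _)
  sumᴷ-bits (suc n) f = begin
    f zero + (f (suc zero) + sumᴷ (λ q → f (bit n q)))
      ≈⟨ K.+-congˡ (K.+-congˡ (sumᴷ-bits n f)) ⟩
    f zero + (f (suc zero) + ι (+ n) * (f zero + f (suc zero)))
      ≈⟨ K.+-assoc (f zero) (f (suc zero)) _ ⟨
    (f zero + f (suc zero)) + ι (+ n) * (f zero + f (suc zero))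
      ≈⟨ K.+-congʳ (ι1-* (f zero + f (suc zero))) ⟨
    ι 1ℤ * (f zero + f (suc zero)) + ι (+ n) * (f zero + f (suc zero))
      ≈⟨ ι-+-* 1ℤ (+ n) (f zero + f (suc zero)) ⟨
    ι (+ suc n) * (f zero + f (suc zero)) ∎

  module Eigenvector (n : ℕ) (μ : Carrier) (v : Fin (size n) → Carrier)
    (eigen : ∀ i → sumᴷ (λ j → ι (adjacency n i j) * v j) ≈ μ * v i) where

    V : Fin (half n) → Carrier
    V = foldSum v

    W : Fin (n ℕ.* 2) → Carrier
    W = foldSum V

    -- `V` sums the vector over α, and `W` over α and β. `X p` sums `W` over the side of K_{n,n}
    -- opposite to `p`, so its two values are the sums over the two halves of the graph.
    X : Fin 2 → Carrier
    X p = sumᴷ (λ q → ι (distinct p (bit n q)) * W q)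

    -- Adding `V r` cancels the summand `- δ r r′` of `halfEntry`; the rest of the row depends on
    -- folded indices only, so it sees just `W`. With no negative terms left, the later
    -- rearrangements are semiring identities.
    halfRow : ∀ r → let q = fold (n ℕ.* 2) r in
      sumᴷ (λ r′ → ι (halfEntry n r r′) * V r′) + V r ≈ X (bit n q) + W q
    halfRow r = begin
      sumᴷ (λ r′ → ι (halfEntry n r r′) * V r′) + V r
        ≈⟨ K.+-congˡ (sumᴷ-ιδ r V) ⟨
      sumᴷ (λ r′ → ι (halfEntry n r r′) * V r′) + sumᴷ (λ r′ → ι (δ r r′) * V r′)
        ≈⟨ sumᴷ-ι-+ (halfEntry n r) (δ r) V ⟨
      sumᴷ (λ r′ → ι (halfEntry n r r′ ℤ.+ δ r r′) * V r′)
        ≈⟨ sum-cong-≋ (λ r′ → K.*-congʳ (K.reflexive (cong ι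
             (cancel (quarterEntry n q (fold (n ℕ.* 2) r′)) (δ q (fold (n ℕ.* 2) r′)) (δ r r′))))) ⟩
      sumᴷ (λ r′ → ι (quarterEntry n q (fold (n ℕ.* 2) r′) ℤ.+ δ q (fold (n ℕ.* 2) r′)) * V r′)
        ≈⟨ sumᴷ-fold (λ q′ → ι (quarterEntry n q q′ ℤ.+ δ q q′)) V ⟩
      sumᴷ (λ q′ → ι (quarterEntry n q q′ ℤ.+ δ q q′) * W q′)
        ≈⟨ sumᴷ-ι-+ (quarterEntry n q) (δ q) W ⟩
      X (bit n q) + sumᴷ (λ q′ → ι (δ q q′) * W q′)
        ≈⟨ K.+-congˡ (sumᴷ-ιδ q W) ⟩
      X (bit n q) + W q ∎
      where
      q = fold (n ℕ.* 2) r
      cancel : ∀ e d d′ → (e ℤ.+ (d ℤ.- d′)) ℤ.+ d′ ≡ e ℤ.+ d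
      cancel = solve-∀

    eigen-v : ∀ i → let r = fold (half n) i ; q = fold (n ℕ.* 2) r in
              μ * v i + V r ≈ X (bit n q) + W q
    eigen-v i = begin
      μ * v i + V r
        ≈⟨ K.+-congʳ (eigen i) ⟨
      sumᴷ (λ j → ι (halfEntry n r (fold (half n) j)) * v j) + V r
        ≈⟨ K.+-congʳ (sumᴷ-fold (λ r′ → ι (halfEntry n r r′)) v) ⟩
      sumᴷ (λ r′ → ι (halfEntry n r r′) * V r′) + V r
        ≈⟨ halfRow r ⟩
      X (bit n (fold (n ℕ.* 2) r)) + W (fold (n ℕ.* 2) r) ∎
      where r = fold (half n) i

    eigen-V : ∀ r → let q = fold (n ℕ.* 2) r in
              μ * V r + (V r + V r) ≈ (X (bit n q) + W q) + (X (bit n q) + W q)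
    eigen-V r = begin
      μ * (v i₁ + v i₂) + (V r + V r)
        ≈⟨ solve 4 (λ μ x y z → μ :* (x :+ y) :+ (z :+ z) := (μ :* x :+ z) :+ (μ :* y :+ z))
             K.refl μ (v i₁) (v i₂) (V r) ⟩
      (μ * v i₁ + V r) + (μ * v i₂ + V r)
        ≈⟨ K.+-cong (at i₁ (fold-↑ˡ r)) (at i₂ (fold-↑ʳ r)) ⟩
      (X (bit n q) + W q) + (X (bit n q) + W q) ∎
      where
      q = fold (n ℕ.* 2) r
      i₁ = r ↑ˡ half n
      i₂ = half n ↑ʳ r
      at : ∀ i → fold (half n) i ≡ r → μ * v i + V r ≈ X (bit n q) + W q
      at i ≡.refl = eigen-v i

    -- Adding `eigen-V` over the two values of β and cancelling 2 W gives (μ - 2) W = 4 X.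
    eigen-W : ∀ q → let x = X (bit n q) in μ * W q ≈ ((x + x) + (x + x)) + (W q + W q)
    eigen-W q = RingProperties.+-cancelʳ ring (W q + W q) (μ * W q) _ (begin
      μ * (V r₁ + V r₂) + (W q + W q)
        ≈⟨ solve 3 (λ μ x y → μ :* (x :+ y) :+ ((x :+ y) :+ (x :+ y)) :=
                              (μ :* x :+ (x :+ x)) :+ (μ :* y :+ (y :+ y)))
             K.refl μ (V r₁) (V r₂) ⟩
      (μ * V r₁ + (V r₁ + V r₁)) + (μ * V r₂ + (V r₂ + V r₂))
        ≈⟨ K.+-cong (at r₁ (fold-↑ˡ q)) (at r₂ (fold-↑ʳ q)) ⟩
      ((x + W q) + (x + W q)) + ((x + W q) + (x + W q))
        ≈⟨ solve 2 (λ x w → ((x :+ w) :+ (x :+ w)) :+ ((x :+ w) :+ (x :+ w)) :=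
                            (((x :+ x) :+ (x :+ x)) :+ (w :+ w)) :+ (w :+ w))
             K.refl x (W q) ⟩
      (((x + x) + (x + x)) + (W q + W q)) + (W q + W q) ∎)
      where
      x = X (bit n q)
      r₁ = q ↑ˡ (n ℕ.* 2)
      r₂ = (n ℕ.* 2) ↑ʳ q
      at : ∀ r → fold (n ℕ.* 2) r ≡ q → μ * V r + (V r + V r) ≈ (x + W q) + (x + W q)
      at r ≡.refl = eigen-V r

    -- `eigen-W` is summed over the side opposite to `p`. Each parity occurs n times among the
    -- indices, so y is n times `X` at the other parity and the coupling has strength 4n.
    eigen-X : ∀ p → let y = ι (+ n) * (ι (distinct p zero) * X zero + ι (distinct p (suc zero)) * X (suc zero)) in
              μ * X p ≈ ((y + y) + (y + y)) + (X p + X p)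
    eigen-X p = begin
      μ * X p
        ≈⟨ *-distribˡ-sumᴷ μ (λ q → d q * W q) ⟩
      sumᴷ (λ q → μ * (d q * W q))
        ≈⟨ sum-cong-≋ (λ q → begin
             μ * (d q * W q)
               ≈⟨ solve 3 (λ μ d w → μ :* (d :* w) := d :* (μ :* w)) K.refl μ (d q) (W q) ⟩
             d q * (μ * W q)
               ≈⟨ K.*-congˡ (eigen-W q) ⟩
             d q * (((x q + x q) + (x q + x q)) + (W q + W q))
               ≈⟨ solve 3 (λ d x w → d :* (((x :+ x) :+ (x :+ x)) :+ (w :+ w)) :=
                    ((d :* x :+ d :* x) :+ (d :* x :+ d :* x)) :+ (d :* w :+ d :* w))
                    K.refl (d q) (x q) (W q) ⟩
             ((d q * x q + d q * x q) + (d q * x q + d q * x q)) + (d q * W q + d q * W q) ∎) ⟩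
      sumᴷ (λ q → ((d q * x q + d q * x q) + (d q * x q + d q * x q)) + (d q * W q + d q * W q))
        ≈⟨ sumᴷ-+ (λ q → (d q * x q + d q * x q) + (d q * x q + d q * x q)) (λ q → d q * W q + d q * W q) ⟩
      sumᴷ (λ q → (d q * x q + d q * x q) + (d q * x q + d q * x q)) + sumᴷ (λ q → d q * W q + d q * W q)
        ≈⟨ K.+-cong (K.trans (sumᴷ-double (λ q → d q * x q + d q * x q)) (K.+-cong dx-double dx-double))
                    (sumᴷ-double (λ q → d q * W q)) ⟩
      ((y + y) + (y + y)) + (X p + X p) ∎
      where
      d x : Fin (n ℕ.* 2) → Carrier
      d q = ι (distinct p (bit n q))
      x q = X (bit n q)
      y = ι (+ n) * (ι (distinct p zero) * X zero + ι (distinct p (suc zero)) * X (suc zero))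
      sumᴷ-double : ∀ {N} (f : Fin N → Carrier) → sumᴷ (λ i → f i + f i) ≈ sumᴷ f + sumᴷ f
      sumᴷ-double f = sumᴷ-+ f f
      dx-double : sumᴷ (λ q → d q * x q + d q * x q) ≈ y + y
      dx-double = K.trans (sumᴷ-double (λ q → d q * x q)) (K.+-cong total total)
        where
        total : sumᴷ (λ q → d q * x q) ≈ y
        total = sumᴷ-bits n (λ p′ → ι (distinct p p′) * X p′)

    -- Written as a double of a double to match the four copies of y in `eigen-X`.
    4n : ℤ
    4n = (+ n ℤ.+ + n) ℤ.+ (+ n ℤ.+ + n)

    ι4n-* : ∀ z → ι 4n * z ≈ (ι (+ n) * z + ι (+ n) * z) + (ι (+ n) * z + ι (+ n) * z)
    ι4n-* z = K.trans (ι-+-* (+ n ℤ.+ + n) (+ n ℤ.+ + n) z)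
      (K.+-cong (ι-+-* (+ n) (+ n) z) (ι-+-* (+ n) (+ n) z))

    eigen-X₀ : μ * X zero ≈ ι 4n * X (suc zero) + ι (+ 2) * X zero
    eigen-X₀ = K.trans (eigen-X zero) (K.+-cong (K.trans
      (K.+-cong (K.+-cong y y) (K.+-cong y y)) (K.sym (ι4n-* (X (suc zero))))) (K.sym (ι2-* (X zero))))
      where
      y = K.*-congˡ {ι (+ n)} (K.trans (K.+-cong (K.zeroˡ (X zero)) (ι1-* (X (suc zero)))) (K.+-identityˡ _))

    eigen-X₁ : μ * X (suc zero) ≈ ι 4n * X zero + ι (+ 2) * X (suc zero)
    eigen-X₁ = K.trans (eigen-X (suc zero)) (K.+-cong (K.trans
      (K.+-cong (K.+-cong y y) (K.+-cong y y)) (K.sym (ι4n-* (X zero)))) (K.sym (ι2-* (X (suc zero)))))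
      where
      y = K.*-congˡ {ι (+ n)} (K.trans (K.+-cong (ι1-* (X zero)) (K.zeroˡ (X (suc zero)))) (K.+-identityʳ _))

    -- Each value disposes of one level: 4n + 2 of the sum of the two `X`, -4n + 2 of `X zero`, then
    -- 2 of `W`, -2 of `V` and 0 of `v`. Once the coarser sums vanish, the equation of the next
    -- level has the form μ z = c z.
    zero-vector : All (λ c → μ # ι c) (distinctEigenvalues 4n) → ∀ i → v i ≈ 0#
    zero-vector (μ#4n+2 ∷ μ#-4n+2 ∷ μ#2 ∷ μ#-2 ∷ μ#0 ∷ []) i =
      cancel-eigenvalue μ#0 (begin
        μ * v i                ≈⟨ K.+-identityʳ (μ * v i) ⟨
        μ * v i + 0#           ≈⟨ K.+-congˡ (V≈0 r) ⟨
        μ * v i + V r          ≈⟨ eigen-v i ⟩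
        X (bit n q) + W q      ≈⟨ K.+-cong (X≈0 (bit n q)) (W≈0 q) ⟩
        0# + 0#                ≈⟨ K.+-identityˡ 0# ⟩
        0#                     ≈⟨ K.zeroˡ (v i) ⟨
        0# * v i               ∎)
      where
      r = fold (half n) i
      q = fold (n ℕ.* 2) r
      X₀+X₁≈0 : X zero + X (suc zero) ≈ 0#
      X₀+X₁≈0 = cancel-eigenvalue μ#4n+2 (begin
        μ * (X zero + X (suc zero))
          ≈⟨ K.distribˡ μ (X zero) (X (suc zero)) ⟩
        μ * X zero + μ * X (suc zero)
          ≈⟨ K.+-cong eigen-X₀ eigen-X₁ ⟩
        (ι 4n * X (suc zero) + ι (+ 2) * X zero) + (ι 4n * X zero + ι (+ 2) * X (suc zero))
          ≈⟨ solve 4 (λ f t x y → (f :* y :+ t :* x) :+ (f :* x :+ t :* y) := (f :+ t) :* (x :+ y))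
               K.refl (ι 4n) (ι (+ 2)) (X zero) (X (suc zero)) ⟩
        (ι 4n + ι (+ 2)) * (X zero + X (suc zero))
          ≈⟨ K.*-congʳ (ι-+ 4n (+ 2)) ⟨
        ι (4n ℤ.+ + 2) * (X zero + X (suc zero)) ∎)
      X₁≈-X₀ : X (suc zero) ≈ K.- X zero
      X₁≈-X₀ = RingProperties.+-inverseʳ-unique ring (X zero) (X (suc zero)) X₀+X₁≈0
      X₀≈0 : X zero ≈ 0#
      X₀≈0 = cancel-eigenvalue μ#-4n+2 (begin
        μ * X zero
          ≈⟨ eigen-X₀ ⟩
        ι 4n * X (suc zero) + ι (+ 2) * X zero
          ≈⟨ K.+-congʳ (K.*-congˡ X₁≈-X₀) ⟩
        ι 4n * (K.- X zero) + ι (+ 2) * X zero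
          ≈⟨ K.+-congʳ (RingProperties.-‿distribʳ-* ring (ι 4n) (X zero)) ⟨
        K.- (ι 4n * X zero) + ι (+ 2) * X zero
          ≈⟨ K.+-congʳ (ι-neg-* 4n (X zero)) ⟨
        ι (- 4n) * X zero + ι (+ 2) * X zero
          ≈⟨ ι-+-* (- 4n) (+ 2) (X zero) ⟨
        ι (- 4n ℤ.+ + 2) * X zero ∎)
      X≈0 : ∀ p → X p ≈ 0#
      X≈0 zero       = X₀≈0
      X≈0 (suc zero) = K.trans X₁≈-X₀ (K.trans (K.-‿cong X₀≈0) (RingProperties.-0#≈0# ring))
      W≈0 : ∀ q → W q ≈ 0#
      W≈0 q = cancel-eigenvalue μ#2 (begin
        μ * W q
          ≈⟨ eigen-W q ⟩
        ((x + x) + (x + x)) + (W q + W q)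
          ≈⟨ K.+-cong (K.+-cong x+x≈0 x+x≈0) (K.sym (ι2-* (W q))) ⟩
        (0# + 0#) + ι (+ 2) * W q
          ≈⟨ K.+-congʳ (K.+-identityˡ 0#) ⟩
        0# + ι (+ 2) * W q
          ≈⟨ K.+-identityˡ _ ⟩
        ι (+ 2) * W q ∎)
        where
        x = X (bit n q)
        x+x≈0 : x + x ≈ 0#
        x+x≈0 = K.trans (K.+-cong (X≈0 (bit n q)) (X≈0 (bit n q))) (K.+-identityˡ 0#)
      V≈0 : ∀ r → V r ≈ 0#
      V≈0 r = cancel-eigenvalue μ#-2 (K.trans
        (RingProperties.+-inverseˡ-unique ring (μ * V r) (V r + V r) (begin
          μ * V r + (V r + V r)
            ≈⟨ eigen-V r ⟩
          (X p + W q′) + (X p + W q′)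
            ≈⟨ K.+-cong x+w≈0 x+w≈0 ⟩
          0# + 0#
            ≈⟨ K.+-identityˡ 0# ⟩
          0# ∎))
        (K.sym (K.trans (ι-neg-* (+ 2) (V r)) (K.-‿cong (ι2-* (V r))))))
        where
        q′ = fold (n ℕ.* 2) r
        p = bit n q′
        x+w≈0 : X p + W q′ ≈ 0#
        x+w≈0 = K.trans (K.+-cong (X≈0 p) (W≈0 q′)) (K.+-identityˡ 0#)

-- Integrality and the final result

adjacency-integral : ∀ n → AllEigenvaluesIntegral (adjacency n)
adjacency-integral n K char0 μ (v , (i , vᵢ#0) , eigen) =
  integer-if-not-all-apart char0 μ (distinctEigenvalues 4n) λ apart →
    HeytingField.#-irrefl K (zero-vector apart i) vᵢ#0
  where
  open Scalars K
  open Eigenvector n μ v eigen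

corollary5p2 : (n : ℕ) → .{{_ : NonZero n}} →
    Σ[ isConn ∈ IsConnectionSet (T n) (S n) ]
    ( IsNormalCayley (T n) (S n) isConn
    × Connected (Cay (T n) (S n) isConn)
    × Integral (Cay (T n) (S n) isConn)
    × HasSpectrum (Cay (T n) (S n) isConn)
    ( (- (+ (4 ℕ.* n)) ℤ.+ + 2)
    ∷ (+ (4 ℕ.* n) ℤ.+ + 2)
    ∷ replicate (2 ℕ.* n ∸ 2) (+ 2)
    ++ replicate (2 ℕ.* n) (- (+ 2))
    ++ replicate (4 ℕ.* n) (+ 0) ) )
corollary5p2 zero    = ⊥-elim (ℕ.≢-nonZero⁻¹ 0 ≡.refl)
corollary5p2 (suc m) =
  isConnectionSet , isNormalCayley , connected
  , (adjacencyMatrix , adjacency-integral (suc m))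
  , (adjacencyMatrix , adjacency-spectrum m)
  where
  open ConnectionSet (suc m)
  open Vertices m
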